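{- Let $0\le k\le n$, $n\ge1$. For Young diagrams $\lambda,\mu$ in the $k\times(n-k)$ rectangle, let $c^{\lambda,\mu}_{\,\,\nu}(\vec y)$ be the coefficients defined by the identity in $K_T(Gr(k,n))$ $$G^\lambda(\bar x;\vec y)\,G^\mu(\bar x;\vec y)=\sum_\nu c^{\lambda,\mu}_{\,\,\nu}(\vec y)\,G^\nu(\bar x;\vec y),$$ where $\nu$ runs over Young diagrams in the $k\times(n-k)$ rectangle. Then for all such $\lambda,\mu,\nu$, $c^{\lambda,\mu}_{\,\,\nu}(\vec y)$ equals the sum of the weights of all equivariant puzzles in an up-pointing equilateral triangle of side $n$ whose boundary is as follows: the left side, read from the bottom-left corner to the top corner, encodes $\lambda$; the right side, read from the top corner to the bottom-right corner, encodes $\mu$; the bottom horizontal side, read from left to right, encodes $\nu$. Here the parameter of an elementary lozenge is $w=y_i/y_j$, where, numbering the unit edges of the bottom side $1,\dots,n$ from left to right, $j$ is the number of the bottom edge reached from the centre of the lozenge by going straight down-left (direction $240^\circ$), and $i$ is the number of the bottom edge reached from the centre by going straight down-right (direction $300^\circ$); thus $1\le j<i\le n$.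
   Context: **Young diagrams.** Fix $0\le k\le n$. A Young diagram $\lambda$ (English convention) in the $k\times(n-k)$ rectangle ($k$ rows, $n-k$ columns) is encoded by its frame, a $k$-subset of $\{1,\dots,n\}$: follow the border of $\lambda$ from the bottom-left to the top-right corner of the rectangle in $n$ unit steps (up or right), and record $i$ if the $i$-th step is up. So $\varnothing$ has frame $\{1,\dots,k\}$ and the full rectangle has frame $\{n-k+1,\dots,n\}$. **Polynomials.** Let $\bar x=(x_1,\dots,x_k)$, $\vec y=(y_1,\dots,y_n)$. The double Grothendieck polynomials $G^\lambda(\bar x;\vec y)$ are defined inductively by $G^{\{n-k+1,\dots,n\}}(\bar x;\vec y)=\prod_{i=1}^k\prod_{j=1}^{n-k}(1-x_i/y_j)$ and $G^\mu=D_iG^\lambda$ whenever the frame of $\mu$ is obtained from that of $\lambda$ by replacing $i+1$ with $i$, where $D_if=\dfrac{y_if(\ldots,y_i,y_{i+1},\ldots)-y_{i+1}f(\ldots,y_{i+1},y_i,\ldots)}{y_i-y_{i+1}}$ acts on the $y$ variables. **Ring.** $K_T(Gr(k,n))$ is the quotient of $\mathbb Z[x_1^{\pm1},\dots,x_k^{\pm1},y_1^{\pm1},\dots,y_n^{\pm1}]^{\mathcal S_k}$ ($\mathcal S_k$ permuting the $x_i$) by the ideal of elements that vanish whenever $(x_1,\dots,x_k)$ is specialized to $(y_{i_1},\dots,y_{i_k})$ for any $i_1<\dots<i_k$. It is known that the classes of the $G^\lambda(\bar x;\vec y)$ form a $\mathbb Z[y_1^{\pm1},\dots,y_n^{\pm1}]$-basis.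 **Equivariant puzzles.** Consider the triangular lattice of unit equilateral triangles with horizontal edges. Each unit triangle has a horizontal edge $h$, an edge $a$ in direction $60^\circ/240^\circ$ and an edge $b$ in direction $120^\circ/300^\circ$; for an up-pointing triangle $a$ is the left and $b$ the right edge; for a down-pointing triangle $a$ is the right and $b$ the left edge. Each edge has a state, a subset of $\{R,G\}$ (red, green), written $\emptyset,R,G,RG$. The allowed tiles, given by the states $(h,a,b)$, are $E=(\emptyset,\emptyset,\emptyset)$, $G_1=(G,G,\emptyset)$, $G_2=(G,RG,R)$, $R_1=(R,\emptyset,R)$, $R_2=(R,G,RG)$, $Q=(RG,G,R)$ (equivariant tile), for both up- and down-pointing triangles, and the $K$-tile $K=(\emptyset,RG,RG)$ for up-pointing triangles only. An equivariant puzzle in a domain is an assignment of an allowed tile to every unit triangle of the domain such that triangles sharing an edge assign it the same state. **Boundary conditions.** Horizontal boundary edges must be in state $R$ or $G$; boundary edges in direction $60^\circ/240^\circ$ in state $G$ or $\emptyset$; boundary edges in direction $120^\circ/300^\circ$ in state $R$ or $\emptyset$. A side of length $n$, read in a given direction, encodes the Young diagram whose frame is the set of positions (numbered $1,\dots,n$ along the reading direction) of the $G$ edges for horizontal and $60^\circ/240^\circ$ sides, and of the $\emptyset$ edges for $120^\circ/300^\circ$ sides. **Weights.** An elementary lozenge is the union of an up-pointing unit triangle and the down-pointing unit triangle just below it, sharing a horizontal edge, both in the domain. Its weight depends on a parameter $w$ (depending on its location) and on its (upper tile, lower tile): $(G_2,G_1)$ has weight $w$; $(R_2,R_1)$ has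 weight $w$; $(Q,Q)$ has weight $1-w$; $(K,E)$ has weight $-w$; all the others, $(G_1,G_1),(G_1,G_2),(G_2,G_2),(R_1,R_1),(R_1,R_2),(R_2,R_2),(E,E)$, have weight $1$. The weight of an equivariant puzzle is the product of the weights of all its elementary lozenges (unit triangles not belonging to an elementary lozenge contribute no factor). -}

module Defs where

open import Level using (0ℓ)
open import Data.Bool.Base using (if_then_else_)
open import Data.Nat.Base as ℕ using (ℕ; zero; suc; _∸_)
import Data.Nat.Properties as ℕ
open import Data.Fin.Base as Fin using (Fin; zero; suc; toℕ; inject₁; inject≤)
open import Data.Fin.Permutation using (Permutation′; _⟨$⟩ʳ_)
open import Data.Fin.Permutation.Components using (transpose)
open import Data.Fin.Properties using (all?)
open import Data.Fin.Subset using (Subset; inside; outside; ∣_∣; _∈_; _∉_; _∪_; _-_; ⁅_⁆)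
open import Data.List.Base as List using (List; []; _∷_; foldr; mapMaybe; filter; cartesianProductWith)
import Data.Maybe.Base as Maybe
open import Data.Product.Base using (Σ; _×_; _,_; proj₁; proj₂)
open import Data.Sum.Base as Sum using (_⊎_; inj₁; inj₂; [_,_]′)
open import Data.Unit.Base using (⊤; tt)
open import Data.Vec.Base as Vec using (Vec; []; _∷_; _∷ʳ_; lookup)
import Data.Vec.Properties as Vec
open import Function.Base using (_∘_; id)
open import Function.Bundles using (_⇔_)
open import Relation.Nullary using (Dec; yes; no)
open import Relation.Nullary.Decidable using (dec⇒maybe; _×-dec_)
open import Relation.Binary.Definitions using (DecidableEquality)
open import Relation.Binary.PropositionalEquality as ≡ using (_≡_; refl)
open import Algebra.Bundles using (CommutativeRing)
import Algebra.Properties.CommutativeMonoid.Sum as CMSum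

infixl 6 _⊕_
infixl 7 _⊗_
infix  8 ⊖_
infix  4 _≋_

-- ℤ[ a , a⁻¹ | a ∈ A ] by generators and relations: terms over the
-- generators, with equality the least congruence satisfying the
-- commutative ring axioms and a · a⁻¹ = 1.
data Laurent (A : Set) : Set where
  var inv : A → Laurent A
  𝟘 𝟙     : Laurent A
  _⊕_ _⊗_ : Laurent A → Laurent A → Laurent A
  ⊖_      : Laurent A → Laurent A

data _≋_ {A : Set} : Laurent A → Laurent A → Set where
  ≋-refl      : ∀ {f} → f ≋ f
  ≋-sym       : ∀ {f g} → f ≋ g → g ≋ f
  ≋-trans     : ∀ {f g h} → f ≋ g → g ≋ h → f ≋ h
  ⊕-cong      : ∀ {f f′ g g′} → f ≋ f′ → g ≋ g′ → f ⊕ g ≋ f′ ⊕ g′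
  ⊗-cong      : ∀ {f f′ g g′} → f ≋ f′ → g ≋ g′ → f ⊗ g ≋ f′ ⊗ g′
  ⊖-cong      : ∀ {f f′} → f ≋ f′ → ⊖ f ≋ ⊖ f′
  ⊕-assoc     : ∀ f g h → (f ⊕ g) ⊕ h ≋ f ⊕ (g ⊕ h)
  ⊕-comm      : ∀ f g → f ⊕ g ≋ g ⊕ f
  ⊕-identityˡ : ∀ f → 𝟘 ⊕ f ≋ f
  ⊖-inverseˡ  : ∀ f → ⊖ f ⊕ f ≋ 𝟘
  ⊗-assoc     : ∀ f g h → (f ⊗ g) ⊗ h ≋ f ⊗ (g ⊗ h)
  ⊗-comm      : ∀ f g → f ⊗ g ≋ g ⊗ f
  ⊗-identityˡ : ∀ f → 𝟙 ⊗ f ≋ f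
  ⊗-distribˡ  : ∀ f g h → f ⊗ (g ⊕ h) ≋ f ⊗ g ⊕ f ⊗ h
  var-inv     : ∀ a → var a ⊗ inv a ≋ 𝟙

laurentRing : Set → CommutativeRing 0ℓ 0ℓ
laurentRing A = record
  { Carrier = Laurent A
  ; _≈_ = _≋_
  ; _+_ = _⊕_
  ; _*_ = _⊗_
  ; -_  = ⊖_
  ; 0#  = 𝟘
  ; 1#  = 𝟙
  ; isCommutativeRing = record
    { isRing = record
      { +-isAbelianGroup = record
        { isGroup = record
          { isMonoid = record
            { isSemigroup = record
              { isMagma = record
                { isEquivalence = record
                  { refl = ≋-refl ; sym = ≋-sym ; trans = ≋-trans }
                ; ∙-cong = ⊕-cong }
              ; assoc = ⊕-assoc }
            ; identity = ⊕-identityˡ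
                       , λ f → ≋-trans (⊕-comm f 𝟘) (⊕-identityˡ f) }
          ; inverse = ⊖-inverseˡ
                    , λ f → ≋-trans (⊕-comm f (⊖ f)) (⊖-inverseˡ f)
          ; ⁻¹-cong = ⊖-cong }
        ; comm = ⊕-comm }
      ; *-cong = ⊗-cong
      ; *-assoc = ⊗-assoc
      ; *-identity = ⊗-identityˡ
                   , λ f → ≋-trans (⊗-comm f 𝟙) (⊗-identityˡ f)
      ; distrib = ⊗-distribˡ
                , λ f g h → ≋-trans (⊗-comm (g ⊕ h) f)
                    (≋-trans (⊗-distribˡ f g h)
                      (⊕-cong (⊗-comm f g) (⊗-comm f h)))
      }
    ; *-comm = ⊗-comm
    }
  }

infixl 6 _⊝_
_⊝_ : ∀ {A} → Laurent A → Laurent A → Laurent A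
f ⊝ g = f ⊕ ⊖ g

rename : ∀ {A B : Set} → (A → B) → Laurent A → Laurent B
rename ρ (var a) = var (ρ a)
rename ρ (inv a) = inv (ρ a)
rename ρ 𝟘       = 𝟘
rename ρ 𝟙       = 𝟙
rename ρ (f ⊕ g) = rename ρ f ⊕ rename ρ g
rename ρ (f ⊗ g) = rename ρ f ⊗ rename ρ g
rename ρ (⊖ f)   = ⊖ rename ρ f

rename-cong : ∀ {A B} (ρ : A → B) {f g} → f ≋ g → rename ρ f ≋ rename ρ g
rename-cong ρ ≋-refl              = ≋-refl
rename-cong ρ (≋-sym p)           = ≋-sym (rename-cong ρ p)
rename-cong ρ (≋-trans p q)       = ≋-trans (rename-cong ρ p) (rename-cong ρ q)
rename-cong ρ (⊕-cong p q)        = ⊕-cong (rename-cong ρ p) (rename-cong ρ q)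
rename-cong ρ (⊗-cong p q)        = ⊗-cong (rename-cong ρ p) (rename-cong ρ q)
rename-cong ρ (⊖-cong p)          = ⊖-cong (rename-cong ρ p)
rename-cong ρ (⊕-assoc f g h)     = ⊕-assoc _ _ _
rename-cong ρ (⊕-comm f g)        = ⊕-comm _ _
rename-cong ρ (⊕-identityˡ f)     = ⊕-identityˡ _
rename-cong ρ (⊖-inverseˡ f)      = ⊖-inverseˡ _
rename-cong ρ (⊗-assoc f g h)     = ⊗-assoc _ _ _
rename-cong ρ (⊗-comm f g)        = ⊗-comm _ _
rename-cong ρ (⊗-identityˡ f)     = ⊗-identityˡ _
rename-cong ρ (⊗-distribˡ f g h)  = ⊗-distribˡ _ _ _
rename-cong ρ (var-inv a)         = var-inv _

rename-inj₂ : ∀ {A A′ B : Set} (ρ : A → A′) (f : Laurent B) →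
              rename (Sum.map₁ ρ) (rename inj₂ f) ≡ rename inj₂ f
rename-inj₂ ρ (var a) = refl
rename-inj₂ ρ (inv a) = refl
rename-inj₂ ρ 𝟘       = refl
rename-inj₂ ρ 𝟙       = refl
rename-inj₂ ρ (f ⊕ g) = ≡.cong₂ _⊕_ (rename-inj₂ ρ f) (rename-inj₂ ρ g)
rename-inj₂ ρ (f ⊗ g) = ≡.cong₂ _⊗_ (rename-inj₂ ρ f) (rename-inj₂ ρ g)
rename-inj₂ ρ (⊖ f)   = ≡.cong ⊖_ (rename-inj₂ ρ f)

-- Index i : Fin k is the paper's x_{i+1}, and likewise for y.
Var : ℕ → ℕ → Set
Var k n = Fin k ⊎ Fin n

x : ∀ {k n} → Fin k → Laurent (Var k n)
x i = var (inj₁ i)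

y y⁻¹ : ∀ {k n} → Fin n → Laurent (Var k n)
y   j = var (inj₂ j)
y⁻¹ j = inv (inj₂ j)

module _ {A : Set} where
  open CommutativeRing (laurentRing A) using (*-commutativeMonoid)
  open CMSum *-commutativeMonoid public using () renaming (sum to ∏)

Symmetric : ∀ {k n} → Laurent (Var k n) → Set
Symmetric {k} f =
  ∀ (σ : Permutation′ k) → rename (Sum.map₁ (σ ⟨$⟩ʳ_)) f ≋ f

specialize : ∀ {k n} → (Fin k → Fin n) → Laurent (Var k n) → Laurent (Fin n)
specialize ι = rename [ ι , id ]′

Vanishing : ∀ {k n} → Laurent (Var k n) → Set
Vanishing {k} {n} f =
  ∀ (ι : Fin k → Fin n) → (∀ {a b} → a Fin.< b → ι a Fin.< ι b) →
  specialize ι f ≋ 𝟘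

module _ {A : Set} where
  open CommutativeRing (laurentRing A)
  open import Algebra.Properties.Group +-group
  ⊝⇒≋ : ∀ {f g : Laurent A} → f ⊝ g ≋ 𝟘 → f ≋ g
  ⊝⇒≋ = x∙y⁻¹≈ε⇒x≈y _ _
  ≋⇒⊝ : ∀ {f g : Laurent A} → f ≋ g → f ⊝ g ≋ 𝟘
  ≋⇒⊝ = x≈y⇒x∙y⁻¹≈ε

-- Elements are representatives: symmetric Laurent polynomials, equal when
-- their difference lies in the ideal.
K_T : ℕ → ℕ → CommutativeRing 0ℓ 0ℓ
K_T k n = record
  { Carrier = Σ (Laurent (Var k n)) Symmetric
  ; _≈_ = λ (f , _) (g , _) → Vanishing (f ⊝ g)
  ; _+_ = λ (f , p) (g , q) → f ⊕ g , λ σ → ⊕-cong (p σ) (q σ)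
  ; _*_ = λ (f , p) (g , q) → f ⊗ g , λ σ → ⊗-cong (p σ) (q σ)
  ; -_  = λ (f , p) → ⊖ f , λ σ → ⊖-cong (p σ)
  ; 0#  = 𝟘 , λ σ → ≋-refl
  ; 1#  = 𝟙 , λ σ → ≋-refl
  ; isCommutativeRing = record
    { isRing = record
      { +-isAbelianGroup = record
        { isGroup = record
          { isMonoid = record
            { isSemigroup = record
              { isMagma = record
                { isEquivalence = record
                  { refl = λ ι _ → ⊖-inverseʳ
                  ; sym = λ p ι m → ≋⇒⊝ (≋-sym (⊝⇒≋ (p ι m)))
                  ; trans = λ p q ι m → ≋⇒⊝ (≋-trans (⊝⇒≋ (p ι m)) (⊝⇒≋ (q ι m)))
                  }
                ; ∙-cong = λ p q ι m → ≋⇒⊝ (⊕-cong (⊝⇒≋ (p ι m)) (⊝⇒≋ (q ι m))) }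
              ; assoc = λ _ _ _ ι _ → ≋⇒⊝ (⊕-assoc _ _ _) }
            ; identity = (λ _ ι _ → ≋⇒⊝ (⊕-identityˡ _)) , (λ _ ι _ → ≋⇒⊝ (R.+-identityʳ _)) }
          ; inverse = (λ _ ι _ → ≋⇒⊝ (⊖-inverseˡ _)) , (λ _ ι _ → ≋⇒⊝ (R.-‿inverseʳ _))
          ; ⁻¹-cong = λ p ι m → ≋⇒⊝ (⊖-cong (⊝⇒≋ (p ι m))) }
        ; comm = λ _ _ ι _ → ≋⇒⊝ (⊕-comm _ _) }
      ; *-cong = λ p q ι m → ≋⇒⊝ (⊗-cong (⊝⇒≋ (p ι m)) (⊝⇒≋ (q ι m)))
      ; *-assoc = λ _ _ _ ι _ → ≋⇒⊝ (⊗-assoc _ _ _)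
      ; *-identity = (λ _ ι _ → ≋⇒⊝ (⊗-identityˡ _)) , (λ _ ι _ → ≋⇒⊝ (R.*-identityʳ _))
      ; distrib = (λ _ _ _ ι _ → ≋⇒⊝ (⊗-distribˡ _ _ _)) , (λ _ _ _ ι _ → ≋⇒⊝ (R.distribʳ _ _ _))
      }
    ; *-comm = λ _ _ ι _ → ≋⇒⊝ (⊗-comm _ _)
    }
  }
  where
  module R = CommutativeRing (laurentRing (Fin n))
  ⊖-inverseʳ : ∀ {f} → f ⊝ f ≋ 𝟘
  ⊖-inverseʳ = R.-‿inverseʳ _

scalar : ∀ {k n} → Laurent (Fin n) → CommutativeRing.Carrier (K_T k n)
scalar f = rename inj₂ f , λ σ → ≡.subst (_≋ rename inj₂ f) (≡.sym (rename-inj₂ _ f)) ≋-refl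

-- A Young diagram in the k × (n - k) rectangle, given by its frame;
-- i : Fin n stands for step i + 1 of the border.
Diagram : ℕ → ℕ → Set
Diagram k n = Σ (Subset n) λ S → ∣ S ∣ ≡ k

vectors : ∀ {A : Set} → List A → (n : ℕ) → List (Vec A n)
vectors as zero    = [] ∷ []
vectors as (suc n) = cartesianProductWith _∷_ as (vectors as n)

diagrams : ∀ k n → List (Diagram k n)
diagrams k n =
  mapMaybe (λ S → Maybe.map (S ,_) (dec⇒maybe (∣ S ∣ ℕ.≟ k)))
           (vectors (outside ∷ inside ∷ []) n)

sumOver : ∀ {A : Set} (R : CommutativeRing 0ℓ 0ℓ) →
          List A → (A → CommutativeRing.Carrier R) → CommutativeRing.Carrier R
sumOver R as f = foldr (λ a s → f a + s) 0# as
  where open CommutativeRing R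

-- g = D f for the pair of variables y_p, y_q.  The quotient defining D
-- is exact and the Laurent ring is a domain, so clearing the
-- denominator determines g.
IsDividedDifference : ∀ {k n} (p q : Fin n) (f g : Laurent (Var k n)) → Set
IsDividedDifference p q f g =
  (y p ⊝ y q) ⊗ g ≋ y p ⊗ f ⊝ y q ⊗ rename (Sum.map₂ (transpose p q)) f

data IsGrothendieck {k n : ℕ} : Subset n → Laurent (Var k n) → Set where
  rectangle : ∀ {S f} →
    (∀ i → i ∈ S ⇔ n ∸ k ℕ.≤ toℕ i) →
    f ≋ ∏ (λ (i : Fin k) → ∏ (λ (j : Fin (n ∸ k)) →
          𝟙 ⊝ x i ⊗ y⁻¹ (inject≤ j (ℕ.m∸n≤m n k)))) →
    IsGrothendieck S f
  step : ∀ {S T f g} (p q : Fin n) → toℕ q ≡ suc (toℕ p) →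
    q ∈ S → p ∉ S → T ≡ (S - q) ∪ ⁅ p ⁆ →
    IsGrothendieck S f → IsDividedDifference p q f g →
    IsGrothendieck T g

data State : Set where
  ∅ R G RG : State

_≟_ : DecidableEquality State
∅  ≟ ∅  = yes refl
∅  ≟ R  = no λ ()
∅  ≟ G  = no λ ()
∅  ≟ RG = no λ ()
R  ≟ ∅  = no λ ()
R  ≟ R  = yes refl
R  ≟ G  = no λ ()
R  ≟ RG = no λ ()
G  ≟ ∅  = no λ ()
G  ≟ R  = no λ ()
G  ≟ G  = yes refl
G  ≟ RG = no λ ()
RG ≟ ∅  = no λ ()
RG ≟ R  = no λ ()
RG ≟ G  = no λ ()
RG ≟ RG = yes refl

data Orientation : Set where
  up down : Orientation

data Tile : Orientation → Set where
  E G₁ G₂ R₁ R₂ Q : ∀ {o} → Tile o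
  K               : Tile up

tiles : ∀ o → List (Tile o)
tiles up   = E ∷ G₁ ∷ G₂ ∷ R₁ ∷ R₂ ∷ Q ∷ K ∷ []
tiles down = E ∷ G₁ ∷ G₂ ∷ R₁ ∷ R₂ ∷ Q ∷ []

-- Horizontal edge; edge in direction 60°/240°; edge in direction 120°/300°.
hEdge aEdge bEdge : ∀ {o} → Tile o → State
hEdge E  = ∅
hEdge G₁ = G
hEdge G₂ = G
hEdge R₁ = R
hEdge R₂ = R
hEdge Q  = RG
hEdge K  = ∅

aEdge E  = ∅
aEdge G₁ = G
aEdge G₂ = RG
aEdge R₁ = ∅
aEdge R₂ = G
aEdge Q  = G
aEdge K  = RG

bEdge E  = ∅
bEdge G₁ = ∅
bEdge G₂ = R
bEdge R₁ = R
bEdge R₂ = RG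
bEdge Q  = R
bEdge K  = RG

-- A tiling of side suc n is one of side n, extended below by a row of
-- suc n up-pointing and n down-pointing triangles, each listed from left
-- to right.  Down-pointing triangle i of that row lies between its
-- up-pointing triangles i and suc i, and below bottom edge i of the
-- tiling of side n.
infixl 5 _▷_
data Tiling : ℕ → Set where
  apex : Tiling 0
  _▷_  : ∀ {n} → Tiling n → Vec (Tile up) (suc n) × Vec (Tile down) n →
         Tiling (suc n)

tilings : ∀ n → List (Tiling n)
tilings zero    = apex ∷ []
tilings (suc n) =
  cartesianProductWith _▷_ (tilings n)
    (List.cartesianProduct (vectors (tiles up) (suc n)) (vectors (tiles down) n))

bottomTiles : ∀ {n} → Tiling n → Vec (Tile up) n
bottomTiles apex           = []
bottomTiles (t ▷ (us , _)) = us

-- Each side is read in the direction in which it encodes a diagram: left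
-- side upwards, right side downwards, bottom side rightwards.
leftSide rightSide bottomSide : ∀ {n} → Tiling n → Vec State n
leftSide apex            = []
leftSide (t ▷ (us , _))  = aEdge (Vec.head us) ∷ leftSide t
rightSide apex           = []
rightSide (t ▷ (us , _)) = rightSide t ∷ʳ bEdge (Vec.last us)
bottomSide t             = Vec.map hEdge (bottomTiles t)

Matching : ∀ {n} → Tiling n → Set
Matching apex = ⊤
Matching (t ▷ (us , ds)) = Matching t × (∀ i →
  hEdge (lookup ds i) ≡ lookup (bottomSide t) i ×
  bEdge (lookup ds i) ≡ bEdge (lookup us (inject₁ i)) ×
  aEdge (lookup ds i) ≡ aEdge (lookup us (suc i)))

matching? : ∀ {n} (t : Tiling n) → Dec (Matching t)
matching? apex = yes tt
matching? (t ▷ (us , ds)) = matching? t ×-dec all? λ i →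
  (hEdge (lookup ds i) ≟ lookup (bottomSide t) i) ×-dec
  (bEdge (lookup ds i) ≟ bEdge (lookup us (inject₁ i))) ×-dec
  (aEdge (lookup ds i) ≟ aEdge (lookup us (suc i)))

encode : ∀ {n} → (inFrame notInFrame : State) → Subset n → Vec State n
encode s s′ = Vec.map λ m → if m then s else s′

IsPuzzle : ∀ {k n} → (λ′ μ ν : Diagram k n) → Tiling n → Set
IsPuzzle (S , _) (S′ , _) (S″ , _) t =
  Matching t ×
  leftSide t   ≡ encode G ∅ S ×
  rightSide t  ≡ encode ∅ R S′ ×
  bottomSide t ≡ encode G R S″

isPuzzle? : ∀ {k n} (λ′ μ ν : Diagram k n) (t : Tiling n) → Dec (IsPuzzle λ′ μ ν t)
isPuzzle? _ _ _ t =
  matching? t ×-dec Vec.≡-dec _≟_ _ _ ×-dec Vec.≡-dec _≟_ _ _ ×-dec Vec.≡-dec _≟_ _ _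

puzzles : ∀ {k n} → (λ′ μ ν : Diagram k n) → List (Tiling n)
puzzles {n = n} λ′ μ ν = filter (isPuzzle? λ′ μ ν) (tilings n)

lozengeWeight : ∀ {A} → (w : Laurent A) → (upper : Tile up) (lower : Tile down) → Laurent A
lozengeWeight w G₂ G₁ = w
lozengeWeight w R₂ R₁ = w
lozengeWeight w Q  Q  = 𝟙 ⊝ w
lozengeWeight w K  E  = ⊖ w
lozengeWeight w _  _  = 𝟙

-- For a tiling t of side m that is the top part of one of side n, and a
-- bottom edge e of t, l e and r e are the edges of the bottom side of the
-- latter reached from the midpoint of e in directions 240° and 300°.
-- One row lower, these two lines cross the bottom edges e and e + 1.
weightIn : ∀ {n m} → (l r : Fin m → Fin n) → Tiling m → Laurent (Fin n)
weightIn l r apex = 𝟙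
weightIn l r (t ▷ (us , ds)) =
  weightIn l′ r′ t ⊗
  ∏ (λ e → lozengeWeight (var (r′ e) ⊗ inv (l′ e))
                         (lookup (bottomTiles t) e) (lookup ds e))
  where
  l′ = l ∘ inject₁
  r′ = r ∘ suc

weight : ∀ {n} → Tiling n → Laurent (Fin n)
weight = weightIn id id

puzzleSum : ∀ {k n} → (λ′ μ ν : Diagram k n) → Laurent (Fin n)
puzzleSum {n = n} λ′ μ ν = sumOver (laurentRing (Fin n)) (puzzles λ′ μ ν) weight

{-# OPTIONS --safe #-}
module Submission where

-- Follow the line of each left boundary edge in direction 300° and that of
-- each right boundary edge in direction 240°: they cross in the lozenges and
-- merge in pairs at the bottom side, so a puzzle sum is the partition
-- function of a triangle with a parameter y_i on the i-th line of either
-- family.  By Yang–Baxter equations, exchanging two adjacent parameters acts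
-- on the boundary conditions of all three sides by R-matrices.  The same
-- R-matrix expresses G^λ(x; s_i y) through the G^μ(x; y), as one sees by
-- realizing G^λ as a five-vertex model with one line for each x_i.  Hence
-- the product formula, localized at x = y_I, is preserved when I is replaced
-- by s_i I, and it suffices to check it for I = {1,…,k}, where both G^λ and
-- the puzzle sums are Kronecker deltas.  The same induction on I shows that
-- the matrix of localizations is triangular, with products of differences
-- of variables on the diagonal, so the coefficients are unique.

open import Data.Bool.Base using (Bool; true; false; if_then_else_; _∧_)
open import Data.Bool.Properties using (∨-identityʳ) renaming (_≟_ to _≟ᵇ_)
open import Data.Empty using (⊥-elim)
open import Data.Fin.Base as Fin using (Fin; zero; suc; toℕ; inject₁; inject≤; fromℕ; punchOut)
import Data.Fin.Properties as Fin
open import Data.Fin.Permutation.Components using (transpose)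
open import Data.Fin.Subset using (inside; outside; ∣_∣; _∈_; _∉_; _∪_; _-_; ⁅_⁆)
open import Data.Fin.Subset.Properties using (∪-identityʳ; p─⊥≡p; drop-there; ∣p∣≤n)
open import Data.Integer.Base as ℤ using (ℤ; +_; -[1+_])
import Data.Integer.Properties as ℤ
open import Data.List.Base
  using (List; []; _∷_; _++_; concatMap; cartesianProduct; cartesianProductWith; filter; map; mapMaybe; null)
open import Data.Maybe.Base as Maybe using (Maybe; just; nothing)
open import Data.Nat.Base as ℕ using (ℕ; zero; suc; _+_; _∸_; _≤_; _<_; s≤s; z≤n)
import Data.Nat.Properties as ℕ
open import Data.Product.Base using (Σ; ∃; _×_; _,_; proj₁; proj₂; map₁)
import Data.Product.Properties as ×
open import Data.Sign.Base as Sign using (Sign)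
import Data.Sign.Properties as Sign
open import Data.Sum.Base as Sum using (_⊎_; inj₁; inj₂; [_,_]′)
import Data.Sum.Properties as Sum
open import Data.Unit.Base using (⊤; tt)
open import Data.Vec.Base as Vec
  using (Vec; []; _∷_; _∷ʳ_; here; there; lookup; tabulate; allFin; initLast)
import Data.Vec.Properties as Vec
open import Data.Vec.Relation.Unary.All using (All; []; _∷_)
open import Data.Vec.Relation.Unary.AllPairs using ([]; _∷_)
open import Data.Vec.Relation.Unary.Unique.Propositional using (Unique)
open import Data.Vec.Relation.Unary.Unique.Propositional.Properties using (tabulate⁺)
open import Function.Base using (_∘_; id)
open import Function.Bundles using (_⇔_; mk⇔; Equivalence)
open import Relation.Nullary using (Dec; yes; no; does)
open import Relation.Nullary.Decidable using (_×-dec_; dec⇒maybe)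
open import Relation.Unary using (Decidable)
open import Relation.Binary.Definitions using (DecidableEquality)
open import Relation.Binary.PropositionalEquality as ≡ using (_≡_; _≢_; refl)
open import Algebra.Bundles using (CommutativeRing)
import Algebra.Properties.Monoid.Sum as MonoidSum
import Algebra.Properties.Semiring.Exp as Exp
import Algebra.Solver.CommutativeMonoid as CommutativeMonoidSolver
import Relation.Binary.Reasoning.Setoid as SetoidReasoning
open import Defs

-- A sum of weights is written as a functional on continuations: a crossing, a row or the whole
-- triangle takes the function still to be applied to the outgoing states. Gluing is nesting, pieces
-- without a common line commute by linearity, and each local relation is a finite identity of
-- tables, decided by computation. The induction on I closes because `Rᴬ` and `Rᴮ`, which must also
-- act on the state `RG` of interior edges, restrict on boundary states to the matrix `Rᴴ` of the
-- frames. The obstacle is the cancellation of differences of variables. The Laurent ring is given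
-- by generators and relations, so there are no normal forms to compare and nothing is known about
-- zero divisors. Cancellation is used twice: to recognize G^λ from equations with cleared
-- denominators, and to divide by the diagonal entries of the localization matrix. It is obtained
-- from a module on which one chosen variable acts as a shift.

private variable
  A B X Y W : Set
  k n : ℕ

-- Ring arithmetic, finite sums and linear functionals

module L {A : Set} where
  open CommutativeRing (laurentRing A) public
    using (setoid; +-identityʳ; *-identityʳ; zeroˡ; zeroʳ; distribˡ; distribʳ;
           -‿inverseʳ; *-commutativeMonoid; ring; reflexive)
  open import Algebra.Properties.Ring ring public
    using (-‿distribˡ-*; -‿distribʳ-*; -‿+-comm; -0#≈0#; -‿involutive)
  open import Algebra.Properties.CommutativeSemigroup
    (CommutativeRing.*-commutativeSemigroup (laurentRing A)) public
    using () renaming (x∙yz≈y∙xz to x*yz≈y*xz; interchange to *-interchange)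
  open import Algebra.Properties.CommutativeSemigroup
    (CommutativeRing.+-commutativeSemigroup (laurentRing A)) public
    using () renaming (interchange to +-interchange)
  open SetoidReasoning setoid public

module MonoidSolver {A : Set} where
  open CommutativeMonoidSolver (L.*-commutativeMonoid {A}) public
    using (solve) renaming (_⊕_ to _:*_; _⊜_ to _:=_)

⊖𝟙⊗ : {f : Laurent A} → ⊖ 𝟙 ⊗ f ≋ ⊖ f
⊖𝟙⊗ = ≋-trans (≋-sym (L.-‿distribˡ-* _ _)) (⊖-cong (⊗-identityˡ _))

∑ : List X → (X → Laurent A) → Laurent A
∑ {A = A} = sumOver (laurentRing A)

∑-cong : (xs : List X) {f g : X → Laurent A} → (∀ x → f x ≋ g x) → ∑ xs f ≋ ∑ xs g
∑-cong []       f≋g = ≋-refl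
∑-cong (x ∷ xs) f≋g = ⊕-cong (f≋g x) (∑-cong xs f≋g)

∑-zero : (xs : List X) → ∑ {A = A} xs (λ _ → 𝟘) ≋ 𝟘
∑-zero []       = ≋-refl
∑-zero (x ∷ xs) = ≋-trans (⊕-identityˡ _) (∑-zero xs)

∑-⊕ : (xs : List X) (f g : X → Laurent A) → ∑ xs (λ x → f x ⊕ g x) ≋ ∑ xs f ⊕ ∑ xs g
∑-⊕ []       f g = ≋-sym (⊕-identityˡ 𝟘)
∑-⊕ (x ∷ xs) f g = ≋-trans (⊕-cong ≋-refl (∑-⊕ xs f g)) (L.+-interchange _ _ _ _)

∑-⊗ˡ : (xs : List X) (c : Laurent A) (f : X → Laurent A) → ∑ xs (λ x → c ⊗ f x) ≋ c ⊗ ∑ xs f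
∑-⊗ˡ []       c f = ≋-sym (L.zeroʳ c)
∑-⊗ˡ (x ∷ xs) c f = ≋-trans (⊕-cong ≋-refl (∑-⊗ˡ xs c f)) (≋-sym (⊗-distribˡ _ _ _))

∑-++ : (xs ys : List X) (f : X → Laurent A) → ∑ (xs ++ ys) f ≋ ∑ xs f ⊕ ∑ ys f
∑-++ []       ys f = ≋-sym (⊕-identityˡ _)
∑-++ (x ∷ xs) ys f = ≋-trans (⊕-cong ≋-refl (∑-++ xs ys f)) (≋-sym (⊕-assoc _ _ _))

∑-map : (g : X → Y) (xs : List X) (f : Y → Laurent A) → ∑ (map g xs) f ≡ ∑ xs (f ∘ g)
∑-map g []       f = refl
∑-map g (x ∷ xs) f = ≡.cong (f (g x) ⊕_) (∑-map g xs f)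

∑-concatMap : (g : X → List Y) (xs : List X) (f : Y → Laurent A) →
              ∑ (concatMap g xs) f ≋ ∑ xs (λ x → ∑ (g x) f)
∑-concatMap g []       f = ≋-refl
∑-concatMap g (x ∷ xs) f =
  ≋-trans (∑-++ (g x) (concatMap g xs) f) (⊕-cong ≋-refl (∑-concatMap g xs f))

∑-cartesianProductWith : (g : X → Y → W) (xs : List X) (ys : List Y) (f : W → Laurent A) →
                         ∑ (cartesianProductWith g xs ys) f ≋ ∑ xs (λ x → ∑ ys (λ y → f (g x y)))
∑-cartesianProductWith g []       ys f = ≋-refl
∑-cartesianProductWith g (x ∷ xs) ys f =
  ≋-trans (∑-++ (map (g x) ys) _ f)
          (⊕-cong (L.reflexive (∑-map (g x) ys f)) (∑-cartesianProductWith g xs ys f))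

-- The Iverson bracket: conditions on a tiling become factors, which can be distributed over its
-- tiles like the weights.
[_] : {P : Set} → Dec P → Laurent A
[ d ] = if does d then 𝟙 else 𝟘

[]-× : {P Q : Set} (d : Dec P) (e : Dec Q) → [_] {A = A} (d ×-dec e) ≋ [ d ] ⊗ [ e ]
[]-× (yes _) e = ≋-sym (⊗-identityˡ _)
[]-× (no _)  e = ≋-sym (L.zeroˡ _)

[]-⇔ : {P Q : Set} (d : Dec P) (e : Dec Q) → (P → Q) → (Q → P) → [_] {A = A} d ≡ [ e ]
[]-⇔ (yes p) (yes q) to from = refl
[]-⇔ (yes p) (no ¬q) to from = ⊥-elim (¬q (to p))
[]-⇔ (no ¬p) (yes q) to from = ⊥-elim (¬p (from q))
[]-⇔ (no ¬p) (no ¬q) to from = refl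

∑-filter : {P : X → Set} (P? : Decidable P) (xs : List X) (f : X → Laurent A) →
           ∑ (filter P? xs) f ≋ ∑ xs (λ x → [ P? x ] ⊗ f x)
∑-filter P? []       f = ≋-refl
∑-filter P? (x ∷ xs) f with P? x
... | yes _ = ⊕-cong (≋-sym (⊗-identityˡ _)) (∑-filter P? xs f)
... | no  _ = ≋-trans (∑-filter P? xs f)
                (≋-trans (≋-sym (⊕-identityˡ _)) (⊕-cong (≋-sym (L.zeroˡ _)) ≋-refl))

-- Such a functional plays the part of a formal linear combination of elements of `X`, with the
-- continuation in place of basis vectors; operators are composed by nesting (`linear-bind`).
record Linear {X A : Set} (Φ : (X → Laurent A) → Laurent A) : Set where
  field
    cong  : ∀ {f g} → (∀ x → f x ≋ g x) → Φ f ≋ Φ g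
    add   : ∀ f g → Φ (λ x → f x ⊕ g x) ≋ Φ f ⊕ Φ g
    scale : ∀ c f → Φ (λ x → c ⊗ f x) ≋ c ⊗ Φ f

  zeroes : Φ (λ _ → 𝟘) ≋ 𝟘
  zeroes = ≋-trans (cong λ _ → ≋-sym (L.zeroˡ 𝟘)) (≋-trans (scale 𝟘 (λ _ → 𝟘)) (L.zeroˡ _))

  vanish : ∀ {f} → (∀ x → f x ≋ 𝟘) → Φ f ≋ 𝟘
  vanish f≋𝟘 = ≋-trans (cong f≋𝟘) zeroes

open Linear

linear-at : (x : X) → Linear {A = A} (λ f → f x)
linear-at x = record { cong = λ f≋g → f≋g x ; add = λ _ _ → ≋-refl ; scale = λ _ _ → ≋-refl }

linear-𝟘 : Linear {X} {A} (λ _ → 𝟘)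
linear-𝟘 = record { cong = λ _ → ≋-refl ; add = λ _ _ → ≋-sym (⊕-identityˡ 𝟘)
                  ; scale = λ c _ → ≋-sym (L.zeroʳ c) }

linear-bind : {Φ : (X → Laurent A) → Laurent A} {Ψ : X → (Y → Laurent A) → Laurent A} →
              Linear Φ → (∀ x → Linear (Ψ x)) → Linear (λ f → Φ (λ x → Ψ x f))
linear-bind lΦ lΨ = record
  { cong  = λ f≋g → cong lΦ λ x → cong (lΨ x) f≋g
  ; add   = λ f g → ≋-trans (cong lΦ λ x → add (lΨ x) f g) (add lΦ _ _)
  ; scale = λ c f → ≋-trans (cong lΦ λ x → scale (lΨ x) c f) (scale lΦ c _)
  }

⟨_∣_⟩ : List X → (X → Laurent A) → (X → Laurent A) → Laurent A
⟨ xs ∣ c ⟩ f = ∑ xs (λ x → c x ⊗ f x)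

linear-⟨⟩ : (xs : List X) (c : X → Laurent A) → Linear ⟨ xs ∣ c ⟩
linear-⟨⟩ xs c = record
  { cong  = λ f≋g → ∑-cong xs λ x → ⊗-cong ≋-refl (f≋g x)
  ; add   = λ f g → ≋-trans (∑-cong xs λ x → ⊗-distribˡ _ _ _) (∑-⊕ xs _ _)
  ; scale = λ d f → ≋-trans (∑-cong xs λ x → L.x*yz≈y*xz _ _ _) (∑-⊗ˡ xs d _)
  }

-- Fubini in the form used throughout: a finite sum moves past any part of the picture on whose
-- outcome its weights do not depend.
linear-⟨⟩-comm : {Φ : (X → Laurent A) → Laurent A} → Linear Φ →
                 (ys : List Y) (c : Y → Laurent A) (f : X → Y → Laurent A) →
                 Φ (λ x → ⟨ ys ∣ c ⟩ (f x)) ≋ ⟨ ys ∣ c ⟩ (λ y → Φ (λ x → f x y))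
linear-⟨⟩-comm lΦ []       c f = zeroes lΦ
linear-⟨⟩-comm lΦ (y ∷ ys) c f =
  ≋-trans (add lΦ _ _) (⊕-cong (scale lΦ (c y) _) (linear-⟨⟩-comm lΦ ys c f))

linear-⊗ʳ : {Φ : (X → Laurent A) → Laurent A} → Linear Φ →
            ∀ c f → Φ (λ x → f x ⊗ c) ≋ Φ f ⊗ c
linear-⊗ʳ lΦ c f = ≋-trans (cong lΦ λ _ → ⊗-comm _ _) (≋-trans (scale lΦ c f) (⊗-comm _ _))

∑-comm : (xs : List X) (ys : List Y) (f : X → Y → Laurent A) →
         ∑ xs (λ x → ∑ ys (f x)) ≋ ∑ ys (λ y → ∑ xs (λ x → f x y))
∑-comm []       ys f = ≋-sym (∑-zero ys)
∑-comm (x ∷ xs) ys f = ≋-trans (⊕-cong ≋-refl (∑-comm xs ys f)) (≋-sym (∑-⊕ ys _ _))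

-- Tables of local weights

-- The weights 1, w, 1 − w and −w of a lozenge, homogenized by w = s / t.
data Coef : Set where
  one par copar negpar : Coef

coef : (s t : Laurent A) → Coef → Laurent A
coef s t one    = t
coef s t par    = s
coef s t copar  = t ⊝ s
coef s t negpar = ⊖ s

Table : Set → Set
Table X = List (Coef × X)

⟪_⟫ : Table X → (s t : Laurent A) → (X → Laurent A) → Laurent A
⟪ T ⟫ s t f = ⟨ T ∣ coef s t ∘ proj₁ ⟩ (f ∘ proj₂)

linear-⟪⟫ : (T : Table X) (s t : Laurent A) → Linear (⟪ T ⟫ s t)
linear-⟪⟫ T s t = linear-bind (linear-⟨⟩ T _) (linear-at ∘ proj₂)

linear-⟪⟫-comm : {Φ : (X → Laurent A) → Laurent A} → Linear Φ →
                 (T : Table Y) (s t : Laurent A) (f : X → Y → Laurent A) →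
                 Φ (λ x → ⟪ T ⟫ s t (f x)) ≋ ⟪ T ⟫ s t (λ y → Φ (λ x → f x y))
linear-⟪⟫-comm lΦ T s t f = linear-⟨⟩-comm lΦ T _ (λ x → f x ∘ proj₂)

coef-cong : ∀ c {s s′ t t′ : Laurent A} → s ≋ s′ → t ≋ t′ → coef s t c ≋ coef s′ t′ c
coef-cong one    p q = q
coef-cong par    p q = p
coef-cong copar  p q = ⊕-cong q (⊖-cong p)
coef-cong negpar p q = ⊖-cong p

⟪⟫-cong : (T : Table X) {s s′ t t′ : Laurent A} (f : X → Laurent A) → s ≋ s′ → t ≋ t′ →
          ⟪ T ⟫ s t f ≋ ⟪ T ⟫ s′ t′ f
⟪⟫-cong T f p q = ∑-cong T λ (c , x) → ⊗-cong (coef-cong c p q) ≋-refl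

coef-⊗ : ∀ c (r s t : Laurent A) → coef (r ⊗ s) (r ⊗ t) c ≋ r ⊗ coef s t c
coef-⊗ one    r s t = ≋-refl
coef-⊗ par    r s t = ≋-refl
coef-⊗ copar  r s t = ≋-sym (≋-trans (⊗-distribˡ _ _ _) (⊕-cong ≋-refl (≋-sym (L.-‿distribʳ-* _ _))))
coef-⊗ negpar r s t = L.-‿distribʳ-* _ _

-- Every coefficient is linear in the pair `(s , t)`. This clears denominators: `u` times the table
-- at `(u⁻¹ , 1)` is the table at `(1 , u)`.
⟪⟫-scale : (T : Table X) (r s t : Laurent A) (f : X → Laurent A) →
           ⟪ T ⟫ (r ⊗ s) (r ⊗ t) f ≋ r ⊗ ⟪ T ⟫ s t f
⟪⟫-scale T r s t f = ≋-trans
  (∑-cong T λ (c , x) → ≋-trans (⊗-cong (coef-⊗ c r s t) ≋-refl) (⊗-assoc _ _ _))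
  (∑-⊗ˡ T r _)

-- Identities between iterated tables are decided by expanding both sides
-- into signed monomials in two weights u and w.

data Weight : Set where
  `1 `u `w `uw : Weight

-- Nested tables as syntax that `expand` can inspect; `m` and `n` name the parameters `s` and `t`.
-- Continuations can be ordinary functions, since they are only applied to entries of explicit
-- finite tables.
data Prog : Set → Set₁ where
  ret : X → Prog X
  op  : (m n : Weight) → Table X → (X → Prog Y) → Prog Y

Monomial : Set
Monomial = Sign × ℕ × ℕ

Terms : Set → Set
Terms X = List (Monomial × X)

_·_ : Monomial → Monomial → Monomial
(s , i , j) · (s′ , i′ , j′) = s Sign.* s′ , i + i′ , j + j′

monomial : Weight → Monomial
monomial `1  = Sign.+ , 0 , 0
monomial `u  = Sign.+ , 1 , 0
monomial `w  = Sign.+ , 0 , 1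
monomial `uw = Sign.+ , 1 , 1

negate : Monomial → Monomial
negate = map₁ Sign.opposite

coefMonomials : (m n : Weight) → Coef → List Monomial
coefMonomials m n one    = monomial n ∷ []
coefMonomials m n par    = monomial m ∷ []
coefMonomials m n copar  = monomial n ∷ negate (monomial m) ∷ []
coefMonomials m n negpar = negate (monomial m) ∷ []

expand : Prog X → Terms X
expand (ret x)      = (monomial `1 , x) ∷ []
expand (op m n T p) =
  concatMap (λ (c , x) → concatMap (λ k → map (map₁ (k ·_)) (expand (p x)))
                                   (coefMonomials m n c)) T

module _ (_≟ˣ_ : DecidableEquality X) where
  _≟ᵗ_ : DecidableEquality (Monomial × X)
  _≟ᵗ_ = ×.≡-dec (×.≡-dec Sign._≟_ (×.≡-dec ℕ._≟_ ℕ._≟_)) _≟ˣ_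

  -- A new term cancels one opposite term if there is any. Multiplicities are represented by
  -- repetition instead of integer coefficients.
  insert : Monomial × X → Terms X → Terms X
  insert t []       = t ∷ []
  insert t (s ∷ ts) with map₁ negate t ≟ᵗ s
  ... | yes _ = ts
  ... | no  _ = s ∷ insert t ts

  reduce : Terms X → Terms X
  reduce []       = []
  reduce (t ∷ ts) = insert t (reduce ts)

  agree : Prog X → Prog X → Bool
  agree p q = null (reduce (expand p ++ map (map₁ negate) (expand q)))

-- `uw` has a value of its own because in the Yang-Baxter equations it is again a ratio of two
-- variables, equal to the product of the other two only up to `≋`.
record Valuation (A : Set) : Set where
  field
    value : Weight → Laurent A
    1≋𝟙   : value `1 ≋ 𝟙
    uw≋   : value `uw ≋ value `u ⊗ value `w

  eval : Prog X → (X → Laurent A) → Laurent A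
  eval (ret x)      f = f x
  eval (op m n T p) f = ⟪ T ⟫ (value m) (value n) (λ x → eval (p x) f)

  private
    open Exp (CommutativeRing.semiring (laurentRing A)) using (_^_; ^-homo-*)

    sign : Sign → Laurent A
    sign Sign.+ = 𝟙
    sign Sign.- = ⊖ 𝟙

    sign-opposite : ∀ s → sign (Sign.opposite s) ≋ ⊖ sign s
    sign-opposite Sign.+ = ≋-refl
    sign-opposite Sign.- = ≋-sym (L.-‿involutive 𝟙)

    sign-* : ∀ s s′ → sign (s Sign.* s′) ≋ sign s ⊗ sign s′
    sign-* Sign.+ s′ = ≋-sym (⊗-identityˡ _)
    sign-* Sign.- s′ = begin
      sign (Sign.opposite s′) ≈⟨ sign-opposite s′ ⟩
      ⊖ sign s′               ≈⟨ ⊖-cong (⊗-identityˡ _) ⟨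
      ⊖ (𝟙 ⊗ sign s′)         ≈⟨ L.-‿distribˡ-* _ _ ⟩
      ⊖ 𝟙 ⊗ sign s′           ∎
      where open L

    ⟦_⟧ : Monomial → Laurent A
    ⟦ s , i , j ⟧ = sign s ⊗ (value `u ^ i ⊗ value `w ^ j)

    ⟦⟧-· : ∀ k l → ⟦ k · l ⟧ ≋ ⟦ k ⟧ ⊗ ⟦ l ⟧
    ⟦⟧-· (s , i , j) (s′ , i′ , j′) = ≋-trans
      (⊗-cong (sign-* s s′) (≋-trans (⊗-cong (^-homo-* _ i i′) (^-homo-* _ j j′))
                                     (L.*-interchange _ _ _ _)))
      (L.*-interchange _ _ _ _)

    ⟦⟧-negate : ∀ k → ⟦ negate k ⟧ ≋ ⊖ ⟦ k ⟧
    ⟦⟧-negate (s , _) = ≋-trans (⊗-cong (sign-opposite s) ≋-refl) (≋-sym (L.-‿distribˡ-* _ _))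

    ⟦⟧-monomial : ∀ m → ⟦ monomial m ⟧ ≋ value m
    ⟦⟧-monomial `1  = ≋-trans (⊗-identityˡ _) (≋-trans (⊗-identityˡ _) (≋-sym 1≋𝟙))
    ⟦⟧-monomial `u  = ≋-trans (⊗-identityˡ _) (≋-trans (L.*-identityʳ _) (L.*-identityʳ _))
    ⟦⟧-monomial `w  = ≋-trans (⊗-identityˡ _) (≋-trans (⊗-identityˡ _) (L.*-identityʳ _))
    ⟦⟧-monomial `uw = ≋-trans (⊗-identityˡ _)
      (≋-trans (⊗-cong (L.*-identityʳ _) (L.*-identityʳ _)) (≋-sym uw≋))

    ⟦⟧-coef : ∀ m n c → ∑ (coefMonomials m n c) ⟦_⟧ ≋ coef (value m) (value n) c
    ⟦⟧-coef m n one    = ≋-trans (L.+-identityʳ _) (⟦⟧-monomial n)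
    ⟦⟧-coef m n par    = ≋-trans (L.+-identityʳ _) (⟦⟧-monomial m)
    ⟦⟧-coef m n copar  = ⊕-cong (⟦⟧-monomial n)
      (≋-trans (L.+-identityʳ _) (≋-trans (⟦⟧-negate (monomial m)) (⊖-cong (⟦⟧-monomial m))))
    ⟦⟧-coef m n negpar = ≋-trans (L.+-identityʳ _)
      (≋-trans (⟦⟧-negate (monomial m)) (⊖-cong (⟦⟧-monomial m)))

    ⟦_⟧ᵗ : Terms X → (X → Laurent A) → Laurent A
    ⟦ ts ⟧ᵗ f = ⟨ ts ∣ ⟦_⟧ ∘ proj₁ ⟩ (f ∘ proj₂)

    ⟦⟧ᵗ-· : ∀ k (ts : Terms X) f → ⟦ map (map₁ (k ·_)) ts ⟧ᵗ f ≋ ⟦ k ⟧ ⊗ ⟦ ts ⟧ᵗ f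
    ⟦⟧ᵗ-· k ts f = ≋-trans (L.reflexive (∑-map _ ts _))
      (≋-trans (∑-cong ts λ (l , x) → ≋-trans (⊗-cong (⟦⟧-· k l) ≋-refl) (⊗-assoc _ _ _))
               (∑-⊗ˡ ts ⟦ k ⟧ _))

    ⟦⟧ᵗ-negate : ∀ (ts : Terms X) f → ⟦ map (map₁ negate) ts ⟧ᵗ f ≋ ⊖ ⟦ ts ⟧ᵗ f
    ⟦⟧ᵗ-negate []             f = ≋-sym L.-0#≈0#
    ⟦⟧ᵗ-negate ((k , x) ∷ ts) f = ≋-trans
      (⊕-cong (≋-trans (⊗-cong (⟦⟧-negate k) ≋-refl) (≋-sym (L.-‿distribˡ-* _ _)))
              (⟦⟧ᵗ-negate ts f))
      (L.-‿+-comm _ _)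

    expand-correct : ∀ (p : Prog X) f → ⟦ expand p ⟧ᵗ f ≋ eval p f
    expand-correct (ret x)      f = ≋-trans (L.+-identityʳ _)
      (≋-trans (⊗-cong (≋-trans (⟦⟧-monomial `1) 1≋𝟙) ≋-refl) (⊗-identityˡ _))
    expand-correct (op m n T p) f = ≋-trans (∑-concatMap _ T _) (∑-cong T λ (c , x) → begin
      ∑ (concatMap (λ k → map (map₁ (k ·_)) (expand (p x))) (coefMonomials m n c)) _
        ≈⟨ ∑-concatMap _ (coefMonomials m n c) _ ⟩
      ∑ (coefMonomials m n c) (λ k → ⟦ map (map₁ (k ·_)) (expand (p x)) ⟧ᵗ f)
        ≈⟨ ∑-cong (coefMonomials m n c) (λ k → ⟦⟧ᵗ-· k (expand (p x)) f) ⟩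
      ∑ (coefMonomials m n c) (λ k → ⟦ k ⟧ ⊗ ⟦ expand (p x) ⟧ᵗ f)
        ≈⟨ ∑-cong (coefMonomials m n c) (λ k → ⊗-comm _ _) ⟩
      ∑ (coefMonomials m n c) (λ k → ⟦ expand (p x) ⟧ᵗ f ⊗ ⟦ k ⟧)
        ≈⟨ ∑-⊗ˡ (coefMonomials m n c) _ ⟦_⟧ ⟩
      ⟦ expand (p x) ⟧ᵗ f ⊗ ∑ (coefMonomials m n c) ⟦_⟧
        ≈⟨ ⊗-comm _ _ ⟩
      ∑ (coefMonomials m n c) ⟦_⟧ ⊗ ⟦ expand (p x) ⟧ᵗ f
        ≈⟨ ⊗-cong (⟦⟧-coef m n c) (expand-correct (p x) f) ⟩
      coef (value m) (value n) c ⊗ eval (p x) f ∎)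
      where open L

    module _ (_≟ˣ_ : DecidableEquality X) (f : X → Laurent A) where
      insert-correct : ∀ t ts → ⟦ insert _≟ˣ_ t ts ⟧ᵗ f ≋ ⟦ t ∷ ts ⟧ᵗ f
      insert-correct t           []       = ≋-refl
      insert-correct t@(k , x)   (s ∷ ts) with _≟ᵗ_ _≟ˣ_ (map₁ negate t) s
      ... | yes refl = begin
        ⟦ ts ⟧ᵗ f
          ≈⟨ ⊕-identityˡ _ ⟨
        𝟘 ⊕ ⟦ ts ⟧ᵗ f
          ≈⟨ ⊕-cong (L.zeroˡ (f x)) ≋-refl ⟨
        𝟘 ⊗ f x ⊕ ⟦ ts ⟧ᵗ f
          ≈⟨ ⊕-cong (⊗-cong (L.-‿inverseʳ ⟦ k ⟧) ≋-refl) ≋-refl ⟨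
        (⟦ k ⟧ ⊝ ⟦ k ⟧) ⊗ f x ⊕ ⟦ ts ⟧ᵗ f
          ≈⟨ ⊕-cong (⊗-cong (⊕-cong ≋-refl (⟦⟧-negate k)) ≋-refl) ≋-refl ⟨
        (⟦ k ⟧ ⊕ ⟦ negate k ⟧) ⊗ f x ⊕ ⟦ ts ⟧ᵗ f
          ≈⟨ ⊕-cong (L.distribʳ _ _ _) ≋-refl ⟩
        (⟦ k ⟧ ⊗ f x ⊕ ⟦ negate k ⟧ ⊗ f x) ⊕ ⟦ ts ⟧ᵗ f
          ≈⟨ ⊕-assoc _ _ _ ⟩
        ⟦ k ⟧ ⊗ f x ⊕ (⟦ negate k ⟧ ⊗ f x ⊕ ⟦ ts ⟧ᵗ f) ∎
        where open L
      ... | no _ = ≋-trans (⊕-cong ≋-refl (insert-correct t ts))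
        (≋-trans (≋-sym (⊕-assoc _ _ _)) (≋-trans (⊕-cong (⊕-comm _ _) ≋-refl) (⊕-assoc _ _ _)))

      reduce-correct : ∀ ts → ⟦ reduce _≟ˣ_ ts ⟧ᵗ f ≋ ⟦ ts ⟧ᵗ f
      reduce-correct []       = ≋-refl
      reduce-correct (t ∷ ts) = ≋-trans (insert-correct t (reduce _≟ˣ_ ts))
                                        (⊕-cong ≋-refl (reduce-correct ts))

    null-vanish : ∀ (ts : Terms X) f → null ts ≡ true → ⟦ ts ⟧ᵗ f ≋ 𝟘
    null-vanish [] f _ = ≋-refl

  agree-sound : (_≟ˣ_ : DecidableEquality X) (p q : Prog X) → agree _≟ˣ_ p q ≡ true →
                ∀ f → eval p f ≋ eval q f
  agree-sound _≟ˣ_ p q check f = begin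
    eval p f          ≈⟨ expand-correct p f ⟨
    ⟦ expand p ⟧ᵗ f   ≈⟨ ⊝⇒≋ difference ⟩
    ⟦ expand q ⟧ᵗ f   ≈⟨ expand-correct q f ⟩
    eval q f          ∎
    where
    open L
    difference : ⟦ expand p ⟧ᵗ f ⊝ ⟦ expand q ⟧ᵗ f ≋ 𝟘
    difference = begin
      ⟦ expand p ⟧ᵗ f ⊝ ⟦ expand q ⟧ᵗ f
        ≈⟨ ⊕-cong ≋-refl (⟦⟧ᵗ-negate (expand q) f) ⟨
      ⟦ expand p ⟧ᵗ f ⊕ ⟦ map (map₁ negate) (expand q) ⟧ᵗ f
        ≈⟨ ∑-++ (expand p) _ _ ⟨
      ⟦ expand p ++ map (map₁ negate) (expand q) ⟧ᵗ f
        ≈⟨ reduce-correct _≟ˣ_ f (expand p ++ map (map₁ negate) (expand q)) ⟨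
      ⟦ reduce _≟ˣ_ (expand p ++ map (map₁ negate) (expand q)) ⟧ᵗ f
        ≈⟨ null-vanish _ f check ⟩
      𝟘 ∎

-- R-matrices, crossings and their local relations

every : (State → Bool) → Bool
every p = p ∅ ∧ p R ∧ p G ∧ p RG

∧-true : ∀ {b c} → b ∧ c ≡ true → b ≡ true × c ≡ true
∧-true {true} p = refl , p

every-sound : (p : State → Bool) → every p ≡ true → ∀ s → p s ≡ true
every-sound p q ∅  = proj₁ (∧-true q)
every-sound p q R  = proj₁ (∧-true (proj₂ (∧-true {p ∅} q)))
every-sound p q G  = proj₁ (∧-true (proj₂ (∧-true {p R} (proj₂ (∧-true {p ∅} q)))))
every-sound p q RG = proj₂ (∧-true {p G} (proj₂ (∧-true {p R} (proj₂ (∧-true {p ∅} q)))))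

every³-sound : (p : State → State → State → Bool) →
               every (λ s → every λ t → every (p s t)) ≡ true → ∀ s t r → p s t r ≡ true
every³-sound p q s t =
  every-sound (p s t) (every-sound (λ t → every (p s t))
    (every-sound (λ s → every λ t → every (p s t)) q s) t)

-- The R-matrices exchange adjacent lines whose parameters have ratio par;
-- Rᴬ and Rᴮ, for the lines from the left and from the right side, are the
-- solutions, unique up to scalars, of the Yang–Baxter equations with cross.
-- On the bottom side, true stands for G and false for R.
Rᴬ Rᴮ : State → State → Table (State × State)
Rᴬ ∅  G  = (par , ∅ , G)   ∷ (copar , G , ∅)  ∷ []
Rᴬ ∅  RG = (par , ∅ , RG)  ∷ (copar , RG , ∅) ∷ []
Rᴬ G  RG = (par , G , RG)  ∷ []
Rᴬ RG G  = (one , RG , G)  ∷ (copar , G , RG) ∷ []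
Rᴬ s  t  = (one , s , t)   ∷ []

Rᴮ R  ∅  = (par , R , ∅)   ∷ (copar , ∅ , R)  ∷ []
Rᴮ RG ∅  = (par , RG , ∅)  ∷ (copar , ∅ , RG) ∷ []
Rᴮ RG R  = (par , RG , R)  ∷ []
Rᴮ R  RG = (one , R , RG)  ∷ (copar , RG , R) ∷ []
Rᴮ s  t  = (one , s , t)   ∷ []

Rᴴ : Bool → Bool → Table (Bool × Bool)
Rᴴ false true = (par , false , true) ∷ (copar , true , false) ∷ []
Rᴴ b     c    = (one , b , c)        ∷ []

-- The weights of `lozengeWeight` as symbols, which makes `cross` a table that the decision
-- procedure can expand.
lozenge : Tile up → Tile down → Coef
lozenge G₂ G₁ = par
lozenge R₂ R₁ = par
lozenge Q  Q  = copar
lozenge K  E  = negpar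
lozenge _  _  = one

-- Without entries for `∅` and `RG`, the boundary condition of the bottom side is built into
-- `merge`.
letter : State → Table Bool
letter G = (one , true)  ∷ []
letter R = (one , false) ∷ []
letter _ = []

tilesBy : List (Tile up) → State → State → (Tile up → Table X) → Table X
tilesBy ups a b T =
  concatMap (λ u → if does (aEdge u ≟ a) then if does (bEdge u ≟ b) then T u else [] else []) ups

lower : List (Tile down) → Tile up → Table (State × State)
lower downs u =
  concatMap (λ d → if does (hEdge d ≟ hEdge u) then (lozenge u d , aEdge d , bEdge d) ∷ [] else [])
            downs

-- A lozenge as a crossing: the lines enter through its two upper edges and leave through the
-- parallel lower ones; the horizontal edge inside is summed over.
cross : State → State → Table (State × State)
cross a b = tilesBy (tiles up) a b (lower (tiles down))

merge : State → State → Table Bool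
merge a b = tilesBy (tiles up) a b (letter ∘ hEdge)

-- From the incoming horizontal state and the letter of the new frame to the
-- outgoing horizontal state and the letter of the old one, with par = x / y.
vertex : Bool → Bool → Table (Bool × Bool)
vertex false false = (one , false , false) ∷ (par , true , true) ∷ []
vertex false true  = []
vertex true  false = (copar , true , false) ∷ []
vertex true  true  = (one , false , false) ∷ (one , true , true) ∷ []

-- Yang-Baxter for two left lines with parameters `p₁`, `p₂` and a right line with parameter `q`:
-- the weights `u`, `w`, `uw` are `p₁ / p₂`, `p₂ / q`, `p₁ / q`.
AAB-left AAB-right : State → State → State → Prog (State × State × State)
AAB-left a₁ a₂ b =
  op `u `1 (Rᴬ a₁ a₂) λ (c₁ , c₂) → op `w `1 (cross c₂ b) λ (a₂′ , b′) →
  op `uw `1 (cross c₁ b′) λ (a₁′ , b″) → ret (a₁′ , a₂′ , b″)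
AAB-right a₁ a₂ b =
  op `uw `1 (cross a₂ b) λ (c₂ , b′) → op `w `1 (cross a₁ b′) λ (c₁ , b″) →
  op `u `1 (Rᴬ c₁ c₂) λ (a₁′ , a₂′) → ret (a₁′ , a₂′ , b″)

-- For one left line `p` and two right lines `q₁`, `q₂`, the weights `u`, `w`, `uw` are `q₁ / q₂`,
-- `p / q₁`, `p / q₂`.
ABB-left ABB-right : State → State → State → Prog (State × State × State)
ABB-left a b₁ b₂ =
  op `u `1 (Rᴮ b₁ b₂) λ (c₁ , c₂) → op `w `1 (cross a c₁) λ (a′ , b₁′) →
  op `uw `1 (cross a′ c₂) λ (a″ , b₂′) → ret (a″ , b₁′ , b₂′)
ABB-right a b₁ b₂ =
  op `uw `1 (cross a b₁) λ (a′ , c₁) → op `w `1 (cross a′ b₂) λ (a″ , c₂) →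
  op `u `1 (Rᴮ c₁ c₂) λ (b₁′ , b₂′) → ret (a″ , b₁′ , b₂′)

-- The corner in which two adjacent lines of either family meet: one lozenge and the two bottom
-- tiles beside it.
triangle : (m n : Weight) → State → State → State → State → Prog (Bool × Bool)
triangle m n a₁ a₂ b₁ b₂ =
  op m n (cross a₂ b₁) λ (a₂′ , b₁′) → op `1 `1 (merge a₁ b₁′) λ h₁ →
  op `1 `1 (merge a₂′ b₂) λ h₂ → ret (h₁ , h₂)

_>>=_ : Prog X → (X → Prog Y) → Prog Y
ret x      >>= f = f x
op m n T p >>= f = op m n T (λ x → p x >>= f)

-- Both sides are multiplied by u, as the lozenge on the left has weight u⁻¹.
triangle-left triangle-right : State → State → State → State → Prog (Bool × Bool)
triangle-left a₁ a₂ b₁ b₂ =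
  op `u `1 (Rᴬ a₁ a₂) λ (c₁ , c₂) → op `u `1 (Rᴮ b₁ b₂) λ (d₁ , d₂) →
  triangle `1 `u c₁ c₂ d₁ d₂
triangle-right a₁ a₂ b₁ b₂ =
  op `u `u ((one , tt) ∷ []) λ _ → triangle `u `1 a₁ a₂ b₁ b₂ >>= λ (h₁ , h₂) →
  op `u `1 (Rᴴ h₁ h₂) ret

-- Yang-Baxter for a line with parameter `x` and adjacent columns `y₁`, `y₂`: the weights `u`, `w`,
-- `uw` are `y₁ / y₂`, `x / y₁`, `x / y₂`.
RLL-left RLL-right : Bool → Bool → Bool → Prog (Bool × Bool × Bool)
RLL-left h l₁ l₂ =
  op `u `1 (Rᴴ l₁ l₂) λ (k₁ , k₂) → op `w `1 (vertex h k₁) λ (h′ , m₁) →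
  op `uw `1 (vertex h′ k₂) λ (h″ , m₂) → ret (h″ , m₁ , m₂)
RLL-right h l₁ l₂ =
  op `uw `1 (vertex h l₁) λ (h′ , k₁) → op `w `1 (vertex h′ l₂) λ (h″ , k₂) →
  op `u `1 (Rᴴ k₁ k₂) λ (m₁ , m₂) → ret (h″ , m₁ , m₂)

_≟³_ : DecidableEquality (State × State × State)
_≟³_ = ×.≡-dec _≟_ (×.≡-dec _≟_ _≟_)

_≟ᵇ²_ : DecidableEquality (Bool × Bool)
_≟ᵇ²_ = ×.≡-dec _≟ᵇ_ _≟ᵇ_

_≟ᵇ³_ : DecidableEquality (Bool × Bool × Bool)
_≟ᵇ³_ = ×.≡-dec _≟ᵇ_ _≟ᵇ²_

AAB-agree : ∀ a₁ a₂ b → agree _≟³_ (AAB-left a₁ a₂ b) (AAB-right a₁ a₂ b) ≡ true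
AAB-agree = every³-sound (λ a₁ a₂ b → agree _≟³_ (AAB-left a₁ a₂ b) (AAB-right a₁ a₂ b)) refl

ABB-agree : ∀ a b₁ b₂ → agree _≟³_ (ABB-left a b₁ b₂) (ABB-right a b₁ b₂) ≡ true
ABB-agree = every³-sound (λ a b₁ b₂ → agree _≟³_ (ABB-left a b₁ b₂) (ABB-right a b₁ b₂)) refl

triangle-agree : ∀ a₁ a₂ b₁ b₂ →
                 agree _≟ᵇ²_ (triangle-left a₁ a₂ b₁ b₂) (triangle-right a₁ a₂ b₁ b₂) ≡ true
triangle-agree a₁ = every³-sound
  (λ a₂ b₁ b₂ → agree _≟ᵇ²_ (triangle-left a₁ a₂ b₁ b₂) (triangle-right a₁ a₂ b₁ b₂))
  (every-sound (λ a₁ → every λ a₂ → every λ b₁ → every λ b₂ →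
    agree _≟ᵇ²_ (triangle-left a₁ a₂ b₁ b₂) (triangle-right a₁ a₂ b₁ b₂)) refl a₁)

RLL-agree : ∀ h l₁ l₂ → agree _≟ᵇ³_ (RLL-left h l₁ l₂) (RLL-right h l₁ l₂) ≡ true
RLL-agree false false false = refl
RLL-agree false false true  = refl
RLL-agree false true  false = refl
RLL-agree false true  true  = refl
RLL-agree true  false false = refl
RLL-agree true  false true  = refl
RLL-agree true  true  false = refl
RLL-agree true  true  true  = refl

-- The triangle and the exchange of adjacent parameters

infix 8 _/_
_/_ : A → A → Laurent A
p / q = var p ⊗ inv q

/-trans : (p r q : A) → p / q ≋ p / r ⊗ r / q
/-trans p r q = begin
  var p ⊗ inv q                       ≈⟨ ⊗-cong ≋-refl (⊗-identityˡ _) ⟨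
  var p ⊗ (𝟙 ⊗ inv q)                 ≈⟨ ⊗-cong ≋-refl (⊗-cong (≋-trans (⊗-comm _ _) (var-inv r)) ≋-refl) ⟨
  var p ⊗ ((inv r ⊗ var r) ⊗ inv q)   ≈⟨ ⊗-cong ≋-refl (⊗-assoc _ _ _) ⟩
  var p ⊗ (inv r ⊗ (var r ⊗ inv q))   ≈⟨ ⊗-assoc _ _ _ ⟨
  p / r ⊗ r / q                       ∎
  where open L

/-inverse : (p q : A) → p / q ⊗ q / p ≋ 𝟙
/-inverse p q = ≋-trans (≋-sym (/-trans p q p)) (var-inv p)

swap : Fin n → Vec X (suc n) → Vec X (suc n)
swap zero    (x ∷ y ∷ xs) = y ∷ x ∷ xs
swap (suc i) (x ∷ xs)     = x ∷ swap i xs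

ratio : Fin n → Vec A (suc n) → Laurent A
ratio zero    (p ∷ q ∷ _) = p / q
ratio (suc i) (_ ∷ ps)    = ratio i ps

exchange : (X → X → Table (X × X)) → Laurent A → Fin n → Vec X (suc n) →
           (Vec X (suc n) → Laurent A) → Laurent A
exchange T u zero    (x ∷ y ∷ xs) k = ⟪ T x y ⟫ u 𝟙 λ (x′ , y′) → k (x′ ∷ y′ ∷ xs)
exchange T u (suc i) (x ∷ xs)     k = exchange T u i xs (k ∘ (x ∷_))

linear-exchange : (T : X → X → Table (X × X)) (u : Laurent A) (i : Fin n) (xs : Vec X (suc n)) →
                  Linear (exchange T u i xs)
linear-exchange T u zero    (x ∷ y ∷ xs) = linear-bind (linear-⟪⟫ (T x y) u 𝟙) λ _ → linear-at _
linear-exchange T u (suc i) (x ∷ xs)     = linear-bind (linear-exchange T u i xs) λ _ → linear-at _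

exchange-comm : {Φ : (X → Laurent A) → Laurent A} → Linear Φ →
                (T : Y → Y → Table (Y × Y)) (u : Laurent A) (i : Fin n) (ys : Vec Y (suc n))
                (f : X → Vec Y (suc n) → Laurent A) →
                Φ (λ x → exchange T u i ys (f x)) ≋ exchange T u i ys (λ zs → Φ (λ x → f x zs))
exchange-comm lΦ T u zero    (y ∷ z ∷ ys) f = linear-⟪⟫-comm lΦ (T y z) _ _ _
exchange-comm lΦ T u (suc i) (y ∷ ys)     f = exchange-comm lΦ T u i ys (λ x → f x ∘ (y ∷_))

-- The line with state b crosses those with states as, the last one first.
row : A → Vec A n → Vec State n → State → (Vec State n × State → Laurent A) → Laurent A
row q []       []       b k = k ([] , b)
row q (p ∷ ps) (a ∷ as) b k =
  row q ps as b λ (as′ , b′) → ⟪ cross a b′ ⟫ (p / q) 𝟙 λ (a′ , b″) → k (a′ ∷ as′ , b″)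

linear-row : (q : A) (ps : Vec A n) (as : Vec State n) (b : State) → Linear (row q ps as b)
linear-row q []       []       b = linear-at _
linear-row q (p ∷ ps) (a ∷ as) b = linear-bind (linear-row q ps as b) λ (as′ , b′) →
  linear-bind (linear-⟪⟫ (cross a b′) (p / q) 𝟙) λ (a′ , b″) → linear-at (a′ ∷ as′ , b″)

-- The partition function of a triangle: the i-th line from the left side,
-- with parameter pᵢ, crosses the j-th line from the right side, with
-- parameter qⱼ, for all j < i, and merges with the i-th one at the bottom.
Z : Vec A n → Vec A n → Vec State n → Vec State n → (Vec Bool n → Laurent A) → Laurent A
Z []       []       []       []       k = k []
Z (p ∷ ps) (q ∷ qs) (a ∷ as) (b ∷ bs) k =
  row q ps as b λ (as′ , b′) → ⟪ merge a b′ ⟫ 𝟙 𝟙 λ h → Z ps qs as′ bs (k ∘ (h ∷_))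

linear-Z : (ps qs : Vec A n) (as bs : Vec State n) → Linear (Z ps qs as bs)
linear-Z []       []       []       []       = linear-at _
linear-Z (p ∷ ps) (q ∷ qs) (a ∷ as) (b ∷ bs) = linear-bind (linear-row q ps as b) λ (as′ , b′) →
  linear-bind (linear-⟪⟫ (merge a b′) 𝟙 𝟙) λ h →
  linear-bind (linear-Z ps qs as′ bs) λ hs → linear-at (h ∷ hs)

valuation : (u w uw : Laurent A) → uw ≋ u ⊗ w → Valuation A
valuation u w uw eq = record
  { value = λ { `1 → 𝟙 ; `u → u ; `w → w ; `uw → uw } ; 1≋𝟙 = ≋-refl ; uw≋ = eq }

-- If the two left lines come first, the right line meets them last, and one Yang-Baxter equation
-- applies to what the rest of the row leaves; a line in front of them only adds a crossing that
-- commutes with the exchange.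
row-exchange : (i : Fin n) (q : A) (ps : Vec A (suc n)) (as : Vec State (suc n)) (b : State)
               (k : Vec State (suc n) × State → Laurent A) →
               row q (swap i ps) as b (λ (as′ , b′) → exchange Rᴬ (ratio i ps) i as′ λ as″ → k (as″ , b′))
                 ≋ exchange Rᴬ (ratio i ps) i as (λ as′ → row q ps as′ b k)
row-exchange zero q (p₁ ∷ p₂ ∷ ps) (a₁ ∷ a₂ ∷ as) b k = ≋-trans
  (cong (linear-row q ps as b) λ (as′ , b′) → ≋-sym
    (agree-sound _≟³_ (AAB-left a₁ a₂ b′) (AAB-right a₁ a₂ b′) (AAB-agree a₁ a₂ b′)
      (λ (a₁′ , a₂′ , b″) → k (a₁′ ∷ a₂′ ∷ as′ , b″))))
  (linear-⟪⟫-comm (linear-row q ps as b) (Rᴬ a₁ a₂) _ _ _)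
  where open Valuation (valuation (p₁ / p₂) (p₂ / q) (p₁ / q) (/-trans p₁ p₂ q))
row-exchange (suc i) q (p ∷ ps) (a ∷ as) b k = ≋-trans
  (cong (linear-row q (swap i ps) as b) λ (as′ , b′) → ≋-sym
    (linear-⟪⟫-comm (linear-exchange Rᴬ (ratio i ps) i as′) (cross a b′) _ _ _))
  (row-exchange i q ps as b λ (as′ , b′) →
    ⟪ cross a b′ ⟫ (p / q) 𝟙 λ (a′ , b″) → k (a′ ∷ as′ , b″))

-- The railroad argument: `Rᴮ` is pulled through the left lines one at a time, from the outgoing
-- ends of the two right lines to the incoming ones. The head line is crossed last, so it is passed
-- first.
rows-exchange : (q₁ q₂ : A) (ps : Vec A n) (as : Vec State n) (b₁ b₂ : State)
                (k : Vec State n × State × State → Laurent A) →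
                row q₂ ps as b₁ (λ (as′ , c₁) → row q₁ ps as′ b₂ λ (as″ , c₂) →
                  ⟪ Rᴮ c₁ c₂ ⟫ (q₁ / q₂) 𝟙 λ (d₁ , d₂) → k (as″ , d₁ , d₂))
                ≋ ⟪ Rᴮ b₁ b₂ ⟫ (q₁ / q₂) 𝟙 (λ (c₁ , c₂) →
                  row q₁ ps as c₁ λ (as′ , d₁) → row q₂ ps as′ c₂ λ (as″ , d₂) → k (as″ , d₁ , d₂))
rows-exchange q₁ q₂ []       []       b₁ b₂ k = ≋-refl
rows-exchange q₁ q₂ (p ∷ ps) (a ∷ as) b₁ b₂ k = begin
  row q₂ ps as b₁ (λ (as′ , c₁) → ⟪ cross a c₁ ⟫ (p / q₂) 𝟙 λ (a′ , c₁′) →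
    row q₁ ps as′ b₂ λ (as″ , c₂) → ⟪ cross a′ c₂ ⟫ (p / q₁) 𝟙 λ (a″ , c₂′) →
    ⟪ Rᴮ c₁′ c₂′ ⟫ (q₁ / q₂) 𝟙 λ (d₁ , d₂) → k (a″ ∷ as″ , d₁ , d₂))
    -- The two crossings with the head line become adjacent.
    ≈⟨ (cong (linear-row q₂ ps as b₁) λ (as′ , c₁) → ≋-sym
         (linear-⟪⟫-comm (linear-row q₁ ps as′ b₂) (cross a c₁) _ _ _)) ⟩
  row q₂ ps as b₁ (λ (as′ , c₁) → row q₁ ps as′ b₂ λ (as″ , c₂) →
    ⟪ cross a c₁ ⟫ (p / q₂) 𝟙 λ (a′ , c₁′) → ⟪ cross a′ c₂ ⟫ (p / q₁) 𝟙 λ (a″ , c₂′) →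
    ⟪ Rᴮ c₁′ c₂′ ⟫ (q₁ / q₂) 𝟙 λ (d₁ , d₂) → k (a″ ∷ as″ , d₁ , d₂))
    ≈⟨ (cong (linear-row q₂ ps as b₁) λ (as′ , c₁) → cong (linear-row q₁ ps as′ b₂) λ (as″ , c₂) →
         ≋-sym (agree-sound _≟³_ (ABB-left a c₁ c₂) (ABB-right a c₁ c₂) (ABB-agree a c₁ c₂)
           (λ (a″ , d₁ , d₂) → k (a″ ∷ as″ , d₁ , d₂)))) ⟩
  row q₂ ps as b₁ (λ (as′ , c₁) → row q₁ ps as′ b₂ λ (as″ , c₂) →
    ⟪ Rᴮ c₁ c₂ ⟫ (q₁ / q₂) 𝟙 λ (d₁ , d₂) →
    ⟪ cross a d₁ ⟫ (p / q₁) 𝟙 λ (a′ , d₁′) → ⟪ cross a′ d₂ ⟫ (p / q₂) 𝟙 λ (a″ , d₂′) →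
    k (a″ ∷ as″ , d₁′ , d₂′))
    ≈⟨ rows-exchange q₁ q₂ ps as b₁ b₂ (λ (as″ , d₁ , d₂) →
         ⟪ cross a d₁ ⟫ (p / q₁) 𝟙 λ (a′ , d₁′) → ⟪ cross a′ d₂ ⟫ (p / q₂) 𝟙 λ (a″ , d₂′) →
         k (a″ ∷ as″ , d₁′ , d₂′)) ⟩
  ⟪ Rᴮ b₁ b₂ ⟫ (q₁ / q₂) 𝟙 (λ (c₁ , c₂) →
    row q₁ ps as c₁ λ (as′ , d₁) → row q₂ ps as′ c₂ λ (as″ , d₂) →
    ⟪ cross a d₁ ⟫ (p / q₁) 𝟙 λ (a′ , d₁′) → ⟪ cross a′ d₂ ⟫ (p / q₂) 𝟙 λ (a″ , d₂′) →
    k (a″ ∷ as″ , d₁′ , d₂′))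
    ≈⟨ (cong (linear-⟪⟫ (Rᴮ b₁ b₂) _ _) λ (c₁ , c₂) → cong (linear-row q₁ ps as c₁) λ (as′ , d₁) →
         linear-⟪⟫-comm (linear-row q₂ ps as′ c₂) (cross a d₁) _ _ _) ⟩
  ⟪ Rᴮ b₁ b₂ ⟫ (q₁ / q₂) 𝟙 (λ (c₁ , c₂) →
    row q₁ ps as c₁ λ (as′ , d₁) → ⟪ cross a d₁ ⟫ (p / q₁) 𝟙 λ (a′ , d₁′) →
    row q₂ ps as′ c₂ λ (as″ , d₂) → ⟪ cross a′ d₂ ⟫ (p / q₂) 𝟙 λ (a″ , d₂′) →
    k (a″ ∷ as″ , d₁′ , d₂′)) ∎
  where
  open L
  open Valuation (valuation (q₁ / q₂) (p / q₁) (p / q₂)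
    (≋-trans (/-trans p q₁ q₂) (⊗-comm _ _)))

Z₂ : Laurent A → State → State → State → State → (Bool × Bool → Laurent A) → Laurent A
Z₂ w a₁ a₂ b₁ b₂ f =
  ⟪ cross a₂ b₁ ⟫ w 𝟙 λ (a₂′ , b₁′) → ⟪ merge a₁ b₁′ ⟫ 𝟙 𝟙 λ h₁ →
  ⟪ merge a₂′ b₂ ⟫ 𝟙 𝟙 λ h₂ → f (h₁ , h₂)

-- The weight of the lozenge turns into its inverse, while `agree` only knows polynomials in `u`; so
-- the identity is checked after multiplication by the unit `u`, which `cancel` removes.
Z₂-exchange : (p q : A) (a₁ a₂ b₁ b₂ : State) (f : Bool × Bool → Laurent A) →
              Z₂ (p / q) a₁ a₂ b₁ b₂ (λ (h₁ , h₂) → ⟪ Rᴴ h₁ h₂ ⟫ (p / q) 𝟙 f)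
              ≋ ⟪ Rᴬ a₁ a₂ ⟫ (p / q) 𝟙 (λ (c₁ , c₂) → ⟪ Rᴮ b₁ b₂ ⟫ (p / q) 𝟙 λ (d₁ , d₂) →
                Z₂ (q / p) c₁ c₂ d₁ d₂ f)
Z₂-exchange {A} p q a₁ a₂ b₁ b₂ f = cancel (≋-sym (begin
  u ⊗ ⟪ Rᴬ a₁ a₂ ⟫ u 𝟙 (λ (c₁ , c₂) → ⟪ Rᴮ b₁ b₂ ⟫ u 𝟙 λ (d₁ , d₂) → Z₂ (q / p) c₁ c₂ d₁ d₂ f)
    ≈⟨ scale (linear-⟪⟫ (Rᴬ a₁ a₂) u 𝟙) u _ ⟨
  ⟪ Rᴬ a₁ a₂ ⟫ u 𝟙 (λ (c₁ , c₂) → u ⊗ ⟪ Rᴮ b₁ b₂ ⟫ u 𝟙 λ (d₁ , d₂) → Z₂ (q / p) c₁ c₂ d₁ d₂ f)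
    ≈⟨ (cong (linear-⟪⟫ (Rᴬ a₁ a₂) u 𝟙) λ _ → scale (linear-⟪⟫ (Rᴮ b₁ b₂) u 𝟙) u _) ⟨
  ⟪ Rᴬ a₁ a₂ ⟫ u 𝟙 (λ (c₁ , c₂) → ⟪ Rᴮ b₁ b₂ ⟫ u 𝟙 λ (d₁ , d₂) → u ⊗ Z₂ (q / p) c₁ c₂ d₁ d₂ f)
    ≈⟨ (cong (linear-⟪⟫ (Rᴬ a₁ a₂) u 𝟙) λ (c₁ , c₂) → cong (linear-⟪⟫ (Rᴮ b₁ b₂) u 𝟙) λ (d₁ , d₂) →
        ≋-trans (≋-sym (⟪⟫-scale (cross c₂ d₁) u _ _ _))
                (⟪⟫-cong (cross c₂ d₁) _ (/-inverse p q) (L.*-identityʳ u))) ⟩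
  eval (triangle-left a₁ a₂ b₁ b₂) f
    ≈⟨ agree-sound _≟ᵇ²_ (triangle-left a₁ a₂ b₁ b₂) (triangle-right a₁ a₂ b₁ b₂)
         (triangle-agree a₁ a₂ b₁ b₂) f ⟩
  eval (triangle-right a₁ a₂ b₁ b₂) f
    ≈⟨ L.+-identityʳ _ ⟩
  u ⊗ Z₂ u a₁ a₂ b₁ b₂ (λ (h₁ , h₂) → ⟪ Rᴴ h₁ h₂ ⟫ u 𝟙 f) ∎))
  where
  open L
  u = p / q
  open Valuation (valuation u 𝟙 u (≋-sym (L.*-identityʳ u)))
  v⊗u⊗ : ∀ g → q / p ⊗ (u ⊗ g) ≋ g
  v⊗u⊗ g = ≋-trans (≋-sym (⊗-assoc _ _ _))
    (≋-trans (⊗-cong (/-inverse q p) ≋-refl) (⊗-identityˡ g))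
  cancel : ∀ {g h} → u ⊗ g ≋ u ⊗ h → g ≋ h
  cancel {g} {h} eq = ≋-trans (≋-sym (v⊗u⊗ g)) (≋-trans (⊗-cong ≋-refl eq) (v⊗u⊗ h))

-- Isolates the corner of the first two lines: the rest of the second row meets only later left
-- lines, hence commutes with the lozenge and the first bottom tile of the corner.
Z-unfold : (p₁ p₂ q₁ q₂ : A) (ps qs : Vec A n) (a₁ a₂ b₁ b₂ : State) (as bs : Vec State n)
           (k : Vec Bool (suc (suc n)) → Laurent A) →
           Z (p₁ ∷ p₂ ∷ ps) (q₁ ∷ q₂ ∷ qs) (a₁ ∷ a₂ ∷ as) (b₁ ∷ b₂ ∷ bs) k
           ≋ row q₁ ps as b₁ λ (as′ , c₁) → row q₂ ps as′ b₂ λ (as″ , c₂) →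
             Z₂ (p₂ / q₁) a₁ a₂ c₁ c₂ λ (h₁ , h₂) → Z ps qs as″ bs (λ hs → k (h₁ ∷ h₂ ∷ hs))
Z-unfold p₁ p₂ q₁ q₂ ps qs a₁ a₂ b₁ b₂ as bs k = cong (linear-row q₁ ps as b₁) λ (as′ , c₁) → ≋-trans
  (cong (linear-⟪⟫ (cross a₂ c₁) _ _) λ (a₂′ , b₁′) → ≋-sym
    (linear-⟪⟫-comm (linear-row q₂ ps as′ b₂) (merge a₁ b₁′) _ _ _))
  (≋-sym (linear-⟪⟫-comm (linear-row q₂ ps as′ b₂) (cross a₂ c₁) _ _ _))

-- For the first two lines the corner turns `Rᴴ` into `Rᴬ` and `Rᴮ`; then `Rᴬ` is already at the
-- left side, and `rows-exchange` takes `Rᴮ` to the right side. For later lines both left ones cross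
-- the first right line, which is `row-exchange`, while the first left line meets neither of the two
-- right ones.
Z-exchange : (i : Fin n) (ys : Vec A (suc n)) (as bs : Vec State (suc n))
             (k : Vec Bool (suc n) → Laurent A) →
             Z (swap i ys) (swap i ys) as bs (λ hs → exchange Rᴴ (ratio i ys) i hs k)
             ≋ exchange Rᴬ (ratio i ys) i as (λ as′ → exchange Rᴮ (ratio i ys) i bs λ bs′ →
               Z ys ys as′ bs′ k)
Z-exchange zero (y₁ ∷ y₂ ∷ ys) (a₁ ∷ a₂ ∷ as) (b₁ ∷ b₂ ∷ bs) k = begin
  Z (y₂ ∷ y₁ ∷ ys) (y₂ ∷ y₁ ∷ ys) (a₁ ∷ a₂ ∷ as) (b₁ ∷ b₂ ∷ bs) (λ hs → exchange Rᴴ u zero hs k)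
    ≈⟨ Z-unfold y₂ y₁ y₂ y₁ ys ys a₁ a₂ b₁ b₂ as bs (λ hs → exchange Rᴴ u zero hs k) ⟩
  row y₂ ys as b₁ (λ (as′ , c₁) → row y₁ ys as′ b₂ λ (as″ , c₂) →
    Z₂ u a₁ a₂ c₁ c₂ λ (h₁ , h₂) → Z ys ys as″ bs λ hs →
    ⟪ Rᴴ h₁ h₂ ⟫ u 𝟙 λ (h₁′ , h₂′) → k (h₁′ ∷ h₂′ ∷ hs))
    ≈⟨ (cong (linear-row y₂ ys as b₁) λ (as′ , c₁) → cong (linear-row y₁ ys as′ b₂) λ (as″ , c₂) →
        ≋-trans
          (cong (linear-⟪⟫ (cross a₂ c₁) _ _) λ (a₂′ , b₁′) → cong (linear-⟪⟫ (merge a₁ b₁′) _ _) λ h₁ →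
            cong (linear-⟪⟫ (merge a₂′ c₂) _ _) λ h₂ →
            linear-⟪⟫-comm (linear-Z ys ys as″ bs) (Rᴴ h₁ h₂) _ _ _)
          (Z₂-exchange y₁ y₂ a₁ a₂ c₁ c₂ (f as″))) ⟩
  row y₂ ys as b₁ (λ (as′ , c₁) → row y₁ ys as′ b₂ λ (as″ , c₂) →
    ⟪ Rᴬ a₁ a₂ ⟫ u 𝟙 λ (e₁ , e₂) → ⟪ Rᴮ c₁ c₂ ⟫ u 𝟙 λ (d₁ , d₂) → Z₂ (y₂ / y₁) e₁ e₂ d₁ d₂ (f as″))
    ≈⟨ ≋-trans
        (cong (linear-row y₂ ys as b₁) λ (as′ , c₁) →
          linear-⟪⟫-comm (linear-row y₁ ys as′ b₂) (Rᴬ a₁ a₂) _ _ _)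
        (linear-⟪⟫-comm (linear-row y₂ ys as b₁) (Rᴬ a₁ a₂) _ _ _) ⟩
  ⟪ Rᴬ a₁ a₂ ⟫ u 𝟙 (λ (e₁ , e₂) →
    row y₂ ys as b₁ λ (as′ , c₁) → row y₁ ys as′ b₂ λ (as″ , c₂) →
    ⟪ Rᴮ c₁ c₂ ⟫ u 𝟙 λ (d₁ , d₂) → Z₂ (y₂ / y₁) e₁ e₂ d₁ d₂ (f as″))
    ≈⟨ (cong (linear-⟪⟫ (Rᴬ a₁ a₂) _ _) λ (e₁ , e₂) → rows-exchange y₁ y₂ ys as b₁ b₂
        λ (as″ , d₁ , d₂) → Z₂ (y₂ / y₁) e₁ e₂ d₁ d₂ (f as″)) ⟩
  ⟪ Rᴬ a₁ a₂ ⟫ u 𝟙 (λ (e₁ , e₂) → ⟪ Rᴮ b₁ b₂ ⟫ u 𝟙 λ (c₁ , c₂) →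
    row y₁ ys as c₁ λ (as′ , d₁) → row y₂ ys as′ c₂ λ (as″ , d₂) →
    Z₂ (y₂ / y₁) e₁ e₂ d₁ d₂ (f as″))
    ≈⟨ (cong (linear-⟪⟫ (Rᴬ a₁ a₂) _ _) λ (e₁ , e₂) → cong (linear-⟪⟫ (Rᴮ b₁ b₂) _ _) λ (c₁ , c₂) →
        Z-unfold y₁ y₂ y₁ y₂ ys ys e₁ e₂ c₁ c₂ as bs k) ⟨
  ⟪ Rᴬ a₁ a₂ ⟫ u 𝟙 (λ (e₁ , e₂) → ⟪ Rᴮ b₁ b₂ ⟫ u 𝟙 λ (c₁ , c₂) →
    Z (y₁ ∷ y₂ ∷ ys) (y₁ ∷ y₂ ∷ ys) (e₁ ∷ e₂ ∷ as) (c₁ ∷ c₂ ∷ bs) k) ∎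
  where
  open L
  u = y₁ / y₂
  f : Vec State _ → Bool × Bool → Laurent _
  f as″ (h₁ , h₂) = Z ys ys as″ bs (λ hs → k (h₁ ∷ h₂ ∷ hs))
Z-exchange (suc i) (y ∷ ys) (a ∷ as) (b ∷ bs) k = begin
  row y (swap i ys) as b (λ (as′ , b′) → ⟪ merge a b′ ⟫ 𝟙 𝟙 λ h →
    Z (swap i ys) (swap i ys) as′ bs (λ hs → exchange Rᴴ u i hs (k ∘ (h ∷_))))
    ≈⟨ (cong (linear-row y (swap i ys) as b) λ (as′ , b′) → cong (linear-⟪⟫ (merge a b′) _ _) λ h →
        Z-exchange i ys as′ bs (k ∘ (h ∷_))) ⟩
  row y (swap i ys) as b (λ (as′ , b′) → ⟪ merge a b′ ⟫ 𝟙 𝟙 λ h →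
    exchange Rᴬ u i as′ λ as″ → exchange Rᴮ u i bs λ bs′ → Z ys ys as″ bs′ (k ∘ (h ∷_)))
    ≈⟨ (cong (linear-row y (swap i ys) as b) λ (as′ , b′) →
        linear-⟪⟫-comm (linear-exchange Rᴬ u i as′) (merge a b′) _ _ _) ⟨
  row y (swap i ys) as b (λ (as′ , b′) → exchange Rᴬ u i as′ λ as″ → ⟪ merge a b′ ⟫ 𝟙 𝟙 λ h →
    exchange Rᴮ u i bs λ bs′ → Z ys ys as″ bs′ (k ∘ (h ∷_)))
    ≈⟨ row-exchange i y ys as b (λ (as′ , b′) → ⟪ merge a b′ ⟫ 𝟙 𝟙 λ h →
        exchange Rᴮ u i bs λ bs′ → Z ys ys as′ bs′ (k ∘ (h ∷_))) ⟩
  exchange Rᴬ u i as (λ as′ → row y ys as′ b λ (as″ , b′) → ⟪ merge a b′ ⟫ 𝟙 𝟙 λ h →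
    exchange Rᴮ u i bs λ bs′ → Z ys ys as″ bs′ (k ∘ (h ∷_)))
    ≈⟨ (cong (linear-exchange Rᴬ u i as) λ as′ → ≋-trans
        (cong (linear-row y ys as′ b) λ (as″ , b′) → ≋-sym
          (linear-⟪⟫-comm (linear-exchange Rᴮ u i bs) (merge a b′) _ _ _))
        (exchange-comm (linear-row y ys as′ b) Rᴮ u i bs _)) ⟩
  exchange Rᴬ u i as (λ as′ → exchange Rᴮ u i bs λ bs′ → row y ys as′ b λ (as″ , b′) →
    ⟪ merge a b′ ⟫ 𝟙 𝟙 λ h → Z ys ys as″ bs′ (k ∘ (h ∷_))) ∎
  where
  open L
  u = ratio i ys

-- Double Grothendieck polynomials as a five-vertex model

-- A horizontal line with parameter x enters on the left and leaves on the
-- right in state false; it adds one letter true to the frame.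
line : A → Bool → Vec A n → Vec Bool n → (Vec Bool n → Laurent A) → Laurent A
line x h []       []       k = if h then 𝟘 else k []
line x h (y ∷ ys) (l ∷ ls) k =
  ⟪ vertex h l ⟫ (x / y) 𝟙 λ (h′ , m) → line x h′ ys ls (k ∘ (m ∷_))

linear-line : (x : A) (h : Bool) (ys : Vec A n) (ls : Vec Bool n) → Linear (line x h ys ls)
linear-line x false []       []       = linear-at _
linear-line x true  []       []       = linear-𝟘
linear-line x h     (y ∷ ys) (l ∷ ls) = linear-bind (linear-⟪⟫ (vertex h l) (x / y) 𝟙) λ (h′ , m) →
  linear-bind (linear-line x h′ ys ls) λ ms → linear-at (m ∷ ms)

line-exchange : (i : Fin n) (x : A) (h : Bool) (ys : Vec A (suc n)) (ls : Vec Bool (suc n))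
                (k : Vec Bool (suc n) → Laurent A) →
                line x h (swap i ys) ls (λ ms → exchange Rᴴ (ratio i ys) i ms k)
                ≋ exchange Rᴴ (ratio i ys) i ls (λ ls′ → line x h ys ls′ k)
line-exchange zero x h (y₁ ∷ y₂ ∷ ys) (l₁ ∷ l₂ ∷ ls) k = ≋-trans
  (cong (linear-⟪⟫ (vertex h l₁) _ _) λ (h′ , k₁) → cong (linear-⟪⟫ (vertex h′ l₂) _ _) λ (h″ , k₂) →
    linear-⟪⟫-comm (linear-line x h″ ys ls) (Rᴴ k₁ k₂) _ _ _)
  (≋-sym (agree-sound _≟ᵇ³_ (RLL-left h l₁ l₂) (RLL-right h l₁ l₂) (RLL-agree h l₁ l₂)
    λ (h″ , m₁ , m₂) → line x h″ ys ls λ ms → k (m₁ ∷ m₂ ∷ ms)))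
  where open Valuation (valuation (y₁ / y₂) (x / y₁) (x / y₂)
               (≋-trans (/-trans x y₁ y₂) (⊗-comm _ _)))
line-exchange (suc i) x h (y ∷ ys) (l ∷ ls) k = ≋-trans
  (cong (linear-⟪⟫ (vertex h l) _ _) λ (h′ , m) → line-exchange i x h′ ys ls (k ∘ (m ∷_)))
  (exchange-comm (linear-⟪⟫ (vertex h l) (x / y) 𝟙) Rᴴ (ratio i ys) i ls _)

δ : Vec Bool n → Vec Bool n → Laurent A
δ []           []           = 𝟙
δ (true ∷ bs)  (true ∷ cs)  = δ bs cs
δ (false ∷ bs) (false ∷ cs) = δ bs cs
δ (true ∷ bs)  (false ∷ cs) = 𝟘
δ (false ∷ bs) (true ∷ cs)  = 𝟘

δ-refl : (S : Vec Bool n) → δ {A = A} S S ≡ 𝟙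
δ-refl []          = refl
δ-refl (true ∷ S)  = δ-refl S
δ-refl (false ∷ S) = δ-refl S

δ-≢ : (S T : Vec Bool n) → S ≢ T → δ {A = A} S T ≡ 𝟘
δ-≢ []          []          S≢T = ⊥-elim (S≢T refl)
δ-≢ (true ∷ S)  (true ∷ T)  S≢T = δ-≢ S T (S≢T ∘ ≡.cong (true ∷_))
δ-≢ (false ∷ S) (false ∷ T) S≢T = δ-≢ S T (S≢T ∘ ≡.cong (false ∷_))
δ-≢ (true ∷ S)  (false ∷ T) S≢T = refl
δ-≢ (false ∷ S) (true ∷ T)  S≢T = refl

-- The frame {m+1,...,m+j}, cut off at n: `block 0 k n` belongs to the empty diagram and
-- `block (n ∸ k) k n` to the full rectangle.
block : (m j n : ℕ) → Vec Bool n
block m       j       zero    = []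
block (suc m) j       (suc n) = false ∷ block m j n
block zero    (suc j) (suc n) = true ∷ block zero j n
block zero    zero    (suc n) = false ∷ block zero zero n

-- The head of `xs` acts innermost, next to `f`: its line is the first to add a letter to the
-- vacuum.
iterate : Vec A n → Vec A k → (Vec Bool n → Laurent A) → Vec Bool n → Laurent A
iterate ys []       f = f
iterate ys (x ∷ xs) f = iterate ys xs λ S → line x true ys S f

-- The double Grothendieck polynomial of the frame S.
Γ : Vec A k → Vec A n → Vec Bool n → Laurent A
Γ {n = n} xs ys = iterate ys xs (δ (block 0 0 n))

1⊗⊕𝟘 : (f : Laurent A) → 𝟙 ⊗ f ⊕ 𝟘 ≋ f
1⊗⊕𝟘 f = ≋-trans (L.+-identityʳ _) (⊗-identityˡ f)

⊗𝟘⊕ : ∀ {c f g : Laurent A} → f ≋ 𝟘 → c ⊗ f ⊕ g ≋ g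
⊗𝟘⊕ f≋𝟘 = ≋-trans (⊕-cong (≋-trans (⊗-cong ≋-refl f≋𝟘) (L.zeroʳ _)) ≋-refl) (⊕-identityˡ _)

vacuum-exchange : (u : Laurent A) (i : Fin n) (S : Vec Bool (suc n)) →
                  exchange Rᴴ u i S (δ (block 0 0 _)) ≋ δ (block 0 0 _) S
vacuum-exchange u zero (false ∷ false ∷ S) = 1⊗⊕𝟘 _
vacuum-exchange u zero (false ∷ true ∷ S)  = ≋-trans (⊗𝟘⊕ ≋-refl) (⊗𝟘⊕ ≋-refl)
vacuum-exchange u zero (true ∷ false ∷ S)  = 1⊗⊕𝟘 _
vacuum-exchange u zero (true ∷ true ∷ S)   = 1⊗⊕𝟘 _
vacuum-exchange u (suc i) (false ∷ S) = vacuum-exchange u i S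
vacuum-exchange u (suc i) (true ∷ S)  = zeroes (linear-exchange Rᴴ u i S)

iterate-exchange : (i : Fin n) (xs : Vec A k) (ys : Vec A (suc n)) {f g : Vec Bool (suc n) → Laurent A} →
                   (∀ S → g S ≋ exchange Rᴴ (ratio i ys) i S f) →
                   ∀ S → iterate (swap i ys) xs g S ≋ exchange Rᴴ (ratio i ys) i S (iterate ys xs f)
iterate-exchange i []       ys g≋ S = g≋ S
iterate-exchange i (x ∷ xs) ys {f} g≋ S = iterate-exchange i xs ys
  (λ S → ≋-trans (cong (linear-line x true (swap i ys) S) g≋) (line-exchange i x true ys S f)) S

-- This is D_i solved for the reflected polynomial: if the frame of λ contains i+1 but not i, then
-- G^λ(s_i y) = u G^λ + (1 - u) G^μ with u = y_i / y_{i+1}. For all other frames it is the symmetry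
-- in y_i and y_{i+1}.
Γ-exchange : (i : Fin n) (xs : Vec A k) (ys : Vec A (suc n)) (S : Vec Bool (suc n)) →
             Γ xs (swap i ys) S ≋ exchange Rᴴ (ratio i ys) i S (Γ xs ys)
Γ-exchange i xs ys = iterate-exchange i xs ys λ S → ≋-sym (vacuum-exchange _ i S)

⟦_⟧ᵇ : Bool → ℕ
⟦ b ⟧ᵇ = if b then 1 else 0

-- Each entry of `vertex` conserves particles, `h + m = h′ + l`, and the line leaves without one.
line-support : (x : A) (h : Bool) (ys : Vec A n) (S : Vec Bool n) {f : Vec Bool n → Laurent A} →
               (∀ T → ∣ S ∣ ≡ ⟦ h ⟧ᵇ + ∣ T ∣ → f T ≋ 𝟘) → line x h ys S f ≋ 𝟘
line-support x false []       []          f≋𝟘 = f≋𝟘 [] refl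
line-support x true  []       []          f≋𝟘 = ≋-refl
line-support x false (y ∷ ys) (false ∷ S) f≋𝟘 = ≋-trans
  (⊗𝟘⊕ (line-support x false ys S λ T → f≋𝟘 (false ∷ T)))
  (⊗𝟘⊕ (line-support x true ys S λ T → f≋𝟘 (true ∷ T)))
line-support x false (y ∷ ys) (true ∷ S)  f≋𝟘 = ≋-refl
line-support x true  (y ∷ ys) (false ∷ S) f≋𝟘 =
  ⊗𝟘⊕ (line-support x true ys S λ T → f≋𝟘 (false ∷ T))
line-support x true  (y ∷ ys) (true ∷ S)  f≋𝟘 = ≋-trans
  (⊗𝟘⊕ (line-support x false ys S λ T → f≋𝟘 (false ∷ T) ∘ ≡.cong suc))
  (⊗𝟘⊕ (line-support x true ys S λ T → f≋𝟘 (true ∷ T) ∘ ≡.cong suc))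

iterate-support : (ys : Vec A n) (xs : Vec A k) {j : ℕ} {f : Vec Bool n → Laurent A} →
                  (∀ S → ∣ S ∣ ≢ j → f S ≋ 𝟘) → ∀ S → ∣ S ∣ ≢ k + j → iterate ys xs f S ≋ 𝟘
iterate-support ys []           f≋𝟘 = f≋𝟘
iterate-support ys (x ∷ xs) {j} f≋𝟘 S ≢k+j = iterate-support ys xs {suc j}
  (λ S ≢j → line-support x true ys S λ T eq → f≋𝟘 T λ { refl → ≢j eq })
  S (λ eq → ≢k+j (≡.trans eq (ℕ.+-suc _ j)))

vacuum-support : (S : Vec Bool n) → ∣ S ∣ ≢ 0 → δ {A = A} (block 0 0 n) S ≋ 𝟘
vacuum-support []          ≢0 = ⊥-elim (≢0 refl)
vacuum-support (false ∷ S) ≢0 = vacuum-support S ≢0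
vacuum-support (true ∷ S)  ≢0 = ≋-refl

Γ-support : (xs : Vec A k) (ys : Vec A n) (S : Vec Bool n) → ∣ S ∣ ≢ k → Γ xs ys S ≋ 𝟘
Γ-support xs ys S ≢k = iterate-support ys xs vacuum-support S (λ eq → ≢k (≡.trans eq (ℕ.+-identityʳ _)))

-- The frame {m+1,…,m+j} corresponds to the rectangle of j rows and m
-- columns; the lines producing it pass straight through the first m columns.
passing : ℕ → A → Vec A n → Laurent A
passing zero    x ys       = 𝟙
passing (suc m) x []       = 𝟙
passing (suc m) x (y ∷ ys) = (𝟙 ⊝ x / y) ⊗ passing m x ys

-- A line in state true can turn off only at a letter true of the new frame; without one it would
-- still be true at the right end.
line-true-vacuum : (x : A) (ys : Vec A n) (f : Vec Bool n → Laurent A) →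
                   line x true ys (block 0 0 n) f ≋ 𝟘
line-true-vacuum x []       f = ≋-refl
line-true-vacuum x (y ∷ ys) f = ⊗𝟘⊕ (line-true-vacuum x ys _)

line-false-vacuum : (x : A) (ys : Vec A n) (f : Vec Bool n → Laurent A) →
                    line x false ys (block 0 0 n) f ≋ f (block 0 0 n)
line-false-vacuum x []       f = ≋-refl
line-false-vacuum x (y ∷ ys) f = ≋-trans
  (⊕-cong (⊗-cong ≋-refl (line-false-vacuum x ys _)) (⊗𝟘⊕ (line-true-vacuum x ys _)))
  (1⊗⊕𝟘 _)

-- The path is forced. Turning off before the last letter true leads to a letter true with incoming
-- state false, where `vertex` has no entry; staying on after it is excluded by `line-true-vacuum`.
line-block : (m j : ℕ) (x : A) (ys : Vec A n) (f : Vec Bool n → Laurent A) → m + suc j ≤ n →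
             line x true ys (block m (suc j) n) f ≋ passing m x ys ⊗ f (block m j n)
line-block zero zero x (y ∷ ys) f m+j≤n = ≋-trans
  (⊕-cong (≋-trans (⊗-identityˡ _) (line-false-vacuum x ys _))
          (⊗𝟘⊕ (line-true-vacuum x ys _)))
  (≋-trans (L.+-identityʳ _) (≋-sym (⊗-identityˡ _)))
line-block zero (suc j) x (y ∷ y′ ∷ ys) f (s≤s m+j≤n) = ≋-trans (⊗𝟘⊕ ≋-refl)
  (≋-trans (1⊗⊕𝟘 _) (line-block zero j x (y′ ∷ ys) (f ∘ (true ∷_)) m+j≤n))
line-block zero (suc j) x (y ∷ []) f (s≤s ())
line-block (suc m) j x (y ∷ ys) f (s≤s m+j≤n) = ≋-trans (L.+-identityʳ _)
  (≋-trans (⊗-cong ≋-refl (line-block m j x ys (f ∘ (false ∷_)) m+j≤n)) (≋-sym (⊗-assoc _ _ _)))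

iterate-block : (m j : ℕ) (xs : Vec A k) (ys : Vec A n) (f : Vec Bool n → Laurent A) → m + (k + j) ≤ n →
                iterate ys xs f (block m (k + j) n)
                ≋ ∏ (λ i → passing m (lookup xs i) ys) ⊗ f (block m j n)
iterate-block m j [] ys f le = ≋-sym (⊗-identityˡ _)
iterate-block {k = suc k} {n = n} m j (x ∷ xs) ys f le = begin
  iterate ys xs f′ (block m (suc (k + j)) n)
    ≡⟨ ≡.cong (λ l → iterate ys xs f′ (block m l n)) (ℕ.+-suc k j) ⟨
  iterate ys xs f′ (block m (k + suc j) n)
    ≈⟨ iterate-block m (suc j) xs ys f′ le′ ⟩
  ∏ (λ i → passing m (lookup xs i) ys) ⊗ f′ (block m (suc j) n)
    ≈⟨ ⊗-cong ≋-refl (line-block m j x ys f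
         (ℕ.≤-trans (ℕ.+-monoʳ-≤ m (ℕ.m≤n+m (suc j) k)) le′)) ⟩
  ∏ (λ i → passing m (lookup xs i) ys) ⊗ (passing m x ys ⊗ f (block m j n))
    ≈⟨ L.x*yz≈y*xz _ _ _ ⟩
  passing m x ys ⊗ (∏ (λ i → passing m (lookup xs i) ys) ⊗ f (block m j n))
    ≈⟨ ⊗-assoc _ _ _ ⟨
  ∏ (λ i → passing m (lookup (x ∷ xs) i) ys) ⊗ f (block m j n) ∎
  where
  open L
  f′ = λ S → line x true ys S f
  le′ : m + (k + suc j) ≤ n
  le′ = ≡.subst (λ l → m + l ≤ n) (≡.sym (ℕ.+-suc k j)) le

block-zero : (m n : ℕ) → block m 0 n ≡ block 0 0 n
block-zero zero    n       = refl
block-zero (suc m) zero    = refl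
block-zero (suc m) (suc n) = ≡.cong (false ∷_) (block-zero m n)

Γ-block : (m : ℕ) (xs : Vec A k) (ys : Vec A n) → m + k ≤ n →
          Γ xs ys (block m k n) ≋ ∏ (λ i → passing m (lookup xs i) ys)
Γ-block {k = k} {n = n} m xs ys le = begin
  Γ xs ys (block m k n)
    ≡⟨ ≡.cong (λ j → Γ xs ys (block m j n)) (ℕ.+-identityʳ k) ⟨
  Γ xs ys (block m (k + 0) n)
    ≈⟨ iterate-block m 0 xs ys _ (≡.subst (λ j → m + j ≤ n) (≡.sym (ℕ.+-identityʳ k)) le) ⟩
  ∏ (λ i → passing m (lookup xs i) ys) ⊗ δ (block 0 0 n) (block m 0 n)
    ≈⟨ ⊗-cong ≋-refl (L.reflexive
         (≡.trans (≡.cong (δ (block 0 0 n)) (block-zero m n)) (δ-refl (block 0 0 n)))) ⟩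
  ∏ (λ i → passing m (lookup xs i) ys) ⊗ 𝟙
    ≈⟨ L.*-identityʳ _ ⟩
  ∏ (λ i → passing m (lookup xs i) ys) ∎
  where open L

-- Localization at the first k variables

data At {A : Set} : ∀ {n} → ℕ → Vec A n → A → Set where
  here  : ∀ {n x} {ys : Vec A n} → At 0 (x ∷ ys) x
  there : ∀ {n j x y} {ys : Vec A n} → At j ys x → At (suc j) (y ∷ ys) x

line-false-δ : (x : A) (ys : Vec A n) (S : Vec Bool n) →
               line x false ys S (δ (block 0 0 n)) ≋ δ (block 0 0 n) S
line-false-δ x []       []          = ≋-refl
line-false-δ x (y ∷ ys) (false ∷ S) = ≋-trans
  (⊕-cong (⊗-cong ≋-refl (line-false-δ x ys S)) (⊗𝟘⊕ (zeroes (linear-line x true ys S))))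
  (1⊗⊕𝟘 _)
line-false-δ x (y ∷ ys) (true ∷ S)  = ≋-refl

-- The letters true of the old frame keep the line on up to position j. There the old letter is
-- false, so the line either goes on with weight 1 - x / x = 0 or turns off and leaves a letter true
-- in the new frame.
line-δ : ∀ {j x} {ys : Vec A n} → At j ys x → ∀ S →
         line x true ys S (δ (block 0 j n)) ≋ δ (block 0 (suc j) n) S
line-δ {x = x} {_ ∷ ys} here (false ∷ S) = ≋-trans
  (⊕-cong (≋-trans (⊗-cong (≋-trans (⊕-cong ≋-refl (⊖-cong (var-inv x))) (L.-‿inverseʳ 𝟙)) ≋-refl)
                   (L.zeroˡ _)) ≋-refl)
  (⊕-identityˡ _)
line-δ {x = x} {_ ∷ ys} here (true ∷ S) = ≋-trans
  (⊕-cong (≋-trans (⊗-identityˡ _) (line-false-δ x ys S))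
          (⊗𝟘⊕ (zeroes (linear-line x true ys S))))
  (L.+-identityʳ _)
line-δ {x = x} {_ ∷ ys} (there at) (false ∷ S) = ⊗𝟘⊕ (zeroes (linear-line x true ys S))
line-δ {x = x} {_ ∷ ys} (there at) (true ∷ S)  =
  ≋-trans (⊗𝟘⊕ (zeroes (linear-line x false ys S))) (≋-trans (1⊗⊕𝟘 _) (line-δ at S))

Run : ℕ → Vec A n → Vec A k → Set
Run j ys []       = ⊤
Run j ys (x ∷ xs) = At j ys x × Run (suc j) ys xs

iterate-cong : (ys : Vec A n) (xs : Vec A k) {f g : Vec Bool n → Laurent A} →
               (∀ S → f S ≋ g S) → ∀ S → iterate ys xs f S ≋ iterate ys xs g S
iterate-cong ys []       f≋g = f≋g
iterate-cong ys (x ∷ xs) f≋g = iterate-cong ys xs λ S → cong (linear-line x true ys S) f≋g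

iterate-δ : (j : ℕ) (ys : Vec A n) (xs : Vec A k) → Run j ys xs → ∀ S →
            iterate ys xs (δ (block 0 j n)) S ≋ δ (block 0 (k + j) n) S
iterate-δ j ys []       run        S = ≋-refl
iterate-δ {n = n} {k = suc k} j ys (x ∷ xs) (at , run) S = ≋-trans
  (iterate-cong ys xs (line-δ at) S)
  (≋-trans (iterate-δ (suc j) ys xs run S) (L.reflexive (≡.cong (λ l → δ (block 0 l n) S) (ℕ.+-suc k j))))

data Selects {A : Set} : ∀ {n k} → Vec Bool n → Vec A n → Vec A k → Set where
  []   : Selects [] [] []
  take : ∀ {n k S y} {ys : Vec A n} {xs : Vec A k} → Selects S ys xs → Selects (true ∷ S) (y ∷ ys) (y ∷ xs)
  skip : ∀ {n k S y} {ys : Vec A n} {xs : Vec A k} → Selects S ys xs → Selects (false ∷ S) (y ∷ ys) xs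

Selects-∣∣ : ∀ {S} {ys : Vec A n} {xs : Vec A k} → Selects S ys xs → ∣ S ∣ ≡ k
Selects-∣∣ []       = refl
Selects-∣∣ (take s) = ≡.cong suc (Selects-∣∣ s)
Selects-∣∣ (skip s) = Selects-∣∣ s

Run-suc : ∀ {j y} {ys : Vec A n} (xs : Vec A k) → Run j ys xs → Run (suc j) (y ∷ ys) xs
Run-suc []       run        = tt
Run-suc (x ∷ xs) (at , run) = there at , Run-suc xs run

Selects-Run : (j : ℕ) {ys : Vec A n} {xs : Vec A k} → Selects (block 0 j n) ys xs → Run 0 ys xs
Selects-Run {n = zero} j [] = tt
Selects-Run {n = suc n} (suc j) (take {xs = xs} s) = here , Run-suc xs (Selects-Run j s)
Selects-Run {n = suc n} zero {xs = xs} (skip s) = Run-none xs (Selects-none s)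
  where
  Selects-none : ∀ {n k} {ys : Vec A n} {xs : Vec A k} → Selects (block 0 0 n) ys xs → k ≡ 0
  Selects-none {n = zero} []       = refl
  Selects-none {n = suc n} (skip s) = Selects-none s
  Run-none : ∀ {n k j} {ys : Vec A n} (xs : Vec A k) → k ≡ 0 → Run j ys xs
  Run-none [] refl = tt

Γ-initial : {ys : Vec A n} {xs : Vec A k} → Selects (block 0 k n) ys xs → ∀ S →
            Γ xs ys S ≋ δ (block 0 k n) S
Γ-initial {n = n} {k = k} {ys} {xs} s S = ≋-trans (iterate-δ 0 ys xs (Selects-Run k s) S)
  (L.reflexive (≡.cong (λ l → δ (block 0 l n) S) (ℕ.+-identityʳ k)))

rename-⟪⟫ : (ρ : A → B) (T : Table X) {s t : Laurent A} {f : X → Laurent A} {g : X → Laurent B} →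
            (∀ x → rename ρ (f x) ≋ g x) →
            rename ρ (⟪ T ⟫ s t f) ≋ ⟪ T ⟫ (rename ρ s) (rename ρ t) g
rename-⟪⟫ ρ []                f≋g = ≋-refl
rename-⟪⟫ ρ ((one , x) ∷ T)    f≋g = ⊕-cong (⊗-cong ≋-refl (f≋g x)) (rename-⟪⟫ ρ T f≋g)
rename-⟪⟫ ρ ((par , x) ∷ T)    f≋g = ⊕-cong (⊗-cong ≋-refl (f≋g x)) (rename-⟪⟫ ρ T f≋g)
rename-⟪⟫ ρ ((copar , x) ∷ T)  f≋g = ⊕-cong (⊗-cong ≋-refl (f≋g x)) (rename-⟪⟫ ρ T f≋g)
rename-⟪⟫ ρ ((negpar , x) ∷ T) f≋g = ⊕-cong (⊗-cong ≋-refl (f≋g x)) (rename-⟪⟫ ρ T f≋g)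

rename-line : (ρ : A → B) (x : A) (h : Bool) (ys : Vec A n) (S : Vec Bool n)
              {f : Vec Bool n → Laurent A} {g : Vec Bool n → Laurent B} →
              (∀ S → rename ρ (f S) ≋ g S) →
              rename ρ (line x h ys S f) ≋ line (ρ x) h (Vec.map ρ ys) S g
rename-line ρ x false []       []      f≋g = f≋g []
rename-line ρ x true  []       []      f≋g = ≋-refl
rename-line ρ x h     (y ∷ ys) (l ∷ S) f≋g = rename-⟪⟫ ρ (vertex h l) λ (h′ , m) →
  rename-line ρ x h′ ys S λ S → f≋g (m ∷ S)

rename-δ : (ρ : A → B) (S T : Vec Bool n) → rename ρ (δ S T) ≡ δ S T
rename-δ ρ []          []          = refl
rename-δ ρ (true ∷ S)  (true ∷ T)  = rename-δ ρ S T
rename-δ ρ (false ∷ S) (false ∷ T) = rename-δ ρ S T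
rename-δ ρ (true ∷ S)  (false ∷ T) = refl
rename-δ ρ (false ∷ S) (true ∷ T)  = refl

rename-iterate : (ρ : A → B) (ys : Vec A n) (xs : Vec A k)
                 {f : Vec Bool n → Laurent A} {g : Vec Bool n → Laurent B} →
                 (∀ S → rename ρ (f S) ≋ g S) → ∀ S →
                 rename ρ (iterate ys xs f S) ≋ iterate (Vec.map ρ ys) (Vec.map ρ xs) g S
rename-iterate ρ ys []       f≋g = f≋g
rename-iterate ρ ys (x ∷ xs) f≋g = rename-iterate ρ ys xs λ S → rename-line ρ x true ys S f≋g

rename-Γ : (ρ : A → B) (xs : Vec A k) (ys : Vec A n) (S : Vec Bool n) →
           rename ρ (Γ xs ys S) ≋ Γ (Vec.map ρ xs) (Vec.map ρ ys) S
rename-Γ ρ xs ys = rename-iterate ρ ys xs λ S → L.reflexive (rename-δ ρ (block 0 0 _) S)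

-- For such a frame `swap i` moves one element up by one, which adds a box to the diagram.
data Descent : ∀ {n} → Fin n → Vec Bool (suc n) → Set where
  here  : ∀ {n} {S : Vec Bool n} → Descent zero (true ∷ false ∷ S)
  there : ∀ {n i b} {S : Vec Bool (suc n)} → Descent i S → Descent (suc i) (b ∷ S)

exchange-descent : (u : Laurent A) {i : Fin n} {S : Vec Bool (suc n)} → Descent i S → ∀ f →
                   exchange Rᴴ u i (swap i S) f ≋ u ⊗ f (swap i S) ⊕ (𝟙 ⊝ u) ⊗ f S
exchange-descent u here      f = ⊕-cong ≋-refl (L.+-identityʳ _)
exchange-descent u (there d) f = exchange-descent u d _

exchange-view : (i : Fin n) (S : Vec Bool (suc n)) →
                (∀ {A} (u : Laurent A) f → exchange Rᴴ u i S f ≋ f S) ⊎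
                Σ (Vec Bool (suc n)) λ T → Descent i T × S ≡ swap i T
exchange-view zero (false ∷ false ∷ S) = inj₁ λ u f → 1⊗⊕𝟘 _
exchange-view zero (false ∷ true ∷ S)  = inj₂ (_ , here , refl)
exchange-view zero (true ∷ false ∷ S)  = inj₁ λ u f → 1⊗⊕𝟘 _
exchange-view zero (true ∷ true ∷ S)   = inj₁ λ u f → 1⊗⊕𝟘 _
exchange-view (suc i) (b ∷ S) with exchange-view i S
... | inj₁ fixed           = inj₁ λ u f → fixed u _
... | inj₂ (T , d , refl) = inj₂ (b ∷ T , there d , refl)

-- From tilings to crossing lines

∑-if : (b : Bool) (xs : List X) (f : X → Laurent A) →
       ∑ (if b then xs else []) f ≋ (if b then 𝟙 else 𝟘) ⊗ ∑ xs f
∑-if true  xs f = ≋-sym (⊗-identityˡ _)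
∑-if false xs f = ≋-sym (L.zeroˡ _)

weigh : (a b : State) → Tile up → Laurent A
weigh a b u = [ aEdge u ≟ a ] ⊗ [ bEdge u ≟ b ]

∑-weigh : (ups : List (Tile up)) (a b : State) (T : Tile up → Table X) (s t : Laurent A)
          (f : X → Laurent A) →
          ⟪ tilesBy ups a b T ⟫ s t f ≋ ⟨ ups ∣ weigh a b ⟩ (λ u → ⟪ T u ⟫ s t f)
∑-weigh ups a b T s t f = ≋-trans
  (∑-concatMap (λ u → if does (aEdge u ≟ a) then if does (bEdge u ≟ b) then T u else [] else []) ups _)
  (∑-cong ups λ u → ≋-trans (∑-if (does (aEdge u ≟ a)) _ _)
    (≋-trans (⊗-cong ≋-refl (∑-if (does (bEdge u ≟ b)) (T u) _)) (≋-sym (⊗-assoc _ _ _))))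

coef-lozenge : (w : Laurent A) (u : Tile up) (d : Tile down) →
               coef w 𝟙 (lozenge u d) ≡ lozengeWeight w u d
coef-lozenge w E  d  = refl
coef-lozenge w G₁ d  = refl
coef-lozenge w G₂ E  = refl
coef-lozenge w G₂ G₁ = refl
coef-lozenge w G₂ G₂ = refl
coef-lozenge w G₂ R₁ = refl
coef-lozenge w G₂ R₂ = refl
coef-lozenge w G₂ Q  = refl
coef-lozenge w R₁ d  = refl
coef-lozenge w R₂ E  = refl
coef-lozenge w R₂ G₁ = refl
coef-lozenge w R₂ G₂ = refl
coef-lozenge w R₂ R₁ = refl
coef-lozenge w R₂ R₂ = refl
coef-lozenge w R₂ Q  = refl
coef-lozenge w Q  E  = refl
coef-lozenge w Q  G₁ = refl
coef-lozenge w Q  G₂ = refl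
coef-lozenge w Q  R₁ = refl
coef-lozenge w Q  R₂ = refl
coef-lozenge w Q  Q  = refl
coef-lozenge w K  E  = refl
coef-lozenge w K  G₁ = refl
coef-lozenge w K  G₂ = refl
coef-lozenge w K  R₁ = refl
coef-lozenge w K  R₂ = refl
coef-lozenge w K  Q  = refl

below : (w : Laurent A) → Tile up → Tile down → Laurent A
below w u d = [ hEdge d ≟ hEdge u ] ⊗ lozengeWeight w u d

∑-lower : (downs : List (Tile down)) (w : Laurent A) (u : Tile up) (f : State × State → Laurent A) →
          ⟪ lower downs u ⟫ w 𝟙 f ≋ ⟨ downs ∣ below w u ⟩ λ d → f (aEdge d , bEdge d)
∑-lower downs w u f = ≋-trans
  (∑-concatMap (λ d → if does (hEdge d ≟ hEdge u) then (lozenge u d , aEdge d , bEdge d) ∷ [] else [])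
               downs _)
  (∑-cong downs λ d → ≋-trans (∑-if (does (hEdge d ≟ hEdge u)) _ _)
    (≋-trans (⊗-cong ≋-refl (≋-trans (L.+-identityʳ _)
      (⊗-cong (L.reflexive (coef-lozenge w u d)) ≋-refl))) (≋-sym (⊗-assoc _ _ _))))

-- Abstract, as unification would otherwise unfold all sums over these lists.
abstract
  ups : List (Tile up)
  ups = tiles up

  downs : List (Tile down)
  downs = tiles down

  ups≡ : ups ≡ tiles up
  ups≡ = refl

  downs≡ : downs ≡ tiles down
  downs≡ = refl

  cross-ups : (a b : State) (w : Laurent A) (f : State × State → Laurent A) →
              ⟪ cross a b ⟫ w 𝟙 f
              ≋ ⟨ ups ∣ weigh a b ⟩ λ u → ⟨ downs ∣ below w u ⟩ λ d → f (aEdge d , bEdge d)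
  cross-ups a b w f = ≋-trans (∑-weigh ups a b (lower downs) w 𝟙 f)
    (cong (linear-⟨⟩ ups (weigh a b)) λ u → ∑-lower downs w u f)

  merge-ups : (a b : State) (f : Bool → Laurent A) →
              ⟪ merge a b ⟫ 𝟙 𝟙 f ≋ ⟨ ups ∣ weigh a b ⟩ (λ u → ⟪ letter (hEdge u) ⟫ 𝟙 𝟙 f)
  merge-ups a b = ∑-weigh ups a b (letter ∘ hEdge) 𝟙 𝟙

-- The row of tiles below us, with left and right boundary edges a and b.
tileRow : Vec A n → Vec A n → State → State → Vec (Tile up) n →
          (Vec (Tile up) (suc n) → Laurent A) → Laurent A
tileRow []       []       a b []        k = ⟨ ups ∣ weigh a b ⟩ λ u → k (u ∷ [])
tileRow (p ∷ ps) (q ∷ qs) a b (u₀ ∷ us) k =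
  ⟨ ups ∣ (λ u → [ aEdge u ≟ a ]) ⟩ λ u →
  ⟨ downs ∣ (λ d → [ bEdge d ≟ bEdge u ] ⊗ below (p / q) u₀ d) ⟩ λ d →
  tileRow ps qs (aEdge d) b us (k ∘ (u ∷_))

-- `Z` before the bottom tiles are reduced to letters: a further row can be attached only while the
-- tiles are kept, since they become the upper halves of its lozenges.
Zᵗ : Vec A n → Vec A n → Vec State n → Vec State n → (Vec (Tile up) n → Laurent A) → Laurent A
Zᵗ []       []       []       []       k = k []
Zᵗ (p ∷ ps) (q ∷ qs) (a ∷ as) (b ∷ bs) k =
  row q ps as b λ (as′ , b′) → ⟨ ups ∣ weigh a b′ ⟩ λ u → Zᵗ ps qs as′ bs (k ∘ (u ∷_))

linear-Zᵗ : (ps qs : Vec A n) (as bs : Vec State n) → Linear (Zᵗ ps qs as bs)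
linear-Zᵗ []       []       []       []       = linear-at _
linear-Zᵗ (p ∷ ps) (q ∷ qs) (a ∷ as) (b ∷ bs) = linear-bind (linear-row q ps as b) λ (as′ , b′) →
  linear-bind (linear-⟨⟩ ups (weigh a b′)) λ u →
  linear-bind (linear-Zᵗ ps qs as′ bs) λ us → linear-at (u ∷ us)

[]-sym : (s t : State) → [_] {A = A} (s ≟ t) ≡ [ t ≟ s ]
[]-sym s t = []-⇔ (s ≟ t) (t ≟ s) ≡.sym ≡.sym

-- Adding a row at the bottom of a triangle amounts to adding a line from
-- the left side and one from the right side, at the far ends.
Zᵗ-tileRow : (p q : A) (ps qs : Vec A n) (a b : State) (as bs : Vec State n)
             (k : Vec (Tile up) (suc n) → Laurent A) →
             Zᵗ ps qs as bs (λ us → tileRow ps qs a b us k)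
             ≋ Zᵗ (p ∷ ps) (qs ∷ʳ q) (a ∷ as) (bs ∷ʳ b) k
Zᵗ-tileRow p q [] [] a b [] [] k = ≋-refl
Zᵗ-tileRow p q (p₁ ∷ ps) (q₁ ∷ qs) a b (a₁ ∷ as) (b₁ ∷ bs) k =
  cong (linear-row q₁ ps as b₁) λ (as′ , b′) → begin
    (⟨ ups ∣ weigh a₁ b′ ⟩ λ u₀ → Zᵗ ps qs as′ bs λ us →
      ⟨ ups ∣ (λ u → [ aEdge u ≟ a ]) ⟩ λ u → ⟨ downs ∣ side u₀ u ⟩ λ d →
      tileRow ps qs (aEdge d) b us (k ∘ (u ∷_)))
      ≈⟨ (cong (linear-⟨⟩ ups (weigh a₁ b′)) λ u₀ → ≋-trans
          (linear-⟨⟩-comm (linear-Zᵗ ps qs as′ bs) ups _ _)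
          (cong (linear-⟨⟩ ups _) λ u → ≋-trans
            (linear-⟨⟩-comm (linear-Zᵗ ps qs as′ bs) downs _ _)
            (cong (linear-⟨⟩ downs (side u₀ u)) λ d →
              Zᵗ-tileRow p₁ q ps qs (aEdge d) b as′ bs (k ∘ (u ∷_))))) ⟩
    (⟨ ups ∣ weigh a₁ b′ ⟩ λ u₀ →
      ⟨ ups ∣ (λ u → [ aEdge u ≟ a ]) ⟩ λ u → ⟨ downs ∣ side u₀ u ⟩ λ d →
      Zᵗ (p₁ ∷ ps) (qs ∷ʳ q) (aEdge d ∷ as′) (bs ∷ʳ b) (k ∘ (u ∷_)))
      -- The sum over the new tile `u` moves inside: `u₀` and `d` then form a lozenge, and `u` is
      -- the bottom tile to which its outgoing right line leads.
      ≈⟨ (cong (linear-⟨⟩ ups (weigh a₁ b′)) λ u₀ → ≋-trans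
          (≋-trans
            (cong (linear-⟨⟩ ups _) λ u → ∑-cong downs λ d →
              ≋-trans (⊗-cong (⊗-comm _ _) ≋-refl) (⊗-assoc _ _ _))
            (linear-⟨⟩-comm (linear-⟨⟩ ups _) downs (below (p₁ / q₁) u₀) _))
          (cong (linear-⟨⟩ downs (below (p₁ / q₁) u₀)) λ d → ∑-cong ups λ u →
            ≋-trans (≋-sym (⊗-assoc _ _ _))
              (⊗-cong (⊗-cong ≋-refl (L.reflexive ([]-sym (bEdge d) (bEdge u)))) ≋-refl))) ⟩
    (⟨ ups ∣ weigh a₁ b′ ⟩ λ u₀ → ⟨ downs ∣ below (p₁ / q₁) u₀ ⟩ λ d →
      ⟨ ups ∣ weigh a (bEdge d) ⟩ λ u →
      Zᵗ (p₁ ∷ ps) (qs ∷ʳ q) (aEdge d ∷ as′) (bs ∷ʳ b) (k ∘ (u ∷_)))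
      ≈⟨ cross-ups a₁ b′ (p₁ / q₁) _ ⟨
    (⟪ cross a₁ b′ ⟫ (p₁ / q₁) 𝟙 λ (a₁′ , b″) → ⟨ ups ∣ weigh a b″ ⟩ λ u →
      Zᵗ (p₁ ∷ ps) (qs ∷ʳ q) (a₁′ ∷ as′) (bs ∷ʳ b) (k ∘ (u ∷_))) ∎
  where
  open L
  side : Tile up → Tile up → Tile down → Laurent _
  side u₀ u d = [ bEdge d ≟ bEdge u ] ⊗ below (p₁ / q₁) u₀ d

-- At `us₀ = bottomTiles t` this is definitionally the second component of `matching?`, but it
-- allows recursion along the row.
matches? : (us₀ : Vec (Tile up) n) (us : Vec (Tile up) (suc n)) (ds : Vec (Tile down) n) →
           Dec (∀ i → hEdge (lookup ds i) ≡ lookup (Vec.map hEdge us₀) i ×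
                      bEdge (lookup ds i) ≡ bEdge (lookup us (inject₁ i)) ×
                      aEdge (lookup ds i) ≡ aEdge (lookup us (suc i)))
matches? us₀ us ds = Fin.all? λ i →
  (hEdge (lookup ds i) ≟ lookup (Vec.map hEdge us₀) i) ×-dec
  (bEdge (lookup ds i) ≟ bEdge (lookup us (inject₁ i))) ×-dec
  (aEdge (lookup ds i) ≟ aEdge (lookup us (suc i)))

matches-∷ : (u₀ : Tile up) (us₀ : Vec (Tile up) n) (u : Tile up) (us : Vec (Tile up) (suc n))
            (d : Tile down) (ds : Vec (Tile down) n) →
            [_] {A = A} (matches? (u₀ ∷ us₀) (u ∷ us) (d ∷ ds))
            ≋ [ hEdge d ≟ hEdge u₀ ] ⊗ ([ bEdge d ≟ bEdge u ] ⊗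
              ([ aEdge (Vec.head us) ≟ aEdge d ] ⊗ [ matches? us₀ us ds ]))
matches-∷ u₀ us₀ u us@(u₁ ∷ _) d ds = ≋-trans
  (L.reflexive ([]-⇔ (matches? (u₀ ∷ us₀) (u ∷ us) (d ∷ ds)) (h? ×-dec b? ×-dec a? ×-dec m?)
    (λ m → let (h , b , a) = m zero in h , b , ≡.sym a , m ∘ suc)
    (λ { (h , b , a , m) zero → h , b , ≡.sym a ; (h , b , a , m) (suc i) → m i })))
  (≋-trans ([]-× h? (b? ×-dec a? ×-dec m?)) (⊗-cong ≋-refl
    (≋-trans ([]-× b? (a? ×-dec m?)) (⊗-cong ≋-refl ([]-× a? m?)))))
  where
  h? = hEdge d ≟ hEdge u₀
  b? = bEdge d ≟ bEdge u
  a? = aEdge u₁ ≟ aEdge d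
  m? = matches? us₀ us ds

rowWeight : (r l : Fin n → A) → State → State → Vec (Tile up) n → Vec (Tile up) (suc n) →
            Vec (Tile down) n → Laurent A
rowWeight r l a b us₀ us ds =
  [ matches? us₀ us ds ] ⊗ ([ aEdge (Vec.head us) ≟ a ] ⊗ ([ bEdge (Vec.last us) ≟ b ] ⊗
  ∏ (λ e → lozengeWeight (r e / l e) (lookup us₀ e) (lookup ds e))))

tileRow-∑ : (r l : Fin n → A) (a b : State) (us₀ : Vec (Tile up) n) (k : Vec (Tile up) (suc n) → Laurent A) →
            (∑ (vectors ups (suc n)) λ us → ∑ (vectors downs n) λ ds →
              rowWeight r l a b us₀ us ds ⊗ k us)
            ≋ tileRow (tabulate r) (tabulate l) a b us₀ k
tileRow-∑ {n = zero} r l a b [] k = ≋-trans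
  (∑-cartesianProductWith _∷_ ups ([] ∷ []) _)
  (∑-cong ups λ u → ≋-trans (L.+-identityʳ _) (≋-trans (L.+-identityʳ _)
    (⊗-cong (≋-trans (⊗-identityˡ _) (⊗-cong ≋-refl (L.*-identityʳ _))) ≋-refl)))
tileRow-∑ {n = suc n} r l a b (u₀ ∷ us₀) k = begin
  (∑ (vectors ups (suc (suc n))) λ us → ∑ (vectors downs (suc n)) λ ds →
    rowWeight r l a b (u₀ ∷ us₀) us ds ⊗ k us)
    ≈⟨ ∑-cartesianProductWith _∷_ ups (vectors ups (suc n)) _ ⟩
  (∑ ups λ u → ∑ (vectors ups (suc n)) λ us → ∑ (vectors downs (suc n)) λ ds →
    rowWeight r l a b (u₀ ∷ us₀) (u ∷ us) ds ⊗ k (u ∷ us))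
    ≈⟨ (∑-cong ups λ u → ∑-cong (vectors ups (suc n)) λ us →
         ∑-cartesianProductWith _∷_ downs (vectors downs n) _) ⟩
  (∑ ups λ u → ∑ (vectors ups (suc n)) λ us →
    ∑ downs λ d → ∑ (vectors downs n) λ ds →
    rowWeight r l a b (u₀ ∷ us₀) (u ∷ us) (d ∷ ds) ⊗ k (u ∷ us))
    ≈⟨ (∑-cong ups λ u → ∑-comm (vectors ups (suc n)) downs _) ⟩
  (∑ ups λ u → ∑ downs λ d → ∑ (vectors ups (suc n)) λ us →
    ∑ (vectors downs n) λ ds →
    rowWeight r l a b (u₀ ∷ us₀) (u ∷ us) (d ∷ ds) ⊗ k (u ∷ us))
    ≈⟨ (∑-cong ups λ u → ∑-cong downs λ d → ≋-trans
         (∑-cong (vectors ups (suc n)) λ us → ≋-trans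
           (∑-cong (vectors downs n) λ ds → split u us d ds)
           (∑-⊗ˡ (vectors downs n) _ _))
         (∑-⊗ˡ (vectors ups (suc n)) _ _)) ⟩
  (∑ ups λ u → ∑ downs λ d →
    ([ aEdge u ≟ a ] ⊗ side u d) ⊗
      (∑ (vectors ups (suc n)) λ us → ∑ (vectors downs n) λ ds →
        rowWeight (r ∘ suc) (l ∘ suc) (aEdge d) b us₀ us ds ⊗ k (u ∷ us)))
    ≈⟨ (∑-cong ups λ u → ≋-trans
         (∑-cong downs λ d → ≋-trans
           (⊗-cong ≋-refl (tileRow-∑ (r ∘ suc) (l ∘ suc) (aEdge d) b us₀ (k ∘ (u ∷_))))
           (⊗-assoc _ _ _))
         (∑-⊗ˡ downs _ _)) ⟩
  tileRow (tabulate r) (tabulate l) a b (u₀ ∷ us₀) k ∎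
  where
  open L
  w = r zero / l zero
  side : Tile up → Tile down → Laurent _
  side u d = [ bEdge d ≟ bEdge u ] ⊗ below w u₀ d
  split : ∀ u us d ds →
          rowWeight r l a b (u₀ ∷ us₀) (u ∷ us) (d ∷ ds) ⊗ k (u ∷ us)
          ≋ ([ aEdge u ≟ a ] ⊗ side u d) ⊗ (rowWeight (r ∘ suc) (l ∘ suc) (aEdge d) b us₀ us ds ⊗ k (u ∷ us))
  split u us d ds = ≋-trans (⊗-cong (≋-trans (⊗-cong (matches-∷ u₀ us₀ u us d ds) ≋-refl)
    (shuffle [ hEdge d ≟ hEdge u₀ ] [ bEdge d ≟ bEdge u ] [ aEdge (Vec.head us) ≟ aEdge d ]
      [ matches? us₀ us ds ] [ aEdge u ≟ a ] [ bEdge (Vec.last us) ≟ b ]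
      (lozengeWeight w u₀ d)
      (∏ (λ e → lozengeWeight (r (suc e) / l (suc e)) (lookup us₀ e) (lookup ds e))))) ≋-refl)
    (⊗-assoc _ _ _)
    where
    open MonoidSolver
    shuffle : ∀ h b a m a′ b′ w π →
              (h ⊗ (b ⊗ (a ⊗ m))) ⊗ (a′ ⊗ (b′ ⊗ (w ⊗ π)))
              ≋ (a′ ⊗ (b ⊗ (h ⊗ w))) ⊗ (m ⊗ (a ⊗ (b′ ⊗ π)))
    shuffle = solve 8 (λ h b a m a′ b′ w π →
      (h :* (b :* (a :* m))) :* (a′ :* (b′ :* (w :* π)))
      := (a′ :* (b :* (h :* w))) :* (m :* (a :* (b′ :* π)))) ≋-refl

∑-▷ : (us : List (Vec (Tile up) (suc n))) (ds : List (Vec (Tile down) n)) (ts : List (Tiling n))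
      (f : Tiling (suc n) → Laurent A) →
      ∑ (cartesianProductWith _▷_ ts (cartesianProduct us ds)) f
      ≋ ∑ ts λ t → ∑ us λ u → ∑ ds λ d → f (t ▷ (u , d))
∑-▷ us ds ts f = ≋-trans (∑-cartesianProductWith _▷_ ts (cartesianProduct us ds) f)
  (∑-cong ts λ t → ∑-cartesianProductWith _,_ us ds _)

∑-tilings : (f : Tiling (suc n) → Laurent A) →
            ∑ (tilings (suc n)) f
            ≋ ∑ (tilings n) λ t → ∑ (vectors ups (suc n)) λ us → ∑ (vectors downs n) λ ds → f (t ▷ (us , ds))
∑-tilings {n} rewrite ups≡ | downs≡ = ∑-▷ (vectors (tiles up) (suc n)) (vectors (tiles down) n) (tilings n)

_≟ᵛ_ : DecidableEquality (Vec State n)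
_≟ᵛ_ = Vec.≡-dec _≟_

tabulate-∷ʳ : (f : Fin (suc n) → A) → tabulate (f ∘ inject₁) ∷ʳ f (fromℕ n) ≡ tabulate f
tabulate-∷ʳ {n = zero}  f = refl
tabulate-∷ʳ {n = suc n} f = ≡.cong (f zero ∷_) (tabulate-∷ʳ (f ∘ suc))

module _ {N : ℕ} where
  -- The bottom side is left free; in the sums it is paired with a function.
  sided : (l r : Fin n → Fin N) (as bs : Vec State n) → Tiling n → Laurent (Fin N)
  sided l r as bs t =
    [ matching? t ] ⊗ ([ leftSide t ≟ᵛ as ] ⊗ ([ rightSide t ≟ᵛ bs ] ⊗ weightIn l r t))

  sided-▷ : (l r : Fin (suc n) → Fin N) (a b : State) (as bs : Vec State n) (t : Tiling n)
            (us : Vec (Tile up) (suc n)) (ds : Vec (Tile down) n) →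
            sided l r (a ∷ as) (bs ∷ʳ b) (t ▷ (us , ds))
            ≋ sided (l ∘ inject₁) (r ∘ suc) as bs t
              ⊗ rowWeight (r ∘ suc) (l ∘ inject₁) a b (bottomTiles t) us ds
  sided-▷ l r a b as bs t us ds = ≋-trans
    (⊗-cong ([]-× (matching? t) (matches? (bottomTiles t) us ds)) (⊗-cong
      ([]-× (aEdge (Vec.head us) ≟ a) (leftSide t ≟ᵛ as))
      (⊗-cong (≋-trans
        (L.reflexive ([]-⇔ ((rightSide t ∷ʳ bEdge (Vec.last us)) ≟ᵛ (bs ∷ʳ b))
                           ((rightSide t ≟ᵛ bs) ×-dec (bEdge (Vec.last us) ≟ b))
          (Vec.∷ʳ-injective (rightSide t) bs) (λ (p , q) → ≡.cong₂ _∷ʳ_ p q)))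
        ([]-× (rightSide t ≟ᵛ bs) (bEdge (Vec.last us) ≟ b))) ≋-refl)))
    (shuffle [ matching? t ] [ matches? (bottomTiles t) us ds ] [ aEdge (Vec.head us) ≟ a ]
      [ leftSide t ≟ᵛ as ] [ rightSide t ≟ᵛ bs ] [ bEdge (Vec.last us) ≟ b ]
      (weightIn (l ∘ inject₁) (r ∘ suc) t) _)
    where
    open MonoidSolver
    shuffle : ∀ m m′ a l r b w π →
              (m ⊗ m′) ⊗ ((a ⊗ l) ⊗ ((r ⊗ b) ⊗ (w ⊗ π))) ≋ (m ⊗ (l ⊗ (r ⊗ w))) ⊗ (m′ ⊗ (a ⊗ (b ⊗ π)))
    shuffle = solve 8 (λ m m′ a l r b w π →
      (m :* m′) :* ((a :* l) :* ((r :* b) :* (w :* π)))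
      := (m :* (l :* (r :* w))) :* (m′ :* (a :* (b :* π)))) ≋-refl

  -- Tilings grow by rows and `Zᵗ` by lines; `Zᵗ-tileRow` reconciles the two. A new row extends the
  -- left side at its start and the right side at its end, hence `initLast`.
  ∑-tilings-Zᵗ : (l r : Fin n → Fin N) (as bs : Vec State n) (f : Vec (Tile up) n → Laurent (Fin N)) →
                 ⟨ tilings n ∣ sided l r as bs ⟩ (f ∘ bottomTiles)
                 ≋ Zᵗ (tabulate r) (tabulate l) as bs f
  ∑-tilings-Zᵗ {n = zero} l r [] [] f = ≋-trans (L.+-identityʳ _)
    (≋-trans (⊗-cong (≋-trans (⊗-identityˡ _) (≋-trans (⊗-identityˡ _) (⊗-identityˡ _))) ≋-refl)
             (⊗-identityˡ _))
  ∑-tilings-Zᵗ {n = suc n} l r (a ∷ as) bs′ f with initLast bs′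
  ... | bs , b , refl = begin
    ⟨ tilings (suc n) ∣ sided l r (a ∷ as) (bs ∷ʳ b) ⟩ (f ∘ bottomTiles)
      ≈⟨ ∑-tilings (λ t → sided l r (a ∷ as) (bs ∷ʳ b) t ⊗ f (bottomTiles t)) ⟩
    (∑ (tilings n) λ t → ∑ (vectors ups (suc n)) λ us → ∑ (vectors downs n) λ ds →
      sided l r (a ∷ as) (bs ∷ʳ b) (t ▷ (us , ds)) ⊗ f us)
      ≈⟨ (∑-cong (tilings n) λ t → ≋-trans
          (∑-cong (vectors ups (suc n)) λ us → ≋-trans
            (∑-cong (vectors downs n) λ ds → ≋-trans
              (⊗-cong (sided-▷ l r a b as bs t us ds) ≋-refl) (⊗-assoc _ _ _))
            (∑-⊗ˡ (vectors downs n) _ _))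
          (≋-trans (∑-⊗ˡ (vectors ups (suc n)) _ _)
                   (⊗-cong ≋-refl (tileRow-∑ r′ l′ a b (bottomTiles t) f)))) ⟩
    ⟨ tilings n ∣ sided l′ r′ as bs ⟩
      (λ t → tileRow (tabulate r′) (tabulate l′) a b (bottomTiles t) f)
      ≈⟨ ∑-tilings-Zᵗ l′ r′ as bs _ ⟩
    Zᵗ (tabulate r′) (tabulate l′) as bs (λ us → tileRow (tabulate r′) (tabulate l′) a b us f)
      ≈⟨ Zᵗ-tileRow (r zero) (l (fromℕ n)) (tabulate r′) (tabulate l′) a b as bs f ⟩
    Zᵗ (tabulate r) (tabulate l′ ∷ʳ l (fromℕ n)) (a ∷ as) (bs ∷ʳ b) f
      ≡⟨ ≡.cong (λ qs → Zᵗ (tabulate r) qs (a ∷ as) (bs ∷ʳ b) f) (tabulate-∷ʳ l) ⟩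
    Zᵗ (tabulate r) (tabulate l) (a ∷ as) (bs ∷ʳ b) f ∎
    where
    open L
    l′ = l ∘ inject₁
    r′ = r ∘ suc

decode : Vec State n → (Vec Bool n → Laurent A) → Laurent A
decode []       f = f []
decode (h ∷ hs) f = ⟪ letter h ⟫ 𝟙 𝟙 λ b → decode hs (f ∘ (b ∷_))

Zᵗ-decode : (ps qs : Vec A n) (as bs : Vec State n) (f : Vec Bool n → Laurent A) →
            Zᵗ ps qs as bs (λ us → decode (Vec.map hEdge us) f) ≋ Z ps qs as bs f
Zᵗ-decode []       []       []       []       f = ≋-refl
Zᵗ-decode (p ∷ ps) (q ∷ qs) (a ∷ as) (b ∷ bs) f = cong (linear-row q ps as b) λ (as′ , b′) → ≋-trans
  (cong (linear-⟨⟩ ups (weigh a b′)) λ u → ≋-trans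
    (linear-⟪⟫-comm (linear-Zᵗ ps qs as′ bs) (letter (hEdge u)) _ _ _)
    (cong (linear-⟪⟫ (letter (hEdge u)) _ _) λ h → Zᵗ-decode ps qs as′ bs (f ∘ (h ∷_))))
  (≋-sym (merge-ups a b′ _))

subsets : ∀ n → List (Vec Bool n)
subsets = vectors (outside ∷ inside ∷ [])

∑-decode : (hs : Vec State n) (f : Vec Bool n → Laurent A) →
           ⟨ subsets n ∣ (λ S → [ hs ≟ᵛ encode G R S ]) ⟩ f ≋ decode hs f
∑-decode [] f = ≋-trans (L.+-identityʳ _) (⊗-identityˡ _)
∑-decode {n = suc n} (h ∷ hs) f = begin
  ⟨ subsets (suc n) ∣ (λ S → [ (h ∷ hs) ≟ᵛ encode G R S ]) ⟩ f
    ≈⟨ ∑-cartesianProductWith _∷_ (outside ∷ inside ∷ []) (subsets n) _ ⟩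
  (∑ (outside ∷ inside ∷ []) λ b → ∑ (subsets n) λ S → [ (h ∷ hs) ≟ᵛ encode G R (b ∷ S) ] ⊗ f (b ∷ S))
    ≈⟨ ⊕-cong (part outside) (⊕-cong (part inside) ≋-refl) ⟩
  [ h ≟ R ] ⊗ decode hs (f ∘ (outside ∷_)) ⊕ ([ h ≟ G ] ⊗ decode hs (f ∘ (inside ∷_)) ⊕ 𝟘)
    ≈⟨ byLetter h _ ⟩
  decode (h ∷ hs) f ∎
  where
  open L
  part : ∀ b → (∑ (subsets n) λ S → [ (h ∷ hs) ≟ᵛ encode G R (b ∷ S) ] ⊗ f (b ∷ S))
               ≋ [ h ≟ (if b then G else R) ] ⊗ decode hs (f ∘ (b ∷_))
  part b = ≋-trans
    (∑-cong (subsets n) λ S → ≋-trans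
      (⊗-cong ([]-× (h ≟ (if b then G else R)) (hs ≟ᵛ encode G R S)) ≋-refl) (⊗-assoc _ _ _))
    (≋-trans (∑-⊗ˡ (subsets n) _ _) (⊗-cong ≋-refl (∑-decode hs (f ∘ (b ∷_)))))
  𝟘⊗⊕ : ∀ {f g : Laurent _} → 𝟘 ⊗ f ⊕ g ≋ g
  𝟘⊗⊕ = ≋-trans (⊕-cong (L.zeroˡ _) ≋-refl) (⊕-identityˡ _)
  byLetter : ∀ h (g : Bool → Laurent _) → [ h ≟ R ] ⊗ g outside ⊕ ([ h ≟ G ] ⊗ g inside ⊕ 𝟘)
             ≋ ⟪ letter h ⟫ 𝟙 𝟙 g
  byLetter ∅  g = ≋-trans 𝟘⊗⊕ 𝟘⊗⊕
  byLetter R  g = ⊕-cong ≋-refl 𝟘⊗⊕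
  byLetter G  g = 𝟘⊗⊕
  byLetter RG g = ≋-trans 𝟘⊗⊕ 𝟘⊗⊕

∑-mapMaybe : (g : X → Maybe Y) (xs : List X) (f : Y → Laurent A) →
             ∑ (mapMaybe g xs) f ≋ ∑ xs (λ x → ∑ (Maybe.maybe′ (_∷ []) [] (g x)) f)
∑-mapMaybe g []       f = ≋-refl
∑-mapMaybe g (x ∷ xs) f with g x
... | just y  = ⊕-cong (≋-sym (L.+-identityʳ _)) (∑-mapMaybe g xs f)
... | nothing = ≋-trans (∑-mapMaybe g xs f) (≋-sym (⊕-identityˡ _))

-- Sums over all subsets admit recursion on n, in contrast to those over subsets of a fixed size.
∑-diagrams : (f : Diagram k n → Laurent A) (g : Vec Bool n → Laurent A) →
             (∀ S (eq : ∣ S ∣ ≡ k) → f (S , eq) ≋ g S) → (∀ S → ∣ S ∣ ≢ k → g S ≋ 𝟘) →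
             ∑ (diagrams k n) f ≋ ∑ (subsets n) g
∑-diagrams {k = k} {n = n} f g f≋g g≋𝟘 = ≋-trans
  (∑-mapMaybe (λ S → Maybe.map (S ,_) (dec⇒maybe (∣ S ∣ ℕ.≟ k))) (subsets n) f) (∑-cong (subsets n) pointwise)
  where
  pointwise : ∀ S → ∑ (Maybe.maybe′ (_∷ []) [] (Maybe.map (S ,_) (dec⇒maybe (∣ S ∣ ℕ.≟ k)))) f ≋ g S
  pointwise S with ∣ S ∣ ℕ.≟ k
  ... | yes eq = ≋-trans (L.+-identityʳ _) (f≋g S eq)
  ... | no ≢k  = ≋-sym (g≋𝟘 S ≢k)

-- All the coefficients for given λ and μ are handled at once, as a functional of the function that
-- stands for the G^ν.
puzzleSum-Z : (λ′ μ : Diagram k n) (f : Vec Bool n → Laurent (Fin n)) →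
              (∀ S → ∣ S ∣ ≢ k → f S ≋ 𝟘) →
              ∑ (diagrams k n) (λ ν → puzzleSum λ′ μ ν ⊗ f (proj₁ ν))
              ≋ Z (allFin n) (allFin n) (encode G ∅ (proj₁ λ′)) (encode ∅ R (proj₁ μ)) f
puzzleSum-Z {k = k} {n = n} λ′ μ f f≋𝟘 = begin
  ∑ (diagrams k n) (λ ν → puzzleSum λ′ μ ν ⊗ f (proj₁ ν))
    ≈⟨ (∑-cong (diagrams k n) λ ν → ≋-trans
        (⊗-cong (∑-filter (isPuzzle? λ′ μ ν) (tilings n) weight) ≋-refl)
        (≋-trans (⊗-comm _ _) (≋-trans (≋-sym (∑-⊗ˡ (tilings n) _ _))
          (∑-cong (tilings n) λ t → ≋-trans (⊗-comm _ _) (separate ν t))))) ⟩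
  (∑ (diagrams k n) λ ν → ∑ (tilings n) λ t →
    sided id id as bs t ⊗ ([ bottomSide t ≟ᵛ encode G R (proj₁ ν) ] ⊗ f (proj₁ ν)))
    ≈⟨ ∑-comm (diagrams k n) (tilings n) _ ⟩
  (∑ (tilings n) λ t → ∑ (diagrams k n) λ ν →
    sided id id as bs t ⊗ ([ bottomSide t ≟ᵛ encode G R (proj₁ ν) ] ⊗ f (proj₁ ν)))
    ≈⟨ (∑-cong (tilings n) λ t → ≋-trans (∑-⊗ˡ (diagrams k n) _ _) (⊗-cong ≋-refl (≋-trans
        (∑-diagrams _ (λ S → [ bottomSide t ≟ᵛ encode G R S ] ⊗ f S) (λ _ _ → ≋-refl)
          λ S ≢k → ≋-trans (⊗-cong ≋-refl (f≋𝟘 S ≢k)) (L.zeroʳ _))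
        (∑-decode (bottomSide t) f)))) ⟩
  ⟨ tilings n ∣ sided id id as bs ⟩ (λ t → decode (bottomSide t) f)
    ≈⟨ ∑-tilings-Zᵗ id id as bs (λ us → decode (Vec.map hEdge us) f) ⟩
  Zᵗ (allFin n) (allFin n) as bs (λ us → decode (Vec.map hEdge us) f)
    ≈⟨ Zᵗ-decode (allFin n) (allFin n) as bs f ⟩
  Z (allFin n) (allFin n) as bs f ∎
  where
  open L
  as = encode G ∅ (proj₁ λ′)
  bs = encode ∅ R (proj₁ μ)
  separate : ∀ ν t → ([ isPuzzle? λ′ μ ν t ] ⊗ weight t) ⊗ f (proj₁ ν)
             ≋ sided id id as bs t ⊗ ([ bottomSide t ≟ᵛ encode G R (proj₁ ν) ] ⊗ f (proj₁ ν))
  separate ν t = ≋-trans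
    (⊗-cong (⊗-cong (≋-trans ([]-× m? (l? ×-dec r? ×-dec b?))
      (⊗-cong ≋-refl (≋-trans ([]-× l? (r? ×-dec b?)) (⊗-cong ≋-refl ([]-× r? b?))))) ≋-refl) ≋-refl)
    (shuffle [ m? ] [ l? ] [ r? ] [ b? ] (weight t) (f (proj₁ ν)))
    where
    m? = matching? t
    l? = leftSide t ≟ᵛ as
    r? = rightSide t ≟ᵛ bs
    b? = bottomSide t ≟ᵛ encode G R (proj₁ ν)
    open MonoidSolver
    shuffle : ∀ m l r b w f → ((m ⊗ (l ⊗ (r ⊗ b))) ⊗ w) ⊗ f ≋ (m ⊗ (l ⊗ (r ⊗ w))) ⊗ (b ⊗ f)
    shuffle = solve 6 (λ m l r b w f → ((m :* (l :* (r :* b))) :* w) :* f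
                                       := (m :* (l :* (r :* w))) :* (b :* f)) ≋-refl

-- Differences of variables are not zero divisors

-- The Laurent ring acts on sequences f : ℤ → Laurent A, the variable a by a
-- shift and all others by multiplication.  On the sequence τ of the powers
-- of a, the action is multiplication.  If (a − b) f = 0, then acting with f
-- on the truncation of τ to nonpositive exponents yields a sequence which is
-- geometric with ratio b and vanishes far up, hence vanishes; but far down
-- its terms are those of f τ.
module Shift (_≟ᴬ_ : DecidableEquality A) (a : A) where
  open Exp (CommutativeRing.semiring (laurentRing A)) using (_^_)

  degree : A → ℤ
  degree c = if does (c ≟ᴬ a) then ℤ.1ℤ else ℤ.0ℤ

  factor factor⁻¹ : A → Laurent A
  factor   c = if does (c ≟ᴬ a) then 𝟙 else var c
  factor⁻¹ c = if does (c ≟ᴬ a) then 𝟙 else inv c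

  act : Laurent A → (ℤ → Laurent A) → ℤ → Laurent A
  act (var c) φ m = factor c ⊗ φ (degree c ℤ.+ m)
  act (inv c) φ m = factor⁻¹ c ⊗ φ (ℤ.- degree c ℤ.+ m)
  act 𝟘       φ m = 𝟘
  act 𝟙       φ m = φ m
  act (f ⊕ g) φ m = act f φ m ⊕ act g φ m
  act (f ⊗ g) φ m = act f (act g φ) m
  act (⊖ f)   φ m = ⊖ act f φ m

  linear-⊗ : ∀ {X} {Φ : (X → Laurent A) → Laurent A} (c : Laurent A) → Linear Φ → Linear (λ φ → c ⊗ Φ φ)
  linear-⊗ c lΦ = record
    { cong  = λ f≋g → ⊗-cong ≋-refl (cong lΦ f≋g)
    ; add   = λ f g → ≋-trans (⊗-cong ≋-refl (add lΦ f g)) (⊗-distribˡ _ _ _)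
    ; scale = λ d f → ≋-trans (⊗-cong ≋-refl (scale lΦ d f)) (L.x*yz≈y*xz _ _ _) }

  linear-act : ∀ f m → Linear (λ φ → act f φ m)
  linear-act (var c) m = linear-⊗ _ (linear-at _)
  linear-act (inv c) m = linear-⊗ _ (linear-at _)
  linear-act 𝟘       m = linear-𝟘
  linear-act 𝟙       m = linear-at m
  linear-act (f ⊕ g) m = record
    { cong  = λ p → ⊕-cong (cong (linear-act f m) p) (cong (linear-act g m) p)
    ; add   = λ φ ψ → ≋-trans (⊕-cong (add (linear-act f m) φ ψ) (add (linear-act g m) φ ψ))
                              (L.+-interchange _ _ _ _)
    ; scale = λ c φ → ≋-trans (⊕-cong (scale (linear-act f m) c φ) (scale (linear-act g m) c φ))
                              (≋-sym (⊗-distribˡ _ _ _)) }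
  linear-act (f ⊗ g) m = linear-bind (linear-act f m) (linear-act g)
  linear-act (⊖ f)   m = record
    { cong  = λ p → ⊖-cong (cong (linear-act f m) p)
    ; add   = λ φ ψ → ≋-trans (⊖-cong (add (linear-act f m) φ ψ)) (≋-sym (L.-‿+-comm _ _))
    ; scale = λ c φ → ≋-trans (⊖-cong (scale (linear-act f m) c φ)) (L.-‿distribʳ-* _ _) }

  act-⊖ : ∀ f φ m → act f (⊖_ ∘ φ) m ≋ ⊖ act f φ m
  act-⊖ f φ m = ≋-trans (cong (linear-act f m) λ _ → ≋-sym ⊖𝟙⊗) (≋-trans (scale (linear-act f m) (⊖ 𝟙) φ) ⊖𝟙⊗)

  +-swap : ∀ d e m → d ℤ.+ (e ℤ.+ m) ≡ e ℤ.+ (d ℤ.+ m)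
  +-swap d e m = ≡.trans (≡.sym (ℤ.+-assoc d e m))
    (≡.trans (≡.cong (ℤ._+ m) (ℤ.+-comm d e)) (ℤ.+-assoc e d m))

  act-shift : ∀ f d φ m → act f (φ ∘ ℤ._+_ d) m ≋ act f φ (d ℤ.+ m)
  act-shift (var c) d φ m = ⊗-cong ≋-refl (L.reflexive (≡.cong φ (+-swap d (degree c) m)))
  act-shift (inv c) d φ m = ⊗-cong ≋-refl (L.reflexive (≡.cong φ (+-swap d (ℤ.- degree c) m)))
  act-shift 𝟘       d φ m = ≋-refl
  act-shift 𝟙       d φ m = ≋-refl
  act-shift (f ⊕ g) d φ m = ⊕-cong (act-shift f d φ m) (act-shift g d φ m)
  act-shift (f ⊗ g) d φ m =
    ≋-trans (cong (linear-act f m) (act-shift g d φ)) (act-shift f d (act g φ) m)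
  act-shift (⊖ f)   d φ m = ⊖-cong (act-shift f d φ m)

  -- Generators act by a translation followed by a constant factor; both commute with every `act g`,
  -- by `act-shift` and linearity.
  act-comm : ∀ f g φ m → act f (act g φ) m ≋ act g (act f φ) m
  act-comm (var c)   g φ m = ≋-sym (≋-trans (scale (linear-act g m) _ _)
    (⊗-cong ≋-refl (act-shift g (degree c) φ m)))
  act-comm (inv c)   g φ m = ≋-sym (≋-trans (scale (linear-act g m) _ _)
    (⊗-cong ≋-refl (act-shift g (ℤ.- degree c) φ m)))
  act-comm 𝟘         g φ m = ≋-sym (zeroes (linear-act g m))
  act-comm 𝟙         g φ m = ≋-refl
  act-comm (f ⊕ f′)  g φ m = ≋-trans (⊕-cong (act-comm f g φ m) (act-comm f′ g φ m))
                                     (≋-sym (add (linear-act g m) _ _))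
  act-comm (f ⊗ f′)  g φ m = ≋-trans (cong (linear-act f m) (act-comm f′ g φ)) (act-comm f g (act f′ φ) m)
  act-comm (⊖ f)     g φ m = ≋-trans (⊖-cong (act-comm f g φ m)) (≋-sym (act-⊖ g (act f φ) m))

  factor-inverse : ∀ c → factor c ⊗ factor⁻¹ c ≋ 𝟙
  factor-inverse c with c ≟ᴬ a
  ... | yes _ = ⊗-identityˡ 𝟙
  ... | no  _ = var-inv c

  -- The action is defined on terms; this makes it an action of the ring, so that a relation such as
  -- (a - b) f = 0 can be applied to any sequence.
  act-≋ : ∀ {f g} → f ≋ g → ∀ φ m → act f φ m ≋ act g φ m
  act-≋ ≋-refl                 φ m = ≋-refl
  act-≋ (≋-sym p)              φ m = ≋-sym (act-≋ p φ m)
  act-≋ (≋-trans p q)          φ m = ≋-trans (act-≋ p φ m) (act-≋ q φ m)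
  act-≋ (⊕-cong p q)           φ m = ⊕-cong (act-≋ p φ m) (act-≋ q φ m)
  act-≋ (⊗-cong {f} {g′ = g′} p q) φ m = ≋-trans (cong (linear-act f m) (act-≋ q φ)) (act-≋ p (act g′ φ) m)
  act-≋ (⊖-cong p)             φ m = ⊖-cong (act-≋ p φ m)
  act-≋ (⊕-assoc f g h)        φ m = ⊕-assoc _ _ _
  act-≋ (⊕-comm f g)           φ m = ⊕-comm _ _
  act-≋ (⊕-identityˡ f)        φ m = ⊕-identityˡ _
  act-≋ (⊖-inverseˡ f)         φ m = ⊖-inverseˡ _
  act-≋ (⊗-assoc f g h)        φ m = ≋-refl
  act-≋ (⊗-comm f g)           φ m = act-comm f g φ m
  act-≋ (⊗-identityˡ f)        φ m = ≋-refl
  act-≋ (⊗-distribˡ f g h)     φ m = add (linear-act f m) _ _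
  act-≋ (var-inv c)            φ m = ≋-trans (≋-sym (⊗-assoc _ _ _))
    (≋-trans (⊗-cong (factor-inverse c) (L.reflexive (≡.cong φ eq))) (⊗-identityˡ _))
    where
    eq : ℤ.- degree c ℤ.+ (degree c ℤ.+ m) ≡ m
    eq = ≡.trans (≡.sym (ℤ.+-assoc (ℤ.- degree c) (degree c) m))
           (≡.trans (≡.cong (ℤ._+ m) (ℤ.+-inverseˡ (degree c))) (ℤ.+-identityˡ m))

  τ : ℤ → Laurent A
  τ (+ n)    = var a ^ n
  τ -[1+ n ] = inv a ^ suc n

  inv-var : ∀ {f} → inv a ⊗ (var a ⊗ f) ≋ f
  inv-var = ≋-trans (≋-sym (⊗-assoc _ _ _))
    (≋-trans (⊗-cong (≋-trans (⊗-comm _ _) (var-inv a)) ≋-refl) (⊗-identityˡ _))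

  var-inv′ : ∀ {f} → var a ⊗ (inv a ⊗ f) ≋ f
  var-inv′ = ≋-trans (≋-sym (⊗-assoc _ _ _)) (≋-trans (⊗-cong (var-inv a) ≋-refl) (⊗-identityˡ _))

  τ-suc : ∀ m → τ (ℤ.suc m) ≋ var a ⊗ τ m
  τ-suc (+ n)        = ≋-refl
  τ-suc -[1+ zero ]  = ≋-sym var-inv′
  τ-suc -[1+ suc n ] = ≋-sym var-inv′

  τ-pred : ∀ m → τ (ℤ.pred m) ≋ inv a ⊗ τ m
  τ-pred (+ zero)  = ≋-refl
  τ-pred (+ suc n) = ≋-sym inv-var
  τ-pred -[1+ n ]  = ≋-refl

  τ-cancel : ∀ m {f} → f ⊗ τ m ≋ 𝟘 → f ≋ 𝟘
  τ-cancel m {f} fτ≋𝟘 = begin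
    f                      ≈⟨ L.*-identityʳ f ⟨
    f ⊗ 𝟙                  ≈⟨ ⊗-cong ≋-refl (unit m) ⟨
    f ⊗ (τ m ⊗ τ′ m)       ≈⟨ ⊗-assoc _ _ _ ⟨
    (f ⊗ τ m) ⊗ τ′ m       ≈⟨ ⊗-cong fτ≋𝟘 ≋-refl ⟩
    𝟘 ⊗ τ′ m               ≈⟨ L.zeroˡ _ ⟩
    𝟘                      ∎
    where
    open L
    τ′ : ℤ → Laurent A
    τ′ (+ n)    = inv a ^ n
    τ′ -[1+ n ] = var a ^ suc n
    powers : ∀ n → var a ^ n ⊗ inv a ^ n ≋ 𝟙
    powers zero    = ⊗-identityˡ 𝟙
    powers (suc n) = ≋-trans (L.*-interchange _ _ _ _) (≋-trans (⊗-cong (var-inv a) (powers n)) (⊗-identityˡ 𝟙))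
    unit : ∀ m → τ m ⊗ τ′ m ≋ 𝟙
    unit (+ n)    = powers n
    unit -[1+ n ] = ≋-trans (⊗-comm _ _) (powers (suc n))

  act-τ : ∀ f m → act f τ m ≋ f ⊗ τ m
  act-τ (var c) m with c ≟ᴬ a
  ... | yes refl = ≋-trans (⊗-identityˡ _) (τ-suc m)
  ... | no _     = ⊗-cong ≋-refl (L.reflexive (≡.cong τ (ℤ.+-identityˡ m)))
  act-τ (inv c) m with c ≟ᴬ a
  ... | yes refl = ≋-trans (⊗-identityˡ _) (τ-pred m)
  ... | no _     = ⊗-cong ≋-refl (L.reflexive (≡.cong τ (ℤ.+-identityˡ m)))
  act-τ 𝟘       m = ≋-sym (L.zeroˡ _)
  act-τ 𝟙       m = ≋-sym (⊗-identityˡ _)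
  act-τ (f ⊕ g) m = ≋-trans (⊕-cong (act-τ f m) (act-τ g m)) (≋-sym (L.distribʳ _ _ _))
  act-τ (f ⊗ g) m = ≋-trans (cong (linear-act f m) (act-τ g)) (≋-trans (scale (linear-act f m) g τ)
    (≋-trans (⊗-cong ≋-refl (act-τ f m)) (≋-trans (≋-sym (⊗-assoc _ _ _)) (⊗-cong (⊗-comm g f) ≋-refl))))
  act-τ (⊖ f)   m = ≋-trans (⊖-cong (act-τ f m)) (L.-‿distribˡ-* _ _)

  -- A term shifts by boundedly many places, so sequences that agree far out in one direction still
  -- do after the action. The two instances treat the directions down and up.
  module Locality (_≼_ : ℤ → ℤ → Set) (+-mono : ∀ d {i j} → i ≼ j → (d ℤ.+ i) ≼ (d ℤ.+ j))
                  (meet : ∀ i j → ∃ λ k → ∀ l → l ≼ k → l ≼ i × l ≼ j) where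

    local : ∀ f bound → ∃ λ bound′ → ∀ {φ ψ} → (∀ m → m ≼ bound → φ m ≋ ψ m) →
            ∀ m → m ≼ bound′ → act f φ m ≋ act f ψ m
    local (var c) b = ℤ.- degree c ℤ.+ b , λ p m m≼ → ⊗-cong ≋-refl (p _
      (≡.subst ((degree c ℤ.+ m) ≼_) (cancel (degree c)) (+-mono (degree c) m≼)))
      where
      cancel : ∀ d → d ℤ.+ (ℤ.- d ℤ.+ b) ≡ b
      cancel d = ≡.trans (≡.sym (ℤ.+-assoc d (ℤ.- d) b))
        (≡.trans (≡.cong (ℤ._+ b) (ℤ.+-inverseʳ d)) (ℤ.+-identityˡ b))
    local (inv c) b = degree c ℤ.+ b , λ p m m≼ → ⊗-cong ≋-refl (p _
      (≡.subst ((ℤ.- degree c ℤ.+ m) ≼_) (cancel (degree c)) (+-mono (ℤ.- degree c) m≼)))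
      where
      cancel : ∀ d → ℤ.- d ℤ.+ (d ℤ.+ b) ≡ b
      cancel d = ≡.trans (≡.sym (ℤ.+-assoc (ℤ.- d) d b))
        (≡.trans (≡.cong (ℤ._+ b) (ℤ.+-inverseˡ d)) (ℤ.+-identityˡ b))
    local 𝟘       b = b , λ _ _ _ → ≋-refl
    local 𝟙       b = b , λ p m m≼ → p m m≼
    local (f ⊕ g) b =
      let (i , p) = local f b ; (j , q) = local g b ; (k , below) = meet i j
      in k , λ eq m m≼ → ⊕-cong (p eq m (proj₁ (below m m≼))) (q eq m (proj₂ (below m m≼)))
    local (f ⊗ g) b =
      let (i , p) = local g b ; (j , q) = local f i in j , λ eq → q (p eq)
    local (⊖ f)   b = let (i , p) = local f b in i , λ eq m m≼ → ⊖-cong (p eq m m≼)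

  module Down = Locality ℤ._≤_ ℤ.+-monoʳ-≤
    (λ i j → i ℤ.⊓ j , λ l l≤ → ℤ.≤-trans l≤ (ℤ.i⊓j≤i i j) , ℤ.≤-trans l≤ (ℤ.i⊓j≤j i j))
  module Up = Locality ℤ._≥_ (λ d i≥j → ℤ.+-monoʳ-≤ d i≥j)
    (λ i j → i ℤ.⊔ j , λ l l≥ → ℤ.≤-trans (ℤ.i≤i⊔j i j) l≥ , ℤ.≤-trans (ℤ.i≤j⊔i i j) l≥)

  truncated : ℤ → Laurent A
  truncated (+ zero)  = 𝟙
  truncated (+ suc n) = 𝟘
  truncated -[1+ n ]  = τ -[1+ n ]

  truncated-≤0 : ∀ m → m ℤ.≤ ℤ.0ℤ → truncated m ≋ τ m
  truncated-≤0 (+ zero)  _           = ≋-refl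
  truncated-≤0 (+ suc n) (ℤ.+≤+ ())
  truncated-≤0 -[1+ n ]  _           = ≋-refl

  truncated-≥1 : ∀ m → m ℤ.≥ ℤ.1ℤ → truncated m ≋ 𝟘
  truncated-≥1 (+ zero)  (ℤ.+≤+ ())
  truncated-≥1 (+ suc n) _           = ≋-refl

  i≤+∣i∣ : ∀ i → i ℤ.≤ + ℤ.∣ i ∣
  i≤+∣i∣ (+ n)    = ℤ.≤-refl
  i≤+∣i∣ -[1+ n ] = ℤ.-≤+

  i-[i-j]≡j : ∀ i j → i ℤ.- (i ℤ.- j) ≡ j
  i-[i-j]≡j i j = begin
    i ℤ.- (i ℤ.- j)               ≡⟨ ≡.cong (ℤ._+_ i) (ℤ.neg-distrib-+ i (ℤ.- j)) ⟩
    i ℤ.+ (ℤ.- i ℤ.- (ℤ.- j))     ≡⟨ ≡.cong (λ l → i ℤ.+ (ℤ.- i ℤ.+ l)) (ℤ.neg-involutive j) ⟩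
    i ℤ.+ (ℤ.- i ℤ.+ j)           ≡⟨ ℤ.+-assoc i (ℤ.- i) j ⟨
    i ℤ.- i ℤ.+ j                 ≡⟨ ≡.cong (ℤ._+ j) (ℤ.+-inverseʳ i) ⟩
    ℤ.0ℤ ℤ.+ j                    ≡⟨ ℤ.+-identityˡ j ⟩
    j                             ∎
    where open ≡.≡-Reasoning

  cancel-difference : ∀ b → b ≢ a → ∀ f → (var a ⊝ var b) ⊗ f ≋ 𝟘 → f ≋ 𝟘
  cancel-difference b b≢a f eq = τ-cancel (top ℤ.- + gap) (begin
    f ⊗ τ (top ℤ.- + gap)         ≈⟨ act-τ f _ ⟨
    act f τ (top ℤ.- + gap)       ≈⟨ proj₂ (Down.local f ℤ.0ℤ) truncated-≤0 (top ℤ.- + gap) reach ⟨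
    g (top ℤ.- + gap)             ≈⟨ descend gap ⟩
    𝟘                           ∎)
    where
    open L
    g : ℤ → Laurent A
    g = act f truncated
    bottom top : ℤ
    bottom = proj₁ (Down.local f ℤ.0ℤ)
    top    = proj₁ (Up.local f ℤ.1ℤ)
    -- Enough steps down from `top`, where `g` vanishes, to a place not above `bottom`, where `g`
    -- agrees with `act f τ`.
    gap : ℕ
    gap = ℤ.∣ top ℤ.- bottom ∣
    reach : top ℤ.- + gap ℤ.≤ bottom
    reach = ℤ.≤-trans (ℤ.+-monoʳ-≤ top (ℤ.neg-mono-≤ (i≤+∣i∣ (top ℤ.- bottom))))
                      (ℤ.≤-reflexive (i-[i-j]≡j top bottom))
    act-a : ∀ φ m → act (var a) φ m ≋ φ (ℤ.suc m)
    act-a φ m with a ≟ᴬ a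
    ... | yes _  = ⊗-identityˡ _
    ... | no a≢a = ⊥-elim (a≢a refl)
    act-b : ∀ φ m → act (var b) φ m ≋ var b ⊗ φ m
    act-b φ m with b ≟ᴬ a
    ... | yes b≡a = ⊥-elim (b≢a b≡a)
    ... | no _    = ⊗-cong ≋-refl (L.reflexive (≡.cong φ (ℤ.+-identityˡ m)))
    -- The hypothesis acts on `truncated`: `var a` shifts the result, `var b` multiplies it.
    geometric : ∀ m → g (ℤ.suc m) ≋ var b ⊗ g m
    geometric m = ≋-trans (≋-sym (act-a g m)) (≋-trans
      (⊝⇒≋ (act-≋ eq truncated m)) (act-b g m))
    backward : ∀ m → g (ℤ.suc m) ≋ 𝟘 → g m ≋ 𝟘
    backward m g≋𝟘 = begin
      g m                         ≈⟨ ⊗-identityˡ _ ⟨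
      𝟙 ⊗ g m                     ≈⟨ ⊗-cong (≋-trans (⊗-comm _ _) (var-inv b)) ≋-refl ⟨
      (inv b ⊗ var b) ⊗ g m       ≈⟨ ⊗-assoc _ _ _ ⟩
      inv b ⊗ (var b ⊗ g m)       ≈⟨ ⊗-cong ≋-refl (≋-trans (≋-sym (geometric m)) g≋𝟘) ⟩
      inv b ⊗ 𝟘                   ≈⟨ L.zeroʳ _ ⟩
      𝟘                           ∎
    descend : ∀ n → g (top ℤ.- + n) ≋ 𝟘
    descend zero    = ≋-trans (proj₂ (Up.local f ℤ.1ℤ) {ψ = λ _ → 𝟘} truncated-≥1 (top ℤ.- ℤ.0ℤ)
      (ℤ.≤-reflexive (≡.sym (ℤ.+-identityʳ top)))) (zeroes (linear-act f (top ℤ.- ℤ.0ℤ)))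
    descend (suc n) = backward (top ℤ.- + suc n)
      (≋-trans (L.reflexive (≡.cong g shifted)) (descend n))
      where
      shifted : ℤ.suc (top ℤ.- + suc n) ≡ top ℤ.- + n
      shifted = ≡.trans (+-swap ℤ.1ℤ top (ℤ.- + suc n)) (≡.cong (ℤ._+_ top) (lemma n))
        where
        lemma : ∀ n → ℤ.1ℤ ℤ.+ (ℤ.- + suc n) ≡ ℤ.- + n
        lemma zero    = refl
        lemma (suc n) = refl

-- Double Grothendieck polynomials from divided differences

∏-cong : {f g : Fin n → Laurent A} → (∀ i → f i ≋ g i) → ∏ f ≋ ∏ g
∏-cong {A = A} = MonoidSum.sum-cong-≋ (CommutativeRing.*-monoid (laurentRing A))

passing-∏ : (m : ℕ) (x : A) (g : Fin n → A) (m≤n : m ≤ n) →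
            passing m x (tabulate g) ≋ ∏ (λ (j : Fin m) → 𝟙 ⊝ x / g (inject≤ j m≤n))
passing-∏ zero x g m≤n = ≋-refl
passing-∏ {n = suc n} (suc m) x g (s≤s m≤n) = ⊗-cong ≋-refl (passing-∏ m x (g ∘ suc) m≤n)

block-unique : (m : ℕ) (S : Vec Bool n) → m + k ≡ n → (∀ i → i ∈ S ⇔ m ≤ toℕ i) → S ≡ block m k n
block-unique m [] m+k≡n ∈⇔ = refl
block-unique {k = suc k} zero (b ∷ S) refl ∈⇔ with Equivalence.from (∈⇔ zero) z≤n
... | here = ≡.cong (true ∷_) (block-unique zero S refl λ i →
  mk⇔ (λ _ → z≤n) λ _ → drop-there (Equivalence.from (∈⇔ (suc i)) z≤n))
block-unique (suc m) (true ∷ S) m+k≡n ∈⇔ with Equivalence.to (∈⇔ zero) here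
... | ()
block-unique (suc m) (false ∷ S) m+k≡n ∈⇔ = ≡.cong (false ∷_) (block-unique m S (ℕ.suc-injective m+k≡n) λ i →
  mk⇔ (λ i∈S → ℕ.s≤s⁻¹ (Equivalence.to (∈⇔ (suc i)) (there i∈S)))
      (λ m≤i → drop-there (Equivalence.from (∈⇔ (suc i)) (s≤s m≤i))))

frame-step : (i : Fin n) (S : Vec Bool (suc n)) → suc i ∈ S → inject₁ i ∉ S →
             ∃ λ T → Descent i T × S ≡ swap i T × (S - suc i) ∪ ⁅ inject₁ i ⁆ ≡ T
frame-step zero (true ∷ t ∷ S)  q∈S p∉S = ⊥-elim (p∉S here)
frame-step zero (false ∷ _ ∷ S) (there here) p∉S =
  true ∷ false ∷ S , here , refl , ≡.cong (λ U → true ∷ false ∷ U)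
    (≡.trans (∪-identityʳ _) (p─⊥≡p S))
frame-step (suc i) (s ∷ S) (there q∈S) p∉S =
  let (T , d , S≡ , T≡) = frame-step i S q∈S (p∉S ∘ there)
  in s ∷ T , there d , ≡.cong (s ∷_) S≡ , ≡.cong₂ _∷_ (∨-identityʳ s) T≡

transpose-suc : (p q j : Fin n) → transpose (suc p) (suc q) (suc j) ≡ suc (transpose p q j)
transpose-suc p q j with does (j Fin.≟ p)
... | true  = refl
... | false with does (j Fin.≟ q)
...   | true  = refl
...   | false = refl

swap-tabulate : (i : Fin n) (g : Fin (suc n) → A) →
                tabulate (g ∘ transpose (inject₁ i) (suc i)) ≡ swap i (tabulate g)
swap-tabulate zero    g = refl
swap-tabulate (suc i) g = ≡.cong (g zero ∷_) (≡.trans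
  (Vec.tabulate-cong λ j → ≡.cong g (transpose-suc (inject₁ i) (suc i) j))
  (swap-tabulate i (g ∘ suc)))

ratio-tabulate : (i : Fin n) (g : Fin (suc n) → A) → ratio i (tabulate g) ≡ g (inject₁ i) / g (suc i)
ratio-tabulate zero    g = refl
ratio-tabulate (suc i) g = ratio-tabulate i (g ∘ suc)

-- Inserting the relation of `Γ-exchange` into the numerator of D_i, the terms in `f` cancel because
-- `var q ⊗ p / q ≋ var p`.
dividedDifference : (p q : A) (f g : Laurent A) →
                    var p ⊗ f ⊝ var q ⊗ (p / q ⊗ f ⊕ (𝟙 ⊝ p / q) ⊗ g) ≋ (var p ⊝ var q) ⊗ g
dividedDifference p q f g = begin
  P ⊗ f ⊝ q′ ⊗ (u ⊗ f ⊕ (𝟙 ⊝ u) ⊗ g)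
    ≈⟨ ⊕-cong ≋-refl (⊖-cong (≋-trans (⊗-distribˡ _ _ _) (⊕-cong
         (≋-trans (≋-sym (⊗-assoc _ _ _)) (⊗-cong q⊗u ≋-refl))
         (≋-trans (≋-sym (⊗-assoc _ _ _)) (⊗-cong (≋-trans (⊗-distribˡ _ _ _)
           (⊕-cong (L.*-identityʳ _) (≋-trans (≋-sym (L.-‿distribʳ-* _ _)) (⊖-cong q⊗u)))) ≋-refl))))) ⟩
  P ⊗ f ⊝ (P ⊗ f ⊕ (q′ ⊝ P) ⊗ g)
    ≈⟨ ⊕-cong ≋-refl (L.-‿+-comm _ _) ⟨
  P ⊗ f ⊕ (⊖ (P ⊗ f) ⊝ (q′ ⊝ P) ⊗ g)
    ≈⟨ ⊕-assoc _ _ _ ⟨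
  (P ⊗ f ⊝ P ⊗ f) ⊝ (q′ ⊝ P) ⊗ g
    ≈⟨ ≋-trans (⊕-cong (L.-‿inverseʳ _) ≋-refl) (⊕-identityˡ _) ⟩
  ⊖ ((q′ ⊝ P) ⊗ g)
    ≈⟨ L.-‿distribˡ-* _ _ ⟩
  ⊖ (q′ ⊝ P) ⊗ g
    ≈⟨ ⊗-cong (≋-trans (≋-sym (L.-‿+-comm _ _))
         (≋-trans (⊕-cong ≋-refl (L.-‿involutive _)) (⊕-comm _ _))) ≋-refl ⟩
  (P ⊝ q′) ⊗ g ∎
  where
  open L
  P  = var p
  q′ = var q
  u  = p / q
  q⊗u : q′ ⊗ u ≋ P
  q⊗u = ≋-trans (L.x*yz≈y*xz _ _ _) (≋-trans (⊗-cong ≋-refl (var-inv q)) (L.*-identityʳ _))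

module _ (_≟ᴬ_ : DecidableEquality A) where
  ⊗-cancelˡ-difference : ∀ {p q} → p ≢ q → ∀ {f g} → (var p ⊝ var q) ⊗ f ≋ (var p ⊝ var q) ⊗ g → f ≋ g
  ⊗-cancelˡ-difference {p} {q} p≢q {f} {g} eq = ⊝⇒≋ (Shift.cancel-difference _≟ᴬ_ p q (p≢q ∘ ≡.sym) (f ⊝ g)
    (≋-trans (⊗-distribˡ _ _ _) (≋-trans (⊕-cong ≋-refl (≋-sym (L.-‿distribʳ-* _ _))) (≋⇒⊝ eq))))

module _ {k n : ℕ} where
  Γˣʸ : Vec Bool n → Laurent (Var k n)
  Γˣʸ = Γ (tabulate inj₁) (tabulate inj₂)

rename-transpose-Γ : (i : Fin n) (S : Vec Bool (suc n)) →
                     rename (Sum.map₂ (transpose (inject₁ i) (suc i))) (Γˣʸ {k} S)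
                     ≋ exchange Rᴴ (inj₂ (inject₁ i) / inj₂ (suc i)) i S Γˣʸ
rename-transpose-Γ {k = k} i S = begin
  rename ρ (Γˣʸ S)
    ≈⟨ rename-Γ ρ (tabulate inj₁) (tabulate inj₂) S ⟩
  Γ (Vec.map ρ (tabulate inj₁)) (Vec.map ρ (tabulate inj₂)) S
    ≡⟨ ≡.cong₂ (λ xs ys → Γ {k = k} xs ys S) (≡.sym (Vec.tabulate-∘ ρ inj₁))
         (≡.trans (≡.sym (Vec.tabulate-∘ ρ inj₂)) (swap-tabulate i inj₂)) ⟩
  Γ (tabulate inj₁) (swap i (tabulate inj₂)) S
    ≈⟨ Γ-exchange i (tabulate inj₁) (tabulate inj₂) S ⟩
  exchange Rᴴ (ratio i (tabulate inj₂)) i S Γˣʸ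
    ≡⟨ ≡.cong (λ u → exchange Rᴴ u i S Γˣʸ) (ratio-tabulate i inj₂) ⟩
  exchange Rᴴ (inj₂ (inject₁ i) / inj₂ (suc i)) i S Γˣʸ ∎
  where
  open L
  ρ = Sum.map₂ (transpose (inject₁ i) (suc i))

-- `Γ` has the value of the rectangle and satisfies the same recursion; since that recursion is
-- stated with cleared denominator, the factor y_p - y_q has to be cancelled.
Grothendieck-Γ : k ≤ n → ∀ {S : Vec Bool n} {f : Laurent (Var k n)} → IsGrothendieck S f → f ≋ Γˣʸ S
Grothendieck-Γ {k} {n} k≤n {S} {f} (rectangle ∈⇔ f≋) = begin
  f
    ≈⟨ f≋ ⟩
  ∏ (λ (i : Fin k) → ∏ (λ (j : Fin m) → 𝟙 ⊝ x i ⊗ y⁻¹ (inject≤ j (ℕ.m∸n≤m n k))))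
    ≈⟨ ∏-cong (λ (i : Fin k) → ≋-trans (≋-sym (passing-∏ m (inj₁ i) inj₂ (ℕ.m∸n≤m n k)))
         (L.reflexive (≡.cong (λ a → passing m a (tabulate inj₂)) (≡.sym (Vec.lookup∘tabulate inj₁ i))))) ⟩
  ∏ (λ (i : Fin k) → passing m (lookup (tabulate inj₁) i) (tabulate inj₂))
    ≈⟨ Γ-block m (tabulate inj₁) (tabulate inj₂) (ℕ.≤-reflexive m+k≡n) ⟨
  Γˣʸ (block m k n)
    ≡⟨ ≡.cong Γˣʸ (block-unique m S m+k≡n ∈⇔) ⟨
  Γˣʸ S ∎
  where
  open L
  m = n ∸ k
  m+k≡n : m + k ≡ n
  m+k≡n = ℕ.m∸n+n≡m k≤n
Grothendieck-Γ k≤n {T} {g} (step {S} {f = f} p (suc i) q≡1+p q∈S p∉S T≡ isf div)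
  with refl ← Fin.toℕ-injective {i = p} {j = inject₁ i}
                (≡.trans (≡.sym (ℕ.suc-injective q≡1+p)) (≡.sym (Fin.toℕ-inject₁ i)))
  with T′ , d , refl , T′≡ ← frame-step i S q∈S p∉S
  with refl ← ≡.trans T≡ T′≡
  = ⊗-cancelˡ-difference (Sum.≡-dec Fin._≟_ Fin._≟_) p≢q (begin
  (y p ⊝ y q) ⊗ g
    ≈⟨ div ⟩
  y p ⊗ f ⊝ y q ⊗ rename ρ f
    ≈⟨ ⊕-cong (⊗-cong ≋-refl f≋) (⊖-cong (⊗-cong ≋-refl (≋-trans (rename-cong ρ f≋)
         (≋-trans (rename-transpose-Γ i S) (exchange-descent _ d Γˣʸ))))) ⟩
  y p ⊗ Γˣʸ S ⊝ y q ⊗ (u ⊗ Γˣʸ S ⊕ (𝟙 ⊝ u) ⊗ Γˣʸ T)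
    ≈⟨ dividedDifference (inj₂ p) (inj₂ q) (Γˣʸ S) (Γˣʸ T) ⟩
  (y p ⊝ y q) ⊗ Γˣʸ T ∎)
  where
  open L
  q = suc i
  u = inj₂ p / inj₂ q
  ρ = Sum.map₂ (transpose p q)
  f≋ = Grothendieck-Γ k≤n isf
  p≢q : inj₂ p ≢ inj₂ q
  p≢q eq = ℕ.1+n≢n (≡.trans (≡.sym q≡1+p) (≡.cong toℕ (≡.sym (Sum.inj₂-injective eq))))

specialize-Γ : (ι : Fin k → Fin n) (S : Vec Bool n) → specialize ι (Γˣʸ S) ≋ Γ (tabulate ι) (allFin n) S
specialize-Γ {k} {n} ι S = ≋-trans (rename-Γ [ ι , id ]′ (tabulate inj₁) (tabulate inj₂) S)
  (L.reflexive (≡.cong₂ (λ xs ys → Γ {k = k} xs ys S) (≡.sym (Vec.tabulate-∘ [ ι , id ]′ inj₁))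
    (≡.sym (Vec.tabulate-∘ [ ι , id ]′ inj₂))))

-- Products of localizations and triangularity

encodeᴬ encodeᴮ : Vec Bool n → Vec State n
encodeᴬ = encode G ∅
encodeᴮ = encode ∅ R

⊗𝟘⊗⊕ : ∀ {c f g : Laurent A} → c ⊗ (𝟘 ⊗ f) ⊕ g ≋ g
⊗𝟘⊗⊕ = ⊗𝟘⊕ (L.zeroˡ _)

-- A right line can leave in state `∅` a left line in state `G` or `∅` only if it enters in state
-- `∅`; the crossing then changes nothing and has weight 1.
cross-∅ : (l : Bool) (b : State) (w : Laurent A) (f : State → Laurent A) →
          ⟪ cross (if l then G else ∅) b ⟫ w 𝟙 (λ (a , b′) → [ b′ ≟ ∅ ] ⊗ f a)
          ≋ [ b ≟ ∅ ] ⊗ f (if l then G else ∅)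
cross-∅ false ∅  w f = 1⊗⊕𝟘 _
cross-∅ false R  w f = ≋-trans ⊗𝟘⊗⊕ (≋-trans ⊗𝟘⊗⊕ (≋-sym (L.zeroˡ _)))
cross-∅ false G  w f = ≋-sym (L.zeroˡ _)
cross-∅ false RG w f = ≋-sym (L.zeroˡ _)
cross-∅ true  ∅  w f = ≋-trans (⊕-cong ≋-refl ⊗𝟘⊗⊕) (1⊗⊕𝟘 _)
cross-∅ true  R  w f = ≋-trans ⊗𝟘⊗⊕ (≋-sym (L.zeroˡ _))
cross-∅ true  G  w f = ≋-sym (L.zeroˡ _)
cross-∅ true  RG w f = ≋-trans ⊗𝟘⊗⊕ (≋-trans ⊗𝟘⊗⊕ (≋-sym (L.zeroˡ _)))

cross-R : (b : State) (w : Laurent A) (f : State → Laurent A) →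
          ⟪ cross ∅ b ⟫ w 𝟙 (λ (a , b′) → [ b′ ≟ R ] ⊗ f a) ≋ [ b ≟ R ] ⊗ f ∅
cross-R ∅  w f = ≋-trans ⊗𝟘⊗⊕ (≋-sym (L.zeroˡ _))
cross-R R  w f = ≋-trans (⊕-cong ≋-refl ⊗𝟘⊗⊕) (1⊗⊕𝟘 _)
cross-R G  w f = ≋-sym (L.zeroˡ _)
cross-R RG w f = ≋-sym (L.zeroˡ _)

row-∅ : (q : A) (ps : Vec A n) (S : Vec Bool n) (b : State) (f : Vec State n → Laurent A) →
        row q ps (encodeᴬ S) b (λ (as , b′) → [ b′ ≟ ∅ ] ⊗ f as) ≋ [ b ≟ ∅ ] ⊗ f (encodeᴬ S)
row-∅ q []       []      b f = ≋-refl
row-∅ q (p ∷ ps) (l ∷ S) b f = ≋-trans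
  (cong (linear-row q ps (encodeᴬ S) b) λ (as , b′) → cross-∅ l b′ (p / q) (λ a → f (a ∷ as)))
  (row-∅ q ps S b λ as → f (_ ∷ as))

row-R : (q : A) (ps : Vec A n) (S : Vec Bool n) (b : State) (f : Vec State n → Laurent A) → ∣ S ∣ ≡ 0 →
        row q ps (encodeᴬ S) b (λ (as , b′) → [ b′ ≟ R ] ⊗ f as) ≋ [ b ≟ R ] ⊗ f (encodeᴬ S)
row-R q []       []          b f ∣S∣≡0 = ≋-refl
row-R q (p ∷ ps) (false ∷ S) b f ∣S∣≡0 = ≋-trans
  (cong (linear-row q ps (encodeᴬ S) b) λ (as , b′) → cross-R b′ (p / q) (λ a → f (a ∷ as)))
  (row-R q ps S b (λ as → f (∅ ∷ as)) ∣S∣≡0)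

merge-G : (b : State) (f : Bool → Laurent A) → f false ≋ 𝟘 →
          ⟪ merge G b ⟫ 𝟙 𝟙 f ≋ [ b ≟ ∅ ] ⊗ f true
merge-G ∅  f f≋𝟘 = L.+-identityʳ _
merge-G R  f f≋𝟘 = ≋-sym (L.zeroˡ _)
merge-G G  f f≋𝟘 = ≋-sym (L.zeroˡ _)
merge-G RG f f≋𝟘 = ≋-trans (⊗𝟘⊕ f≋𝟘) (≋-sym (L.zeroˡ _))

merge-∅ : (b : State) (f : Bool → Laurent A) → ⟪ merge ∅ b ⟫ 𝟙 𝟙 f ≋ [ b ≟ R ] ⊗ f false
merge-∅ ∅  f = ≋-sym (L.zeroˡ _)
merge-∅ R  f = L.+-identityʳ _
merge-∅ G  f = ≋-sym (L.zeroˡ _)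
merge-∅ RG f = ≋-sym (L.zeroˡ _)

-- The delta prescribes the bottom letters, and these force the lines from the first position on: G
-- arises only from `G` and `∅`, R only from `∅` and `R`. Such a right line leaves the remaining
-- left lines unchanged, with weight 1, so the induction continues with the smaller triangle.
Z-initial : (ps qs : Vec A n) (j : ℕ) (S T : Vec Bool n) → ∣ S ∣ ≡ j →
            Z ps qs (encodeᴬ S) (encodeᴮ T) (δ (block 0 j n)) ≋ δ (block 0 j n) S ⊗ δ (block 0 j n) T
Z-initial [] [] j [] [] ∣S∣≡j = ≋-sym (⊗-identityˡ 𝟙)
Z-initial (p ∷ ps) (q ∷ qs) zero (false ∷ S) (t ∷ T) ∣S∣≡0 = begin
  Z (p ∷ ps) (q ∷ qs) (encodeᴬ (false ∷ S)) (encodeᴮ (t ∷ T)) (δ (block 0 0 _))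
    ≈⟨ (cong (linear-row q ps (encodeᴬ S) _) λ (as , b′) → merge-∅ b′ _) ⟩
  row q ps (encodeᴬ S) (if t then ∅ else R)
    (λ (as , b′) → [ b′ ≟ R ] ⊗ Z ps qs as (encodeᴮ T) (δ (block 0 0 _)))
    ≈⟨ row-R q ps S _ (λ as → Z ps qs as (encodeᴮ T) (δ (block 0 0 _))) ∣S∣≡0 ⟩
  [ (if t then ∅ else R) ≟ R ] ⊗ Z ps qs (encodeᴬ S) (encodeᴮ T) (δ (block 0 0 _))
    ≈⟨ last t ⟩
  δ (block 0 0 _) (false ∷ S) ⊗ δ (block 0 0 _) (t ∷ T) ∎
  where
  open L
  last : ∀ t → [ (if t then ∅ else R) ≟ R ] ⊗ Z ps qs (encodeᴬ S) (encodeᴮ T) (δ (block 0 0 _))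
               ≋ δ (block 0 0 _) (false ∷ S) ⊗ δ (block 0 0 _) (t ∷ T)
  last false = ≋-trans (⊗-identityˡ _) (Z-initial ps qs 0 S T ∣S∣≡0)
  last true  = ≋-trans (L.zeroˡ _) (≋-sym (L.zeroʳ _))
Z-initial (p ∷ ps) (q ∷ qs) (suc j) (false ∷ S) (t ∷ T) ∣S∣≡j = ≋-trans
  (vanish (linear-row q ps (encodeᴬ S) _) λ (as , b′) → ≋-trans (merge-∅ b′ _)
    (≋-trans (⊗-cong ≋-refl (zeroes (linear-Z ps qs as (encodeᴮ T)))) (L.zeroʳ _)))
  (≋-sym (L.zeroˡ _))
Z-initial (p ∷ ps) (q ∷ qs) (suc j) (true ∷ S) (t ∷ T) ∣S∣≡j = begin
  Z (p ∷ ps) (q ∷ qs) (encodeᴬ (true ∷ S)) (encodeᴮ (t ∷ T)) (δ (block 0 (suc j) _))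
    ≈⟨ (cong (linear-row q ps (encodeᴬ S) _) λ (as , b′) →
         merge-G b′ _ (zeroes (linear-Z ps qs as (encodeᴮ T)))) ⟩
  row q ps (encodeᴬ S) (if t then ∅ else R)
    (λ (as , b′) → [ b′ ≟ ∅ ] ⊗ Z ps qs as (encodeᴮ T) (δ (block 0 j _)))
    ≈⟨ row-∅ q ps S _ (λ as → Z ps qs as (encodeᴮ T) (δ (block 0 j _))) ⟩
  [ (if t then ∅ else R) ≟ ∅ ] ⊗ Z ps qs (encodeᴬ S) (encodeᴮ T) (δ (block 0 j _))
    ≈⟨ last t ⟩
  δ (block 0 (suc j) _) (true ∷ S) ⊗ δ (block 0 (suc j) _) (t ∷ T) ∎
  where
  open L
  last : ∀ t → [ (if t then ∅ else R) ≟ ∅ ] ⊗ Z ps qs (encodeᴬ S) (encodeᴮ T) (δ (block 0 j _))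
               ≋ δ (block 0 (suc j) _) (true ∷ S) ⊗ δ (block 0 (suc j) _) (t ∷ T)
  last true  = ≋-trans (⊗-identityˡ _) (Z-initial ps qs j S T (ℕ.suc-injective ∣S∣≡j))
  last false = ≋-trans (L.zeroˡ _) (≋-sym (L.zeroʳ _))

-- Reaching every frame by adding boxes

data _⇝_ : ∀ {n} → Vec Bool n → Vec Bool n → Set where
  done : ∀ {S : Vec Bool n} → S ⇝ S
  _then_ : ∀ {i : Fin n} {S} {T} → Descent i S → swap i S ⇝ T → S ⇝ T

⇝-trans : {S T U : Vec Bool n} → S ⇝ T → T ⇝ U → S ⇝ U
⇝-trans done         q = q
⇝-trans (d then p) q = d then ⇝-trans p q

⇝-∷ : ∀ b {S T : Vec Bool n} → S ⇝ T → (b ∷ S) ⇝ (b ∷ T)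
⇝-∷ b done       = done
⇝-∷ b (d then p) = there d then ⇝-∷ b p

-- The letters true move one place to the right, the last one first.
bubble : (j : ℕ) → j ≤ n → block 0 j (suc n) ⇝ (false ∷ block 0 j n)
bubble zero j≤n = done
bubble (suc j) (s≤s j≤n) = ⇝-trans (⇝-∷ true (bubble j j≤n)) (here then done)

reachable : (S : Vec Bool n) → block 0 ∣ S ∣ n ⇝ S
reachable []          = done
reachable (true ∷ S)  = ⇝-∷ true (reachable S)
reachable (false ∷ S) = ⇝-trans (bubble ∣ S ∣ (∣p∣≤n S)) (⇝-∷ false (reachable S))

⇝-induction : (P : ∀ {n} → Vec Bool n → Set) →
              (∀ {n} {i : Fin n} {S} → Descent i S → P S → P (swap i S)) →
              {S T : Vec Bool n} → S ⇝ T → P S → P T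
⇝-induction P ind done       p = p
⇝-induction P ind (d then r) p = ⇝-induction P ind r (ind d p)

swap-involutive : (i : Fin n) (xs : Vec X (suc n)) → swap i (swap i xs) ≡ xs
swap-involutive zero    (x ∷ y ∷ xs) = refl
swap-involutive (suc i) (x ∷ xs)     = ≡.cong (x ∷_) (swap-involutive i xs)

-- Exactly one of the two exchanged entries is selected, so the selection keeps its order.
Selects-swap : ∀ {i : Fin n} {S} {ys : Vec A (suc n)} {xs : Vec A k} → Descent i S →
               Selects (swap i S) ys xs → Selects S (swap i ys) xs
Selects-swap here      (skip (take s)) = take (skip s)
Selects-swap (there d) (take s)        = take (Selects-swap d s)
Selects-swap (there d) (skip s)        = skip (Selects-swap d s)

-- Pairs of states from `G` and `∅` stay such pairs under `Rᴬ`, whose entries there are those of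
-- `Rᴴ`. Together with its analogue for `Rᴮ` this makes all three sides of the triangle transform
-- alike.
exchange-encodeᴬ : (u : Laurent A) (i : Fin n) (S : Vec Bool (suc n)) (f : Vec State (suc n) → Laurent A) →
                   exchange Rᴬ u i (encodeᴬ S) f ≋ exchange Rᴴ u i S (f ∘ encodeᴬ)
exchange-encodeᴬ u zero (false ∷ false ∷ S) f = ≋-refl
exchange-encodeᴬ u zero (false ∷ true ∷ S)  f = ≋-refl
exchange-encodeᴬ u zero (true ∷ false ∷ S)  f = ≋-refl
exchange-encodeᴬ u zero (true ∷ true ∷ S)   f = ≋-refl
exchange-encodeᴬ u (suc i) (b ∷ S)          f = exchange-encodeᴬ u i S _

exchange-encodeᴮ : (u : Laurent A) (i : Fin n) (S : Vec Bool (suc n)) (f : Vec State (suc n) → Laurent A) →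
                   exchange Rᴮ u i (encodeᴮ S) f ≋ exchange Rᴴ u i S (f ∘ encodeᴮ)
exchange-encodeᴮ u zero (false ∷ false ∷ S) f = ≋-refl
exchange-encodeᴮ u zero (false ∷ true ∷ S)  f = ≋-refl
exchange-encodeᴮ u zero (true ∷ false ∷ S)  f = ≋-refl
exchange-encodeᴮ u zero (true ∷ true ∷ S)   f = ≋-refl
exchange-encodeᴮ u (suc i) (b ∷ S)          f = exchange-encodeᴮ u i S _

exchange-cong-∣∣ : (u : Laurent A) (i : Fin n) (S : Vec Bool (suc n)) {f g : Vec Bool (suc n) → Laurent A} →
                   (∀ T → ∣ T ∣ ≡ ∣ S ∣ → f T ≋ g T) → exchange Rᴴ u i S f ≋ exchange Rᴴ u i S g
exchange-cong-∣∣ u zero (false ∷ false ∷ S) f≋g = ⊕-cong (⊗-cong ≋-refl (f≋g _ refl)) ≋-refl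
exchange-cong-∣∣ u zero (false ∷ true ∷ S)  f≋g =
  ⊕-cong (⊗-cong ≋-refl (f≋g _ refl)) (⊕-cong (⊗-cong ≋-refl (f≋g _ refl)) ≋-refl)
exchange-cong-∣∣ u zero (true ∷ false ∷ S)  f≋g = ⊕-cong (⊗-cong ≋-refl (f≋g _ refl)) ≋-refl
exchange-cong-∣∣ u zero (true ∷ true ∷ S)   f≋g = ⊕-cong (⊗-cong ≋-refl (f≋g _ refl)) ≋-refl
exchange-cong-∣∣ u (suc i) (false ∷ S)      f≋g = exchange-cong-∣∣ u i S λ T eq → f≋g (false ∷ T) eq
exchange-cong-∣∣ u (suc i) (true ∷ S)       f≋g = exchange-cong-∣∣ u i S λ T eq → f≋g (true ∷ T) (≡.cong suc eq)

Multiplicative : (A : Set) (k : ℕ) → Vec Bool n → Set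
Multiplicative {n} A k S = ∀ (ys : Vec A n) (xs : Vec A k) → Selects S ys xs →
  ∀ (T U : Vec Bool n) → ∣ T ∣ ≡ k →
  Z ys ys (encodeᴬ T) (encodeᴮ U) (Γ xs ys) ≋ Γ xs ys T ⊗ Γ xs ys U

multiplicative-initial : Multiplicative {n} A k (block 0 k n)
multiplicative-initial {k = k} ys xs s T U ∣T∣≡k = ≋-trans
  (cong (linear-Z ys ys (encodeᴬ T) (encodeᴮ U)) (Γ-initial s))
  (≋-trans (Z-initial ys ys k T U ∣T∣≡k) (≋-sym (⊗-cong (Γ-initial s T) (Γ-initial s U))))

multiplicative-swap : ∀ {i : Fin n} {S} → Descent i S → Multiplicative A k S → Multiplicative A k (swap i S)
multiplicative-swap {A = A} {i = i} d mult ys xs s T U ∣T∣≡k =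
  -- The exchange leads from `zs` to `swap i zs`, so the induction hypothesis is used at
  -- `zs = swap i ys`.
  ≡.subst (λ zs → Z zs zs (encodeᴬ T) (encodeᴮ U) (Γ xs zs) ≋ Γ xs zs T ⊗ Γ xs zs U)
          (swap-involutive i ys) swapped
  where
  open L
  zs = swap i ys
  u = ratio i zs
  f : Vec Bool _ → Vec Bool _ → Laurent A
  f T′ U′ = Z zs zs (encodeᴬ T′) (encodeᴮ U′) (Γ xs zs)
  swapped : Z (swap i zs) (swap i zs) (encodeᴬ T) (encodeᴮ U) (Γ xs (swap i zs))
            ≋ Γ xs (swap i zs) T ⊗ Γ xs (swap i zs) U
  swapped = begin
    Z (swap i zs) (swap i zs) (encodeᴬ T) (encodeᴮ U) (Γ xs (swap i zs))
      ≈⟨ cong (linear-Z (swap i zs) (swap i zs) (encodeᴬ T) (encodeᴮ U)) (Γ-exchange i xs zs) ⟩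
    Z (swap i zs) (swap i zs) (encodeᴬ T) (encodeᴮ U) (λ V → exchange Rᴴ u i V (Γ xs zs))
      ≈⟨ Z-exchange i zs (encodeᴬ T) (encodeᴮ U) (Γ xs zs) ⟩
    exchange Rᴬ u i (encodeᴬ T) (λ as → exchange Rᴮ u i (encodeᴮ U) λ bs → Z zs zs as bs (Γ xs zs))
      ≈⟨ ≋-trans (exchange-encodeᴬ u i T _)
          (cong (linear-exchange Rᴴ u i T) λ T′ → exchange-encodeᴮ u i U _) ⟩
    exchange Rᴴ u i T (λ T′ → exchange Rᴴ u i U (f T′))
      ≈⟨ (exchange-cong-∣∣ u i T λ T′ eq → ≋-trans
          (cong (linear-exchange Rᴴ u i U) λ U′ →
            mult zs xs (Selects-swap d s) T′ U′ (≡.trans eq ∣T∣≡k))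
          (scale (linear-exchange Rᴴ u i U) (Γ xs zs T′) (Γ xs zs))) ⟩
    exchange Rᴴ u i T (λ T′ → Γ xs zs T′ ⊗ exchange Rᴴ u i U (Γ xs zs))
      ≈⟨ linear-⊗ʳ (linear-exchange Rᴴ u i T) _ (Γ xs zs) ⟩
    exchange Rᴴ u i T (Γ xs zs) ⊗ exchange Rᴴ u i U (Γ xs zs)
      ≈⟨ ⊗-cong (Γ-exchange i xs zs T) (Γ-exchange i xs zs U) ⟨
    Γ xs (swap i zs) T ⊗ Γ xs (swap i zs) U ∎

multiplicative : (S : Vec Bool n) → Multiplicative A ∣ S ∣ S
multiplicative {A = A} S = ⇝-induction (Multiplicative A ∣ S ∣) multiplicative-swap (reachable S)
  multiplicative-initial

-- The number of boxes of the Young diagram, up to a constant.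
height : Vec Bool n → ℕ
height []      = 0
height (b ∷ S) = height S + ∣ S ∣

∣swap∣ : ∀ {i : Fin n} {S} → Descent i S → ∣ swap i S ∣ ≡ ∣ S ∣
∣swap∣ here                  = refl
∣swap∣ (there {b = true} d)  = ≡.cong suc (∣swap∣ d)
∣swap∣ (there {b = false} d) = ∣swap∣ d

height-swap : ∀ {i : Fin n} {S} → Descent i S → height (swap i S) ≡ suc (height S)
height-swap (here {S = S}) = ℕ.+-suc (height S + ∣ S ∣) ∣ S ∣
height-swap (there d)      = ≡.cong₂ _+_ (height-swap d) (∣swap∣ d)

Cancellable : Laurent A → Set
Cancellable g = ∀ f → f ⊗ g ≋ 𝟘 → f ≋ 𝟘

-- Comparing numbers of boxes instead of containment of diagrams makes any two frames comparable and
-- allows an induction on `height`.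
Triangular : (A : Set) (k : ℕ) → Vec Bool n → Set
Triangular {n} A k S = ∀ (ys : Vec A n) (xs : Vec A k) → Unique ys → Selects S ys xs →
  (∀ T → T ≢ S → height S ≤ height T → Γ xs ys T ≋ 𝟘) × Cancellable (Γ xs ys S)

triangular-initial : Triangular {n} A k (block 0 k n)
triangular-initial {n = n} {k = k} ys xs _ s =
  (λ T T≢ _ → ≋-trans (Γ-initial s T) (L.reflexive (δ-≢ (block 0 k n) T (T≢ ∘ ≡.sym)))) ,
  λ f f⊗≋𝟘 → ≋-trans (≋-sym (L.*-identityʳ f)) (≋-trans
    (⊗-cong ≋-refl (≋-sym (≋-trans (Γ-initial s (block 0 k n)) (L.reflexive (δ-refl (block 0 k n))))))
    f⊗≋𝟘)

All-swap : {P : A → Set} (i : Fin n) {xs : Vec A (suc n)} → All P xs → All P (swap i xs)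
All-swap zero    (p ∷ q ∷ ps) = q ∷ p ∷ ps
All-swap (suc i) (p ∷ ps)     = p ∷ All-swap i ps

Unique-swap : (i : Fin n) {xs : Vec A (suc n)} → Unique xs → Unique (swap i xs)
Unique-swap zero    ((x≢y ∷ x≢) ∷ y≢ ∷ uniq) = ((x≢y ∘ ≡.sym) ∷ y≢) ∷ x≢ ∷ uniq
Unique-swap (suc i) (x≢ ∷ uniq)              = All-swap i x≢ ∷ Unique-swap i uniq

module _ (_≟ᴬ_ : DecidableEquality A) where
  -- 1 - p / q is a difference of variables up to the unit q.
  cancellable-ratio : (i : Fin n) (ys : Vec A (suc n)) → Unique ys → Cancellable (𝟙 ⊝ ratio i ys)
  cancellable-ratio zero (p ∷ q ∷ ys) ((p≢q ∷ _) ∷ _) f f⊗≋𝟘 =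
    ⊗-cancelˡ-difference _≟ᴬ_ (p≢q ∘ ≡.sym) (begin
      (var q ⊝ var p) ⊗ f             ≈⟨ ⊗-cong (⊕-cong (L.*-identityʳ _) (⊖-cong q⊗u)) ≋-refl ⟨
      (var q ⊗ 𝟙 ⊝ var q ⊗ u) ⊗ f     ≈⟨ ⊗-cong (⊕-cong ≋-refl (L.-‿distribʳ-* _ _)) ≋-refl ⟩
      (var q ⊗ 𝟙 ⊕ var q ⊗ ⊖ u) ⊗ f   ≈⟨ ⊗-cong (⊗-distribˡ _ _ _) ≋-refl ⟨
      (var q ⊗ (𝟙 ⊝ u)) ⊗ f           ≈⟨ ⊗-assoc _ _ _ ⟩
      var q ⊗ ((𝟙 ⊝ u) ⊗ f)           ≈⟨ ⊗-cong ≋-refl (≋-trans (⊗-comm _ _) f⊗≋𝟘) ⟩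
      var q ⊗ 𝟘                       ≈⟨ L.zeroʳ _ ⟩
      𝟘                               ≈⟨ L.zeroʳ _ ⟨
      (var q ⊝ var p) ⊗ 𝟘             ∎)
    where
    open L
    u = p / q
    q⊗u : var q ⊗ u ≋ var p
    q⊗u = ≋-trans (L.x*yz≈y*xz _ _ _) (≋-trans (⊗-cong ≋-refl (var-inv q)) (L.*-identityʳ _))
  cancellable-ratio (suc i) (_ ∷ ys) (_ ∷ uniq) = cancellable-ratio i ys uniq

  -- By `Γ-exchange`, the value at a frame T is either unchanged or `u` times the old value at T
  -- plus 1 - u times that at T with one box removed. For T at least as high as `swap i S` the old
  -- value at T vanishes; the other term survives only if removing the box gives S, and then
  -- contributes the factor 1 - u to the diagonal.
  triangular-swap : ∀ {i : Fin n} {S} → Descent i S → Triangular A k S → Triangular A k (swap i S)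
  triangular-swap {i = i} {S} d tri ys xs uniq s
    = ≡.subst (λ ws → (∀ T → T ≢ swap i S → height (swap i S) ≤ height T → Γ xs ws T ≋ 𝟘)
                      × Cancellable (Γ xs ws (swap i S)))
              (swap-involutive i ys) (vanishing , cancellable)
    where
    open L
    zs = swap i ys
    u = ratio i zs
    tri′ = tri zs xs (Unique-swap i uniq) (Selects-swap d s)
    height-< : ∀ {T} → height (swap i S) ≤ height T → height S < height T
    height-< {T} = ≡.subst (_≤ height T) (height-swap d)
    higher : ∀ {T} → height (swap i S) ≤ height T → Γ xs zs T ≋ 𝟘
    higher {T} le = proj₁ tri′ T (λ { refl → ℕ.<-irrefl refl (height-< {T} le) }) (ℕ.<⇒≤ (height-< {T} le))
    vanishing : ∀ T → T ≢ swap i S → height (swap i S) ≤ height T → Γ xs (swap i zs) T ≋ 𝟘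
    vanishing T T≢ le with exchange-view i T
    ... | inj₁ fixed = ≋-trans (Γ-exchange i xs zs T) (≋-trans (fixed u (Γ xs zs)) (higher le))
    ... | inj₂ (T′ , d′ , refl) = begin
      Γ xs (swap i zs) (swap i T′)
        ≈⟨ Γ-exchange i xs zs (swap i T′) ⟩
      exchange Rᴴ u i (swap i T′) (Γ xs zs)
        ≈⟨ exchange-descent u d′ (Γ xs zs) ⟩
      u ⊗ Γ xs zs (swap i T′) ⊕ (𝟙 ⊝ u) ⊗ Γ xs zs T′
        ≈⟨ ⊗𝟘⊕ (higher le) ⟩
      (𝟙 ⊝ u) ⊗ Γ xs zs T′
        ≈⟨ ⊗-cong ≋-refl (proj₁ tri′ T′ (λ { refl → T≢ refl })
             (ℕ.s≤s⁻¹ (≡.subst₂ _≤_ (height-swap d) (height-swap d′) le))) ⟩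
      (𝟙 ⊝ u) ⊗ 𝟘
        ≈⟨ L.zeroʳ _ ⟩
      𝟘 ∎
    cancellable : Cancellable (Γ xs (swap i zs) (swap i S))
    cancellable f f⊗≋𝟘 = cancellable-ratio i zs (Unique-swap i uniq) f (proj₂ tri′ _ (begin
      (f ⊗ (𝟙 ⊝ u)) ⊗ Γ xs zs S
        ≈⟨ ⊗-assoc _ _ _ ⟩
      f ⊗ ((𝟙 ⊝ u) ⊗ Γ xs zs S)
        ≈⟨ ⊗-cong ≋-refl (≋-trans (Γ-exchange i xs zs (swap i S))
             (≋-trans (exchange-descent u d (Γ xs zs)) (⊗𝟘⊕ (higher ℕ.≤-refl)))) ⟨
      f ⊗ Γ xs (swap i zs) (swap i S)
        ≈⟨ f⊗≋𝟘 ⟩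
      𝟘 ∎))

  triangular : (S : Vec Bool n) → Triangular A ∣ S ∣ S
  triangular S = ⇝-induction (Triangular A ∣ S ∣) triangular-swap (reachable S) triangular-initial

-- Linear independence of the localizations

∑-subsets-single : (S : Vec Bool n) (f : Vec Bool n → Laurent A) →
                   (∀ T → T ≢ S → f T ≋ 𝟘) → ∑ (subsets n) f ≋ f S
∑-subsets-single []          f f≋𝟘 = L.+-identityʳ _
∑-subsets-single {n = suc n} (b ∷ S) f f≋𝟘 = ≋-trans
  (∑-cartesianProductWith _∷_ (outside ∷ inside ∷ []) (subsets n) f) (byHead b f≋𝟘)
  where
  same : ∀ b → (∀ T → T ≢ (b ∷ S) → f T ≋ 𝟘) → ∑ (subsets n) (f ∘ (b ∷_)) ≋ f (b ∷ S)
  same b f≋𝟘 = ∑-subsets-single S (f ∘ (b ∷_)) λ T T≢ → f≋𝟘 (b ∷ T) (T≢ ∘ Vec.∷-injectiveʳ)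
  other : ∀ b → (∀ T → f (b ∷ T) ≋ 𝟘) → ∑ (subsets n) (f ∘ (b ∷_)) ≋ 𝟘
  other b f≋𝟘 = ≋-trans (∑-cong (subsets n) f≋𝟘) (∑-zero (subsets n))
  byHead : ∀ b → (∀ T → T ≢ (b ∷ S) → f T ≋ 𝟘) →
           ∑ (subsets n) (f ∘ (false ∷_)) ⊕ (∑ (subsets n) (f ∘ (true ∷_)) ⊕ 𝟘) ≋ f (b ∷ S)
  byHead false f≋𝟘 = ≋-trans (⊕-cong (same false f≋𝟘)
    (≋-trans (L.+-identityʳ _) (other true λ T → f≋𝟘 _ λ ()))) (L.+-identityʳ _)
  byHead true  f≋𝟘 = ≋-trans (⊕-cong (other false λ T → f≋𝟘 _ λ ())
    (≋-trans (L.+-identityʳ _) (same true f≋𝟘))) (⊕-identityˡ _)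

module _ {k n : ℕ} (d : Diagram k n → Laurent (Fin n))
         (annihilates : ∀ S → ∣ S ∣ ≡ k → ∃ λ (xs : Vec (Fin n) k) → Selects S (allFin n) xs ×
           ∑ (diagrams k n) (λ ν → d ν ⊗ Γ xs (allFin n) (proj₁ ν)) ≋ 𝟘) where
  private
    -- Extension by zero, so that the sums run over all subsets.
    d̂ : Vec Bool n → Laurent (Fin n)
    d̂ S with ∣ S ∣ ℕ.≟ k
    ... | yes eq = d (S , eq)
    ... | no  _  = 𝟘

    d̂-diagram : ∀ S (eq : ∣ S ∣ ≡ k) → d̂ S ≡ d (S , eq)
    d̂-diagram S eq with ∣ S ∣ ℕ.≟ k
    ... | yes eq′ = ≡.cong (λ e → d (S , e)) (ℕ.≡-irrelevant eq′ eq)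
    ... | no ≢k   = ⊥-elim (≢k eq)

    d̂-other : ∀ S → ∣ S ∣ ≢ k → d̂ S ≡ 𝟘
    d̂-other S ≢k with ∣ S ∣ ℕ.≟ k
    ... | yes eq = ⊥-elim (≢k eq)
    ... | no _   = refl

    -- Localize at S: the terms of smaller height vanish by induction, the other terms besides S by
    -- triangularity, and the diagonal entry can be cancelled.
    vanishes-below : ∀ h S → height S < h → d̂ S ≋ 𝟘
    vanishes-below (suc h) S (s≤s S≤h) with ∣ S ∣ ℕ.≟ k in eq?
    ... | no _     = ≋-refl
    ... | yes refl = proj₂ tri (d (S , refl)) (begin
      d (S , refl) ⊗ Γ xs (allFin n) S
        ≡⟨ ≡.cong (_⊗ Γ xs (allFin n) S) (d̂-diagram S refl) ⟨
      d̂ S ⊗ Γ xs (allFin n) S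
        ≈⟨ ∑-subsets-single S (λ T → d̂ T ⊗ Γ xs (allFin n) T) others ⟨
      ∑ (subsets n) (λ T → d̂ T ⊗ Γ xs (allFin n) T)
        ≈⟨ ∑-diagrams (λ ν → d ν ⊗ Γ xs (allFin n) (proj₁ ν)) (λ T → d̂ T ⊗ Γ xs (allFin n) T)
             (λ T eq → ⊗-cong (L.reflexive (≡.sym (d̂-diagram T eq))) ≋-refl)
             (λ T ≢k → ≋-trans (⊗-cong (L.reflexive (d̂-other T ≢k)) ≋-refl) (L.zeroˡ _)) ⟨
      ∑ (diagrams k n) (λ ν → d ν ⊗ Γ xs (allFin n) (proj₁ ν))
        ≈⟨ proj₂ (proj₂ (annihilates S refl)) ⟩
      𝟘 ∎)
      where
      open L
      xs = proj₁ (annihilates S refl)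
      selected = proj₁ (proj₂ (annihilates S refl))
      tri = triangular Fin._≟_ S (allFin n) xs (tabulate⁺ id) selected
      others : ∀ T → T ≢ S → d̂ T ⊗ Γ xs (allFin n) T ≋ 𝟘
      others T T≢S with height S ℕ.≤? height T
      ... | yes S≤T = ≋-trans (⊗-cong ≋-refl (proj₁ tri T T≢S S≤T)) (L.zeroʳ _)
      ... | no  S≰T = ≋-trans (⊗-cong (vanishes-below h T (ℕ.≤-trans (ℕ.≰⇒> S≰T) S≤h)) ≋-refl) (L.zeroˡ _)

  Γ-independent : ∀ ν → d ν ≋ 𝟘
  Γ-independent (S , eq) = ≋-trans (L.reflexive (≡.sym (d̂-diagram S eq))) (vanishes-below _ S ℕ.≤-refl)

-- Frames and increasing index maps

Increasing : (Fin k → Fin n) → Set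
Increasing ι = ∀ {a b} → a Fin.< b → ι a Fin.< ι b

-- Provides a point of localization for each frame, as uniqueness requires. The recursion replaces
-- `g` by `g ∘ suc`, hence the quantification over `g`.
positions : (S : Vec Bool n) → ∣ S ∣ ≡ k →
            ∃ λ (ι : Fin k → Fin n) → Increasing ι ×
              (∀ {A} (g : Fin n → A) → Selects S (tabulate g) (tabulate (g ∘ ι)))
positions []          refl = (λ ()) , (λ { {()} }) , λ g → []
positions (true ∷ S)  refl = ι′ , incr′ , λ g → take (sel (g ∘ suc))
  where
  ι = proj₁ (positions S refl)
  incr = proj₁ (proj₂ (positions S refl))
  sel = proj₂ (proj₂ (positions S refl))
  ι′ : Fin _ → Fin _
  ι′ zero    = zero
  ι′ (suc i) = suc (ι i)
  incr′ : Increasing ι′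
  incr′ {zero}  {suc b} a<b       = s≤s z≤n
  incr′ {suc a} {suc b} (s≤s a<b) = s≤s (incr a<b)
positions (false ∷ S) eq =
  let (ι , incr , sel) = positions S eq
  in suc ∘ ι , (λ a<b → s≤s (incr a<b)) , λ g → skip (sel (g ∘ suc))

unsuc : (f : Fin k → Fin (suc n)) → (∀ i → f i ≢ zero) → ∃ λ (g : Fin k → Fin n) → ∀ i → f i ≡ suc (g i)
unsuc f f≢0 = (λ i → punchOut (f≢0 i ∘ ≡.sym)) , λ i → ≡.sym (Fin.punchIn-punchOut (f≢0 i ∘ ≡.sym))

unsuc-increasing : (f : Fin k → Fin (suc n)) (g : Fin k → Fin n) → (∀ i → f i ≡ suc (g i)) →
                   Increasing f → Increasing g
unsuc-increasing f g f≡ incr {a} {b} a<b =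
  ℕ.s≤s⁻¹ (≡.subst₂ (λ i j → toℕ i < toℕ j) (f≡ a) (f≡ b) (incr a<b))

-- Shows that every specialization in the definition of the ideal comes from a frame, as existence
-- requires.
frameOf : (ι : Fin k → Fin n) → Increasing ι →
          ∃ λ (S : Vec Bool n) → ∀ {A} (g : Fin n → A) → Selects S (tabulate g) (tabulate (g ∘ ι))
frameOf {zero}  {zero}  ι incr = [] , λ g → []
frameOf {suc k} {zero}  ι incr with ι zero
... | ()
frameOf {zero}  {suc n} ι incr =
  let (S , sel) = frameOf {zero} {n} (λ ()) (λ { {()} }) in false ∷ S , λ g → skip (sel (g ∘ suc))
frameOf {suc k} {suc n} ι incr = byFirst (ι zero) refl
  where
  byFirst : ∀ i → ι zero ≡ i → ∃ λ (S : Vec Bool (suc n)) →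
            ∀ {A} (g : Fin (suc n) → A) → Selects S (tabulate g) (tabulate (g ∘ ι))
  byFirst zero ι0≡ =
    let (ι′ , ι≡) = unsuc (ι ∘ suc) λ i eq →
          ℕ.n≮0 (≡.subst (λ j → toℕ (ι zero) < toℕ j) eq (incr {zero} {suc i} (s≤s z≤n)))
        (S , sel) = frameOf ι′ (unsuc-increasing (ι ∘ suc) ι′ ι≡ (incr ∘ s≤s))
    in true ∷ S , λ g → ≡.subst (Selects (true ∷ S) (tabulate g))
         (≡.cong₂ _∷_ (≡.cong g (≡.sym ι0≡)) (Vec.tabulate-cong λ i → ≡.cong g (≡.sym (ι≡ i))))
         (take (sel (g ∘ suc)))
  byFirst (suc j) ι0≡ =
    let (ι′ , ι≡) = unsuc ι λ
          { zero eq    → Fin.0≢1+n (≡.trans (≡.sym eq) ι0≡)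
          ; (suc i) eq → ℕ.n≮0 (≡.subst (λ j → toℕ (ι zero) < toℕ j) eq (incr {zero} {suc i} (s≤s z≤n))) }
        (S , sel) = frameOf ι′ (unsuc-increasing ι ι′ ι≡ incr)
    in false ∷ S , λ g → ≡.subst (Selects (false ∷ S) (tabulate g))
         (Vec.tabulate-cong λ i → ≡.cong g (≡.sym (ι≡ i))) (skip (sel (g ∘ suc)))

-- The product formula at the point y_S, with the puzzle sums as coefficients.
puzzle-rule : (S : Vec Bool n) (xs : Vec (Fin n) k) → Selects S (allFin n) xs → (λ′ μ : Diagram k n) →
              ∑ (diagrams k n) (λ ν → puzzleSum λ′ μ ν ⊗ Γ xs (allFin n) (proj₁ ν))
              ≋ Γ xs (allFin n) (proj₁ λ′) ⊗ Γ xs (allFin n) (proj₁ μ)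
puzzle-rule {n} S xs s λ′ μ with refl ← Selects-∣∣ s = ≋-trans
  (puzzleSum-Z λ′ μ (Γ xs (allFin n)) (Γ-support xs (allFin n)))
  (multiplicative S (allFin n) xs s (proj₁ λ′) (proj₁ μ) (proj₂ λ′))

specialize-scalar : (ι : Fin k → Fin n) (f : Laurent (Fin n)) → specialize ι (rename inj₂ f) ≡ f
specialize-scalar ι (var a) = refl
specialize-scalar ι (inv a) = refl
specialize-scalar ι 𝟘       = refl
specialize-scalar ι 𝟙       = refl
specialize-scalar ι (f ⊕ g) = ≡.cong₂ _⊕_ (specialize-scalar ι f) (specialize-scalar ι g)
specialize-scalar ι (f ⊗ g) = ≡.cong₂ _⊗_ (specialize-scalar ι f) (specialize-scalar ι g)
specialize-scalar ι (⊖ f)   = ≡.cong ⊖_ (specialize-scalar ι f)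

specialize-sumOver : (ι : Fin k → Fin n) (xs : List X) (f : X → CommutativeRing.Carrier (K_T k n)) →
                     specialize ι (proj₁ (sumOver (K_T k n) xs f)) ≡ ∑ xs (specialize ι ∘ proj₁ ∘ f)
specialize-sumOver ι []       f = refl
specialize-sumOver ι (x ∷ xs) f = ≡.cong (specialize ι (proj₁ (f x)) ⊕_) (specialize-sumOver ι xs f)

theorem2 : ∀ (k n : ℕ) → k ≤ n → 1 ≤ n →
    let open CommutativeRing (K_T k n) in
    (𝒢 : Diagram k n → Carrier) →
    (∀ κ → IsGrothendieck (proj₁ κ) (proj₁ (𝒢 κ))) →
    ∀ (λ′ μ : Diagram k n) (c : Diagram k n → Laurent (Fin n)) →
    (𝒢 λ′ * 𝒢 μ ≈ sumOver (K_T k n) (diagrams k n) (λ ν → scalar (c ν) * 𝒢 ν))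
    ⇔ (∀ ν → c ν ≋ puzzleSum λ′ μ ν)
theorem2 k n k≤n _ 𝒢 isG λ′ μ c = mk⇔ unique expands
  where
  open L
  open CommutativeRing (K_T k n) using () renaming (_≈_ to _≈ᴷ_; _*_ to _*ᴷ_)
  Γ[_] : (Fin k → Fin n) → Diagram k n → Laurent (Fin n)
  Γ[ ι ] ν = Γ (tabulate ι) (allFin n) (proj₁ ν)
  localize : ∀ ι ν → specialize ι (proj₁ (𝒢 ν)) ≋ Γ[ ι ] ν
  localize ι ν = ≋-trans (rename-cong _ (Grothendieck-Γ k≤n (isG ν))) (specialize-Γ ι (proj₁ ν))
  localize-sum : ∀ ι → specialize ι (proj₁ (sumOver (K_T k n) (diagrams k n) (λ ν → scalar (c ν) *ᴷ 𝒢 ν)))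
                       ≋ ∑ (diagrams k n) (λ ν → c ν ⊗ Γ[ ι ] ν)
  localize-sum ι = ≋-trans (L.reflexive (specialize-sumOver ι (diagrams k n) _))
    (∑-cong (diagrams k n) λ ν → ⊗-cong (L.reflexive (specialize-scalar ι (c ν))) (localize ι ν))
  unique : 𝒢 λ′ *ᴷ 𝒢 μ ≈ᴷ sumOver (K_T k n) (diagrams k n) (λ ν → scalar (c ν) *ᴷ 𝒢 ν) →
           ∀ ν → c ν ≋ puzzleSum λ′ μ ν
  unique product ν = ⊝⇒≋ (Γ-independent (λ ν → c ν ⊝ puzzleSum λ′ μ ν) annihilates ν)
    where
    annihilates : ∀ S → ∣ S ∣ ≡ k → ∃ λ (xs : Vec (Fin n) k) → Selects S (allFin n) xs ×
                  ∑ (diagrams k n) (λ ν → (c ν ⊝ puzzleSum λ′ μ ν) ⊗ Γ xs (allFin n) (proj₁ ν)) ≋ 𝟘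
    annihilates S ∣S∣≡k with ι , incr , sel ← positions S ∣S∣≡k = tabulate ι , sel id , (begin
      ∑ (diagrams k n) (λ ν → (c ν ⊝ puzzleSum λ′ μ ν) ⊗ Γ[ ι ] ν)
        -- Subtraction becomes scaling by -1, to which `∑-⊗ˡ` applies.
        ≈⟨ (∑-cong (diagrams k n) λ ν → ≋-trans (L.distribʳ _ _ _) (⊕-cong ≋-refl
             (≋-trans (≋-sym (L.-‿distribˡ-* _ _)) (≋-sym ⊖𝟙⊗)))) ⟩
      ∑ (diagrams k n) (λ ν → c ν ⊗ Γ[ ι ] ν ⊕ ⊖ 𝟙 ⊗ (puzzleSum λ′ μ ν ⊗ Γ[ ι ] ν))
        ≈⟨ ≋-trans (∑-⊕ (diagrams k n) _ _) (⊕-cong ≋-refl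
             (≋-trans (∑-⊗ˡ (diagrams k n) (⊖ 𝟙) _) ⊖𝟙⊗)) ⟩
      ∑ (diagrams k n) (λ ν → c ν ⊗ Γ[ ι ] ν) ⊝ ∑ (diagrams k n) (λ ν → puzzleSum λ′ μ ν ⊗ Γ[ ι ] ν)
        ≈⟨ ⊕-cong (≋-sym (localize-sum ι)) (⊖-cong (puzzle-rule S (tabulate ι) (sel id) λ′ μ)) ⟩
      specialize ι (proj₁ (sumOver (K_T k n) (diagrams k n) (λ ν → scalar (c ν) *ᴷ 𝒢 ν)))
        ⊝ Γ[ ι ] λ′ ⊗ Γ[ ι ] μ
        ≈⟨ ≋⇒⊝ (≋-trans (≋-sym (⊝⇒≋ (product ι incr))) (⊗-cong (localize ι λ′) (localize ι μ))) ⟩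
      𝟘 ∎)
  expands : (∀ ν → c ν ≋ puzzleSum λ′ μ ν) →
            𝒢 λ′ *ᴷ 𝒢 μ ≈ᴷ sumOver (K_T k n) (diagrams k n) (λ ν → scalar (c ν) *ᴷ 𝒢 ν)
  expands c≋ ι incr = ≋⇒⊝ (begin
    specialize ι (proj₁ (𝒢 λ′)) ⊗ specialize ι (proj₁ (𝒢 μ))
      ≈⟨ ⊗-cong (localize ι λ′) (localize ι μ) ⟩
    Γ[ ι ] λ′ ⊗ Γ[ ι ] μ
      ≈⟨ puzzle-rule S (tabulate ι) (sel id) λ′ μ ⟨
    ∑ (diagrams k n) (λ ν → puzzleSum λ′ μ ν ⊗ Γ[ ι ] ν)
      ≈⟨ ∑-cong (diagrams k n) (λ ν → ⊗-cong (c≋ ν) ≋-refl) ⟨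
    ∑ (diagrams k n) (λ ν → c ν ⊗ Γ[ ι ] ν)
      ≈⟨ localize-sum ι ⟨
    specialize ι (proj₁ (sumOver (K_T k n) (diagrams k n) (λ ν → scalar (c ν) *ᴷ 𝒢 ν))) ∎)
    where
    S = proj₁ (frameOf ι incr)
    sel = proj₂ (frameOf ι incr)
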